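{- Let $w_n$ be the number of weak-ordering chains in $\mathcal{WOC}(n)$ subject to the stopping condition $x_{i_1}<x_{i_2}<x_{i_3}$ with $i_1<i_2<i_3$. Then \[ w_n=\sum_{d=0}^{n-1}2^d e_{n,d}+\sum_{j=3}^{n}\sum_{d=0}^{j-3}2^d g_{j,d}. \] The sequence starts $1,3,13,69,401,2433,15121,95441,\dots$, and $W(x)=\sum_{n\ge1}w_nx^n$ satisfies \[ W(x)=\frac{x+x\sqrt{1-8x+8x^2}}{2(1-x)\sqrt{1-8x+8x^2}}. \]
   Context: A weak-ordering chain on $x_1,\dots,x_m$ is an expression $x_{i_1}\,\mathrm{op}\,x_{i_2}\,\mathrm{op}\cdots\mathrm{op}\,x_{i_m}$, where $(i_1,\dots,i_m)$ is an ordering of $[m]$ and each $\mathrm{op}$ is $<$ or $=$; expressions defining the same ordered set partition of $[m]$ are identified. $\mathcal{WOC}(m)$ is the set of these chains. Each chain in $\mathcal{WOC}(m)$, $m\ge 2$, arises uniquely from its restriction to $x_1,\dots,x_{m-1}$ by inserting $x_m$; this gives a rooted tree with root $x_1$ whose level-$m$ nodes are the elements of $\mathcal{WOC}(m)$. The restricted generating tree of order $n$ for a stopping condition is the part of this tree up to level $n$ in which any node containing the stopping condition has no descendants; "the number of weak-ordering chains in $\mathcal{WOC}(n)$ subject to the stopping condition" is the number of leaves of this tree (nodes at level $n$ plus nodes containing the condition), equivalently the number of chains in $\mathcal{WOC}(n)$ avoiding the condition plus, for each $j\le n$, the number of chains in $\mathcal{WOC}(j)$ containing the condition whose restriction to $x_1,\dots,x_{j-1}$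 avoids it. Here a chain contains the stopping condition if there are indices $i_1<i_2<i_3$ with $x_{i_1}<x_{i_2}<x_{i_3}$ in the chain. $e_{n,d}$ is the number of $123$-avoiding permutations of $[n]$ with exactly $d$ descents (a descent of $\sigma$ is an $i$ with $\sigma(i)>\sigma(i+1)$). $g_{j,d}=|\mathcal{G}^d_j(123)|$, where for $j>3$, $1\le d\le j-3$, $\mathcal{G}^d_j(123)$ is the set of permutations $\sigma$ of $[j]$ that contain the pattern $123$, have exactly $d$ descents, and such that the permutation $\sigma'$ obtained by deleting $j$ avoids $123$; $\mathcal{G}^0_3(123)=\{123\}$, and $g_{j,d}=0$ otherwise. -}

module Defs where

open import Data.Nat as ℕ using (ℕ; zero; suc; _+_; _*_; _∸_; _^_)
import Data.Nat.Properties as ℕP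
open import Data.Nat.ListAction using (sum)
open import Data.Bool using (if_then_else_; _∧_)
open import Data.Fin as Fin using (Fin; toℕ)
open import Data.Fin.Properties using (any?; all?) renaming (_≟_ to _≟ᶠ_; _<?_ to _<?ᶠ_)
open import Data.List as List using (List; []; _∷_; length; filter; map; concatMap; allFin; upTo; lookup; take; tabulate)
open import Data.Integer as ℤ using (ℤ; +_)
open import Data.Product using (Σ; ∃; _×_; _,_)
open import Relation.Binary.PropositionalEquality using (_≡_)
open import Relation.Nullary using (¬_; Dec)
open import Relation.Nullary.Decidable using (_×-dec_; _→-dec_; ¬?)
open import Relation.Unary using (Decidable)

count : {A : Set} {P : A → Set} → Decidable P → List A → ℕ
count P? xs = length (filter P? xs)

funs : (m k : ℕ) → List (Fin m → Fin k)
funs zero    k = (λ ()) ∷ []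
funs (suc m) k =
  concatMap (λ a → map (λ f → λ { Fin.zero → a ; (Fin.suc i) → f i }) (funs m k))
            (allFin k)

-- Σ_{i=a}^{b} f i  (empty if b < a)
sumFromTo : ℕ → ℕ → (ℕ → ℕ) → ℕ
sumFromTo a b f = sum (map (λ k → f (a + k)) (upTo (suc b ∸ a)))

Contains123 : List ℕ → Set
Contains123 xs =
  Σ (Fin (length xs)) λ i → Σ (Fin (length xs)) λ j → Σ (Fin (length xs)) λ k →
    (i Fin.< j) × (j Fin.< k) × (lookup xs i ℕ.< lookup xs j) × (lookup xs j ℕ.< lookup xs k)

contains123? : Decidable Contains123
contains123? xs =
  any? λ i → any? λ j → any? λ k →
    (i <?ᶠ j) ×-dec (j <?ᶠ k) ×-dec (lookup xs i ℕP.<? lookup xs j) ×-dec (lookup xs j ℕP.<? lookup xs k)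

toList : {n : ℕ} → (Fin n → Fin n) → List ℕ
toList {n} σ = tabulate (λ i → toℕ (σ i))

-- Weak-ordering chains on x_1..x_m (ordered set partitions of [m]),
-- encoded by rank functions r : Fin m → Fin m whose image is an initial
-- segment {0,…,k-1}: x_i < x_j iff r i < r j, x_i = x_j iff r i = r j.

IsWOC : (m : ℕ) → (Fin m → Fin m) → Set
IsWOC m r = ∀ i (k : Fin m) → k Fin.< r i → ∃ λ j → r j ≡ k

isWOC? : (m : ℕ) → Decidable (IsWOC m)
isWOC? m r = all? λ i → all? λ k → (k <?ᶠ r i) →-dec any? (λ j → r j ≟ᶠ k)

WOC : (m : ℕ) → List (Fin m → Fin m)
WOC m = filter (isWOC? m) (funs m m)

ContainsStop : {m : ℕ} → (Fin m → Fin m) → Set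
ContainsStop r = Contains123 (toList r)

-- the restriction of the chain on x_1..x_j to x_1..x_{j-1} contains the
-- stopping condition (restriction keeps the relative order of the
-- remaining variables, so this is the same test on the first j-1 ranks)
RestrContainsStop : {m : ℕ} → (Fin m → Fin m) → Set
RestrContainsStop {m} r = Contains123 (take (m ∸ 1) (toList r))

-- w_n : leaves of the restricted generating tree of order n
w : ℕ → ℕ
w n = count (λ r → ¬? (contains123? (toList r))) (WOC n)
    + sumFromTo 1 n (λ j →
        count (λ r → contains123? (toList r) ×-dec ¬? (contains123? (take (j ∸ 1) (toList r))))
              (WOC j))

IsPerm : (n : ℕ) → (Fin n → Fin n) → Set
IsPerm n σ = ∀ i j → σ i ≡ σ j → i ≡ j

isPerm? : (n : ℕ) → Decidable (IsPerm n)
isPerm? n σ = all? λ i → all? λ j → (σ i ≟ᶠ σ j) →-dec (i ≟ᶠ j)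

Perms : (n : ℕ) → List (Fin n → Fin n)
Perms n = filter (isPerm? n) (funs n n)

IsDescentAt : {n : ℕ} → (Fin n → Fin n) → Fin n → Set
IsDescentAt {n} σ i = ∃ λ (j : Fin n) → (toℕ j ≡ suc (toℕ i)) × (σ j Fin.< σ i)

des : {n : ℕ} → (Fin n → Fin n) → ℕ
des {n} σ = count (λ i → any? λ j → (toℕ j ℕP.≟ suc (toℕ i)) ×-dec (σ j <?ᶠ σ i)) (allFin n)

e : ℕ → ℕ → ℕ
e n d = count (λ σ → ¬? (contains123? (toList σ)) ×-dec (des σ ℕP.≟ d)) (Perms n)

-- deleting the largest entry n (value n-1 in 0-based one-line notation)
deleteMax : {n : ℕ} → (Fin n → Fin n) → List ℕ
deleteMax {n} σ = filter (λ v → ¬? (v ℕP.≟ (n ∸ 1))) (toList σ)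

gCount : ℕ → ℕ → ℕ
gCount j d = count (λ σ → contains123? (toList σ) ×-dec (des σ ℕP.≟ d)
                          ×-dec ¬? (contains123? (deleteMax σ)))
                   (Perms j)

g : ℕ → ℕ → ℕ
g j d = if (3 ℕ.<ᵇ j) ∧ (1 ℕ.≤ᵇ d) ∧ (d ℕ.≤ᵇ j ∸ 3) then gCount j d
        else (if (j ℕ.≡ᵇ 3) ∧ (d ℕ.≡ᵇ 0) then 1 else 0)

FPS : Set
FPS = ℕ → ℤ

sumℤ : ℕ → (ℕ → ℤ) → ℤ
sumℤ zero    f = f 0
sumℤ (suc n) f = sumℤ n f ℤ.+ f (suc n)

_⊛_ : FPS → FPS → FPS
(a ⊛ b) n = sumℤ n (λ k → a k ℤ.* b (n ∸ k))

P : FPS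
P 0 = + 1
P 1 = ℤ.- (+ 8)
P 2 = + 8
P _ = + 0

twoOneMinusX : FPS
twoOneMinusX 0 = + 2
twoOneMinusX 1 = ℤ.- (+ 2)
twoOneMinusX _ = + 0

X : FPS
X 1 = + 1
X _ = + 0

One : FPS
One 0 = + 1
One _ = + 0

_⊕_ : FPS → FPS → FPS
(a ⊕ b) n = a n ℤ.+ b n

Wser : FPS
Wser zero    = + 0
Wser (suc n) = + w (suc n)

{-# OPTIONS --safe #-}

-- A chain is a permutation in one-line notation whose blocks are written decreasingly, so it amounts to a
-- permutation together with a set of descents turned into equalities, and it contains the stopping condition
-- iff the permutation contains 123.  Both sides are grown one element at a time: appending x_n to a chain,
-- inserting n into a permutation.  The 123-avoiding children of a node depend only on a small state, which
-- gives operators T (chains) and V (permutations); with U summing a function of chain states over the sets of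
-- descents, V U = U T, so both sides have the same counts.
-- A node with k blocks has 2k + 1 children, hence w_(n+1) - w_n is twice the number of blocks of the avoiding
-- chains of size n.  The series counting these from the states b = 0, 1, 2, … satisfy a linear system that is
-- invariant under a shift of b; therefore the shift acts as multiplication by a fixed series θ, and the system
-- closes up to a quadratic equation, whose discriminant is 1 - 8x + 8x².

module Submission where

open import Defs
open import Algebra.Bundles using (CommutativeRing)
open import Algebra.Solver.Ring.AlmostCommutativeRing using (fromCommutativeRing; _-Raw-AlmostCommutative⟶_)
open import Data.Bool using (true; false; if_then_else_)
open import Data.Bool.Properties using (T-≡)
open import Data.Empty using (⊥-elim)
open import Data.Fin as Fin using (Fin; toℕ; fromℕ<)
open import Data.Fin.Properties using (toℕ-injective; toℕ<n; toℕ-fromℕ<; any?) renaming (_<?_ to _<?ᶠ_)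
open import Data.Integer as ℤ using (ℤ)
import Data.Integer.Properties as ℤ
import Data.Integer.Tactic.RingSolver as ℤSolver
open import Data.List using (List; []; _∷_; _++_; map; concatMap; filter; length; upTo; applyUpTo; reverse; lookup; tabulate; allFin; take; cartesianProductWith)

open import Data.List.Membership.Propositional using (_∈_; find; lose)
open import Data.List.Membership.Propositional.Properties
open import Data.List.Membership.Propositional.Properties.WithK using (unique∧set⇒bag)
open import Data.List.Properties using (map-++; map-∘; map-id; map-cong; map-cong-local; map-tabulate; length-map; length-reverse; length-tabulate; reverse-injective; reverse-involutive; unfold-reverse; filter-all; ∷-injective; ∷-injectiveˡ; ∷-injectiveʳ)
open import Data.List.Relation.Binary.BagAndSetEquality using (∼bag⇒↭)
open import Data.List.Relation.Binary.Permutation.Propositional using (_↭_)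
import Data.List.Relation.Binary.Permutation.Propositional.Properties as ↭
open import Data.List.Relation.Binary.Sublist.Propositional as Sub using (_⊆_; []; _∷_; _∷ʳ_; from∈; to∈; ⊆-trans; ⊆-refl)
open import Data.List.Relation.Binary.Sublist.Propositional.Properties using (reverse⁺; map⁺; All-resp-⊆)
open import Data.List.Relation.Unary.All as All using (All; []; _∷_)
import Data.List.Relation.Unary.All.Properties as All
open import Data.List.Relation.Unary.AllPairs as AllPairs using ([]; _∷_)
import Data.List.Relation.Unary.AllPairs.Properties as AllPairs
open import Data.List.Relation.Unary.Any using (Any; here; there)
import Data.List.Relation.Unary.Any.Properties as Any
open import Data.List.Relation.Unary.Unique.Propositional using (Unique)
import Data.List.Relation.Unary.Unique.Propositional.Properties as Unique
open import Data.Maybe using (Maybe; just; nothing)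
open import Data.Nat using (ℕ; zero; suc; pred; _≤_; _<_; _∸_; _*_; _+_; _^_; _⊔_; z≤n; s≤s; s≤s⁻¹)
open import Data.Nat.Induction using (<-rec)
open import Data.Nat.ListAction using (sum)
open import Data.Nat.ListAction.Properties using (sum-↭)
open import Data.Nat.Properties
open import Data.Nat.Tactic.RingSolver using (solve-∀)
open import Data.List.Membership.DecPropositional _≟_ using (_∈?_)
open import Data.Product using (∃; _×_; _,_; proj₁; proj₂)
open import Data.Sum using (inj₁; inj₂)
open import Function using (_∘_; id; mk⇔)
open import Function.Bundles using (Equivalence)
open import Level using (0ℓ)
open import Relation.Binary.Definitions using (tri<; tri≈; tri>)
open import Relation.Binary.PropositionalEquality
import Relation.Binary.Reasoning.Setoid as SetoidReasoning
open import Relation.Nullary using (¬_; Dec; yes; no; does)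
open import Relation.Nullary.Decidable using (dec-true; dec-false; ¬?; _×-dec_)
open import Relation.Unary using (Decidable)

-- The stopping nodes are never counted by themselves. Every child of an avoiding node either avoids
-- or stops, so the avoiding and stopping nodes of one level together are all children of the
-- avoiding nodes one level up. The number of children depends only on the state, through the
-- function `extensions`, and the descent weight of all insertions into a permutation is the image
-- under `U` of that same function. Hence the sums of avoiding and stopping nodes agree on both
-- sides, and the stopping parts agree by cancellation. The obstacle to the generating function is
-- the root: chains without a pattern 12 have no least top, and their equations are not invariant
-- under the shift. They are reached by comparison with the states `H κ κ`, which costs two further
-- families of series. No infinite system is ever solved: each conjectured shift relation has a
-- defect that satisfies a homogeneous system with a factor `X`, which forces the defect to be zero.

private variable
  A B : Set

-- Finite sums, indicators and duplicate-free lists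

∑ : List A → (A → ℕ) → ℕ
∑ xs f = sum (map f xs)

∑-cong : {f g : A → ℕ} (xs : List A) → (∀ {x} → x ∈ xs → f x ≡ g x) → ∑ xs f ≡ ∑ xs g
∑-cong []       h = refl
∑-cong (x ∷ xs) h = cong₂ _+_ (h (here refl)) (∑-cong xs (h ∘ there))

∑-++ : (xs ys : List A) (f : A → ℕ) → ∑ (xs ++ ys) f ≡ ∑ xs f + ∑ ys f
∑-++ []       ys f = refl
∑-++ (x ∷ xs) ys f = trans (cong (f x +_) (∑-++ xs ys f)) (sym (+-assoc (f x) _ _))

∑-map : (g : A → B) (xs : List A) (f : B → ℕ) → ∑ (map g xs) f ≡ ∑ xs (f ∘ g)
∑-map g []       f = refl
∑-map g (x ∷ xs) f = cong (f (g x) +_) (∑-map g xs f)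

∑-concatMap : (g : A → List B) (xs : List A) (f : B → ℕ) →
  ∑ (concatMap g xs) f ≡ ∑ xs (λ x → ∑ (g x) f)
∑-concatMap g []       f = refl
∑-concatMap g (x ∷ xs) f =
  trans (∑-++ (g x) (concatMap g xs) f) (cong (∑ (g x) f +_) (∑-concatMap g xs f))

∑-+ : (xs : List A) (f g : A → ℕ) → ∑ xs (λ x → f x + g x) ≡ ∑ xs f + ∑ xs g
∑-+ []       f g = refl
∑-+ (x ∷ xs) f g rewrite ∑-+ xs f g = lemma (f x) (g x) (∑ xs f) (∑ xs g)
  where
  lemma : ∀ a b c d → a + b + (c + d) ≡ a + c + (b + d)
  lemma = solve-∀

∑-* : (c : ℕ) (xs : List A) (f : A → ℕ) → ∑ xs (λ x → c * f x) ≡ c * ∑ xs f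
∑-* c []       f = sym (*-zeroʳ c)
∑-* c (x ∷ xs) f = trans (cong (c * f x +_) (∑-* c xs f)) (sym (*-distribˡ-+ c (f x) _))

∑-0 : (xs : List A) → ∑ xs (λ _ → 0) ≡ 0
∑-0 []       = refl
∑-0 (x ∷ xs) = ∑-0 xs

∑-↭ : {xs ys : List A} (f : A → ℕ) → xs ↭ ys → ∑ xs f ≡ ∑ ys f
∑-↭ f p = sum-↭ (↭.map⁺ f p)

∑< : ℕ → (ℕ → ℕ) → ℕ
∑< zero    f = 0
∑< (suc n) f = f 0 + ∑< n (f ∘ suc)

∑<-cong : ∀ n {f g : ℕ → ℕ} → (∀ {v} → v < n → f v ≡ g v) → ∑< n f ≡ ∑< n g
∑<-cong zero    h = refl
∑<-cong (suc n) h = cong₂ _+_ (h (s≤s z≤n)) (∑<-cong n (h ∘ s≤s))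

∑<-+ : ∀ n (f g : ℕ → ℕ) → ∑< n (λ v → f v + g v) ≡ ∑< n f + ∑< n g
∑<-+ zero    f g = refl
∑<-+ (suc n) f g rewrite ∑<-+ n (f ∘ suc) (g ∘ suc) = lemma (f 0) (g 0) _ _
  where
  lemma : ∀ a b c d → a + b + (c + d) ≡ a + c + (b + d)
  lemma = solve-∀

∑<-const : ∀ n c → ∑< n (λ _ → c) ≡ n * c
∑<-const zero    c = refl
∑<-const (suc n) c = cong (c +_) (∑<-const n c)

∑<-last : ∀ n f → ∑< (suc n) f ≡ ∑< n f + f n
∑<-last zero    f = +-comm (f 0) 0
∑<-last (suc n) f = trans (cong (f 0 +_) (∑<-last n (f ∘ suc))) (sym (+-assoc (f 0) _ _))

∑<-truncate : ∀ {m n} f → m ≤ n → (∀ {v} → m ≤ v → f v ≡ 0) → ∑< n f ≡ ∑< m f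
∑<-truncate {zero}  {zero}  f m≤n       h = refl
∑<-truncate {zero}  {suc n} f m≤n       h =
  cong₂ _+_ (h z≤n) (∑<-truncate {zero} {n} (f ∘ suc) z≤n (λ _ → h z≤n))
∑<-truncate {suc m} {suc n} f (s≤s m≤n) h =
  cong (f 0 +_) (∑<-truncate (f ∘ suc) m≤n (h ∘ s≤s))

∑-applyUpTo : ∀ n (g : ℕ → A) f → ∑ (applyUpTo g n) f ≡ ∑< n (f ∘ g)
∑-applyUpTo zero    g f = refl
∑-applyUpTo (suc n) g f = cong (f (g 0) +_) (∑-applyUpTo n (g ∘ suc) f)

∑-upTo : ∀ n f → ∑ (upTo n) f ≡ ∑< n f
∑-upTo n f = ∑-applyUpTo n id f

ind : {P : Set} → Dec P → ℕ
ind p? = if does p? then 1 else 0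

module _ {P : Set} (p? : Dec P) where

  ind-yes : P → ind p? ≡ 1
  ind-yes p = cong (if_then 1 else 0) (dec-true p? p)

  ind-no : ¬ P → ind p? ≡ 0
  ind-no ¬p = cong (if_then 1 else 0) (dec-false p? ¬p)

ind-⇔ : {P Q : Set} (p? : Dec P) (q? : Dec Q) → (P → Q) → (Q → P) → ind p? ≡ ind q?
ind-⇔ p? q? f g with q?
... | yes q = ind-yes p? (g q)
... | no ¬q = ind-no p? (¬q ∘ f)

ind-¬ : {P : Set} (p? : Dec P) → ind (¬? p?) + ind p? ≡ 1
ind-¬ (yes _) = refl
ind-¬ (no _)  = refl

count≡∑ : {P : A → Set} (P? : Decidable P) (xs : List A) → count P? xs ≡ ∑ xs (ind ∘ P?)
count≡∑ P? []       = refl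
count≡∑ P? (x ∷ xs) with does (P? x)
... | true  = cong suc (count≡∑ P? xs)
... | false = count≡∑ P? xs

-- Exchange of summation: an `x` with `P x` contributes to the single index `D x`, which the last
-- hypothesis keeps below `m`. The predicate `Q d` is a parameter because `e` and `gCount` arrange
-- their conjuncts differently.
∑-weighted-count : {P : A → Set} (P? : Decidable P) (D : A → ℕ)
  {Q : ℕ → A → Set} (Q? : ∀ d → Decidable (Q d)) →
  (∀ {d x} → Q d x → P x × D x ≡ d) → (∀ {x} → P x → Q (D x) x) →
  ∀ m (f : ℕ → ℕ) (xs : List A) → (∀ {x} → x ∈ xs → P x → D x < m) →
  ∑< m (λ d → f d * count (Q? d) xs) ≡ ∑ xs (λ x → ind (P? x) * f (D x))
∑-weighted-count {P = P} P? D {Q} Q? from to m f []       h =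
  trans (∑<-cong m (λ {d} _ → *-zeroʳ (f d))) (trans (∑<-const m 0) (*-zeroʳ m))
∑-weighted-count {P = P} P? D {Q} Q? from to m f (x ∷ xs) h = begin
  ∑< m (λ d → f d * count (Q? d) (x ∷ xs))
    ≡⟨ ∑<-cong m (λ {d} _ → trans (cong (f d *_) (step d)) (*-distribˡ-+ (f d) _ _)) ⟩
  ∑< m (λ d → f d * ind (Q? d x) + f d * count (Q? d) xs)
    ≡⟨ ∑<-+ m _ _ ⟩
  ∑< m (λ d → f d * ind (Q? d x)) + ∑< m (λ d → f d * count (Q? d) xs)
    ≡⟨ cong₂ _+_ (head (P? x)) (∑-weighted-count P? D Q? from to m f xs (h ∘ there)) ⟩
  ind (P? x) * f (D x) + ∑ xs (λ y → ind (P? y) * f (D y)) ∎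
  where
  open ≡-Reasoning
  step : ∀ d → count (Q? d) (x ∷ xs) ≡ ind (Q? d x) + count (Q? d) xs
  step d = trans (count≡∑ (Q? d) (x ∷ xs)) (cong (ind (Q? d x) +_) (sym (count≡∑ (Q? d) xs)))
  zeros : ∀ n (g : ℕ → ℕ) → (∀ v → g v ≡ 0) → ∑< n g ≡ 0
  zeros n g z = ∑<-truncate {0} {n} g z≤n (λ {v} _ → z v)
  point : ∀ n k (g : ℕ → ℕ) → k < n → (∀ v → v ≢ k → g v ≡ 0) → ∑< n g ≡ g k
  point (suc n) zero    g k<n z = trans (cong (g 0 +_) (zeros n (g ∘ suc) (λ v → z (suc v) λ ()))) (+-identityʳ _)
  point (suc n) (suc k) g (s≤s k<n) z =
    cong₂ _+_ (z 0 λ ()) (point n k (g ∘ suc) k<n (λ v v≢k → z (suc v) (v≢k ∘ suc-injective)))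
  head : (p? : Dec (P x)) → ∑< m (λ d → f d * ind (Q? d x)) ≡ ind p? * f (D x)
  head (yes p) = trans (point m (D x) _ (h (here refl) p)
      (λ d d≢D → trans (cong (f d *_) (ind-no (Q? d x) (λ q → d≢D (sym (proj₂ (from q)))))) (*-zeroʳ (f d))))
    (trans (cong (f (D x) *_) (ind-yes (Q? (D x) x) (to p))) (*-comm (f (D x)) 1))
  head (no ¬p) = zeros m _ (λ d → trans (cong (f d *_) (ind-no (Q? d x) (¬p ∘ proj₁ ∘ from))) (*-zeroʳ (f d)))

-- Since `parent` recovers a node from each of its children, the lists of children of distinct nodes
-- are disjoint.
concatMap-unique : (f : A → List B) (parent : B → A) (xs : List A) →
  (∀ {x} → x ∈ xs → Unique (f x)) → (∀ {x c} → x ∈ xs → c ∈ f x → parent c ≡ x) →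
  Unique xs → Unique (concatMap f xs)
concatMap-unique f parent []       u p []        = []
concatMap-unique f parent (x ∷ xs) u p (x∉ ∷ us) =
  Unique.++⁺ (u (here refl)) (concatMap-unique f parent xs (u ∘ there) (p ∘ there) us) disjoint
  where
  ∈concatMap : ∀ {c} zs → c ∈ concatMap f zs → ∃ λ z → z ∈ zs × c ∈ f z
  ∈concatMap zs c∈ with ∈-concatMap⁻ f {xs = zs} c∈
  ... | any = go any
    where
    go : ∀ {c zs} → Any (λ z → c ∈ f z) zs → ∃ λ z → z ∈ zs × c ∈ f z
    go (here q)  = _ , here refl , q
    go (there a) = let z , z∈ , q = go a in z , there z∈ , q
  disjoint : ∀ {c} → ¬ (c ∈ f x × c ∈ concatMap f xs)
  disjoint (c∈ , c∈′) = let z , z∈ , c∈fz = ∈concatMap xs c∈′ in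
    All.lookup x∉ z∈ (trans (sym (p (here refl) c∈)) (p (there z∈) c∈fz))

-- Functions as words

word : ∀ {m k} → (Fin m → Fin k) → List ℕ
word f = tabulate (toℕ ∘ f)

words : ℕ → ℕ → List (List ℕ)
words m k = map word (funs m k)

words-suc : ∀ m k → words (suc m) k ≡ cartesianProductWith _∷_ (map toℕ (allFin k)) (words m k)
words-suc m k = product _ (λ _ _ → refl) (allFin k) (funs m k)
  where
  -- The pattern-matching function inside `funs` has no name, so `cons` is arbitrary up to its word
  -- and is found by unification.
  product : (cons : Fin k → (Fin m → Fin k) → Fin (suc m) → Fin k) →
    (∀ a f → word (cons a f) ≡ toℕ a ∷ word f) → ∀ as fs →
    map word (concatMap (λ a → map (cons a) fs) as)
      ≡ cartesianProductWith _∷_ (map toℕ as) (map word fs)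
  product cons h []       fs = refl
  product cons h (a ∷ as) fs = begin
    map word (map (cons a) fs ++ concatMap (λ a → map (cons a) fs) as)
      ≡⟨ map-++ word (map (cons a) fs) _ ⟩
    map word (map (cons a) fs) ++ map word (concatMap (λ a → map (cons a) fs) as)
      ≡⟨ cong₂ _++_ (trans (sym (map-∘ fs)) (trans (map-cong (h a) fs) (map-∘ fs)))
                    (product cons h as fs) ⟩
    map (toℕ a ∷_) (map word fs) ++ cartesianProductWith _∷_ (map toℕ as) (map word fs) ∎
    where open ≡-Reasoning

words-unique : ∀ m k → Unique (words m k)
words-unique zero    k = [] ∷ []
words-unique (suc m) k = subst Unique (sym (words-suc m k))
  (Unique.cartesianProductWith⁺ _∷_ ∷-injective
    (Unique.map⁺ toℕ-injective (Unique.allFin⁺ k)) (words-unique m k))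

∈-words : ∀ {m k xs} → length xs ≡ m → All (_< k) xs → xs ∈ words m k
∈-words {k = k} {[]}     refl []         = here refl
∈-words {k = k} {x ∷ xs} refl (x<k ∷ xs<k) = subst (x ∷ xs ∈_) (sym (words-suc (length xs) k))
  (∈-cartesianProductWith⁺ _∷_
    (subst (_∈ map toℕ (allFin k)) (toℕ-fromℕ< x<k) (∈-map⁺ toℕ (∈-allFin (fromℕ< x<k))))
    (∈-words refl xs<k))

-- Duplicate-free lists with the same elements are permutations of each other. Passing to words
-- avoids function extensionality; for the same reason `P` is required of every function with the
-- given word.
filter-words-↭ : ∀ {m} {P : (Fin m → Fin m) → Set} (P? : Decidable P) {zs : List (List ℕ)} →
  Unique zs → (∀ σ → P σ → toList σ ∈ zs) →
  (∀ {xs} → xs ∈ zs → length xs ≡ m × All (_< m) xs × (∀ σ → toList σ ≡ xs → P σ)) →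
  map toList (filter P? (funs m m)) ↭ zs
filter-words-↭ {m} {P} P? {zs} zs! to from =
  ∼bag⇒↭ (unique∧set⇒bag filter! zs! (mk⇔ ⊆-to ⊆-from))
  where
  filter! : Unique (map toList (filter P? (funs m m)))
  filter! = AllPairs.map⁺ (AllPairs.filter⁺ P? (AllPairs.map⁻ (words-unique m m)))
  ⊆-to : ∀ {xs} → xs ∈ map toList (filter P? (funs m m)) → xs ∈ zs
  ⊆-to xs∈ with σ , σ∈ , refl ← ∈-map⁻ toList xs∈ = to σ (proj₂ (∈-filter⁻ P? {xs = funs m m} σ∈))
  ⊆-from : ∀ {xs} → xs ∈ zs → xs ∈ map toList (filter P? (funs m m))
  ⊆-from xs∈ with len , bound , P-of ← from xs∈
    with σ , σ∈ , refl ← ∈-map⁻ word (∈-words len bound) =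
    ∈-map⁺ toList (∈-filter⁺ P? σ∈ (P-of σ refl))

-- Weak-ordering chains

-- A down-closed set of letters is an initial segment, so these are the Cayley permutations, the
-- rank words of ordered set partitions.
Cayley : List ℕ → Set
Cayley xs = ∀ {u v} → v ∈ xs → u < v → u ∈ xs

-- One more than the largest letter, hence the number of blocks of a Cayley word.
width : List ℕ → ℕ
width []       = 0
width (v ∷ ys) = suc v ⊔ width ys

∈⇒<width : ∀ {v ys} → v ∈ ys → v < width ys
∈⇒<width {ys = y ∷ ys} (here refl) = m≤m⊔n (suc y) (width ys)
∈⇒<width {ys = y ∷ ys} (there v∈)  = ≤-trans (∈⇒<width v∈) (m≤n⊔m (suc y) (width ys))

<width⇒≤∈ : ∀ {u} ys → u < width ys → ∃ λ v → v ∈ ys × u ≤ v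
<width⇒≤∈ (y ∷ ys) u< with ⊔-sel (suc y) (width ys)
... | inj₁ eq = y , here refl , s≤s⁻¹ (subst (_ <_) eq u<)
... | inj₂ eq = let v , v∈ , u≤v = <width⇒≤∈ ys (subst (_ <_) eq u<) in v , there v∈ , u≤v

<width⇒∈ : ∀ {u ys} → Cayley ys → u < width ys → u ∈ ys
<width⇒∈ {ys = ys} cay u< with <width⇒≤∈ ys u<
... | v , v∈ , u≤v with m≤n⇒m<n∨m≡n u≤v
... | inj₁ u<v  = cay v∈ u<v
... | inj₂ refl = v∈

-- The increasing injection that misses exactly `v`: the old ranks are renamed by it when a new
-- block is inserted at rank `v`.
bump : ℕ → ℕ → ℕ
bump zero    y       = suc y
bump (suc v) zero    = zero
bump (suc v) (suc y) = suc (bump v y)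

unbump : ℕ → ℕ → ℕ
unbump zero    y       = pred y
unbump (suc v) zero    = zero
unbump (suc v) (suc y) = suc (unbump v y)

unbump-bump : ∀ v y → unbump v (bump v y) ≡ y
unbump-bump zero    y       = refl
unbump-bump (suc v) zero    = refl
unbump-bump (suc v) (suc y) = cong suc (unbump-bump v y)

bump-unbump : ∀ v y → y ≢ v → bump v (unbump v y) ≡ y
bump-unbump zero    zero    y≢v = ⊥-elim (y≢v refl)
bump-unbump zero    (suc y) y≢v = refl
bump-unbump (suc v) zero    y≢v = refl
bump-unbump (suc v) (suc y) y≢v = cong suc (bump-unbump v y (y≢v ∘ cong suc))

bump-≢ : ∀ v y → bump v y ≢ v
bump-≢ (suc v) (suc y) eq = bump-≢ v y (suc-injective eq)

bump-mono-< : ∀ v {y z} → y < z → bump v y < bump v z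
bump-mono-< zero    y<z = s≤s y<z
bump-mono-< (suc v) {zero}  {suc z} y<z = s≤s z≤n
bump-mono-< (suc v) {suc y} {suc z} (s≤s y<z) = s≤s (bump-mono-< v y<z)

bump-cancel-< : ∀ v {y z} → bump v y < bump v z → y < z
bump-cancel-< v {y} {z} h with <-cmp y z
... | tri< y<z _ _ = y<z
... | tri≈ _ refl _ = ⊥-elim (<-irrefl refl h)
... | tri> _ _ z<y = ⊥-elim (<-asym h (bump-mono-< v z<y))

bump-below : ∀ {v y} → y < v → bump v y ≡ y
bump-below {suc v} {zero}  y<v = refl
bump-below {suc v} {suc y} (s≤s y<v) = cong suc (bump-below y<v)

bump-above : ∀ {v y} → v ≤ y → bump v y ≡ suc y
bump-above {zero}  {y}     v≤y = refl
bump-above {suc v} {suc y} (s≤s v≤y) = cong suc (bump-above v≤y)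

-- A letter below `v` is not raised, but there `v` dominates both sides; this is why `width-bump`
-- holds without a bound on `v`.
bump-⊔ : ∀ v u → v ⊔ bump v u ≡ v ⊔ suc u
bump-⊔ zero    u       = refl
bump-⊔ (suc v) zero    = cong suc (sym (⊔-identityʳ v))
bump-⊔ (suc v) (suc u) = cong suc (bump-⊔ v u)

width-bump : ∀ v ys → suc v ⊔ width (map (bump v) ys) ≡ suc (v ⊔ width ys)
width-bump v []       = cong suc (sym (⊔-identityʳ v))
width-bump v (y ∷ ys) = begin
  suc v ⊔ (suc (bump v y) ⊔ w′)       ≡⟨ ⊔-assoc (suc v) (suc (bump v y)) w′ ⟨
  suc (v ⊔ bump v y) ⊔ w′             ≡⟨ cong (λ z → suc z ⊔ w′) (bump-⊔ v y) ⟩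
  suc (v ⊔ suc y) ⊔ w′                ≡⟨ cong (λ z → suc z ⊔ w′) (⊔-comm v (suc y)) ⟩
  (suc (suc y) ⊔ suc v) ⊔ w′          ≡⟨ ⊔-assoc (suc (suc y)) (suc v) w′ ⟩
  suc (suc y) ⊔ (suc v ⊔ w′)          ≡⟨ cong (suc (suc y) ⊔_) (width-bump v ys) ⟩
  suc (suc y ⊔ (v ⊔ width ys))        ≡⟨ cong suc (⊔-assoc (suc y) v (width ys)) ⟨
  suc ((suc y ⊔ v) ⊔ width ys)        ≡⟨ cong (λ z → suc (z ⊔ width ys)) (⊔-comm (suc y) v) ⟩
  suc ((v ⊔ suc y) ⊔ width ys)        ≡⟨ cong suc (⊔-assoc v (suc y) (width ys)) ⟩
  suc (v ⊔ width (y ∷ ys))            ∎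
  where
  open ≡-Reasoning
  w′ = width (map (bump v) ys)

-- Words are listed backwards: the head of a word in CW n is the rank of x_n.

repeats : List ℕ → List (List ℕ)
repeats ys = map (_∷ ys) (upTo (width ys))

splits : List ℕ → List (List ℕ)
splits ys = map (λ v → v ∷ map (bump v) ys) (upTo (suc (width ys)))

children : List ℕ → List (List ℕ)
children ys = repeats ys ++ splits ys

CW : ℕ → List (List ℕ)
CW zero    = [] ∷ []
CW (suc n) = concatMap children (CW n)

data Child (ys : List ℕ) : List ℕ → Set where
  repeat : ∀ {v} → v < width ys → Child ys (v ∷ ys)
  split  : ∀ {v} → v ≤ width ys → Child ys (v ∷ map (bump v) ys)

children⁻ : ∀ {ys c} → c ∈ children ys → Child ys c
children⁻ {ys} c∈ with ∈-++⁻ (repeats ys) c∈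
... | inj₁ p with v , v∈ , refl ← ∈-map⁻ _ p = repeat (∈-upTo⁻ v∈)
... | inj₂ p with v , v∈ , refl ← ∈-map⁻ _ p = split (s≤s⁻¹ (∈-upTo⁻ v∈))

children⁺ : ∀ {ys c} → Child ys c → c ∈ children ys
children⁺ (repeat v<)     = ∈-++⁺ˡ (∈-map⁺ _ (∈-upTo⁺ v<))
children⁺ {ys} (split v≤) = ∈-++⁺ʳ (repeats ys) (∈-map⁺ _ (∈-upTo⁺ (s≤s v≤)))

child-cayley : ∀ {ys c} → Cayley ys → Child ys c → Cayley c
child-cayley cay (repeat v<) (here refl) u< = there (<width⇒∈ cay (<-trans u< v<))
child-cayley cay (repeat v<) (there x∈)  u< = there (cay x∈ u<)
child-cayley {ys} cay (split {v} v≤) (here refl) u< =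
  there (subst (_∈ map (bump v) ys) (bump-below u<) (∈-map⁺ _ (<width⇒∈ cay (<-≤-trans u< v≤))))
child-cayley {ys} cay (split {v} v≤) {u} (there x∈) u<x with ∈-map⁻ _ x∈
... | x′ , x′∈ , refl with u ≟ v
... | yes refl = here refl
... | no u≢v   = there (subst (_∈ map (bump v) ys) (bump-unbump v u u≢v)
  (∈-map⁺ _ (cay x′∈ (bump-cancel-< v (subst (_< bump v x′) (sym (bump-unbump v u u≢v)) u<x)))))

child-width : ∀ {ys v} → v ≤ width ys → width (v ∷ map (bump v) ys) ≡ suc (width ys)
child-width {ys} {v} v≤ = trans (width-bump v ys) (cong suc (m≤n⇒m⊔n≡n v≤))

record IsCW (n : ℕ) (ys : List ℕ) : Set where
  constructor mkCW
  field
    len    : length ys ≡ n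
    cayley : Cayley ys
    width≤ : width ys ≤ n

child-CW : ∀ {n ys c} → IsCW n ys → Child ys c → IsCW (suc n) c
child-CW {n} {ys} (mkCW len cay w≤) ch@(repeat v<) =
  mkCW (cong suc len) (child-cayley cay ch) (subst (_≤ suc n) (sym (m≤n⇒m⊔n≡n v<)) (m≤n⇒m≤1+n w≤))
child-CW {n} {ys} (mkCW len cay w≤) ch@(split {v} v≤) =
  mkCW (cong suc (trans (length-map _ ys) len)) (child-cayley cay ch)
    (subst (_≤ suc n) (sym (child-width {ys} v≤)) (s≤s w≤))

∈-concatMap : {A B : Set} {f : A → List B} {xs : List A} {c : B} →
  c ∈ concatMap f xs → ∃ λ x → x ∈ xs × c ∈ f x
∈-concatMap {f = f} {xs} c∈ = find (∈-concatMap⁻ f {xs = xs} c∈)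
  where open import Data.List.Membership.Propositional using (find)

CW-sound : ∀ n {ys} → ys ∈ CW n → IsCW n ys
CW-sound zero    (here refl) = mkCW refl (λ ()) z≤n
CW-sound (suc n) c∈ = let ys , ys∈ , c∈′ = ∈-concatMap {xs = CW n} c∈ in
  child-CW (CW-sound n ys∈) (children⁻ c∈′)

concatMap-∈ : {A B : Set} (f : A → List B) {xs : List A} {x : A} {c : B} →
  x ∈ xs → c ∈ f x → c ∈ concatMap f xs
concatMap-∈ f {xs = xs} x∈ c∈ = ∈-concatMap⁺ f {xs = xs} (lose x∈ c∈)
  where open import Data.List.Membership.Propositional using (lose)

-- Whether the head letter recurs decides the kind of child. If it does, the tail is already Cayley;
-- if not, the tail misses exactly that letter and `unbump` closes the gap.
CW-complete : ∀ n {ys} → length ys ≡ n → Cayley ys → ys ∈ CW n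
CW-complete zero    {[]}     len cay = here refl
CW-complete (suc n) {v ∷ ys} len cay with v ∈? ys
... | yes v∈ = concatMap-∈ children (CW-complete n (suc-injective len) cay′) (children⁺ (repeat (∈⇒<width v∈)))
  where
  cay′ : Cayley ys
  cay′ x∈ u<x with cay (there x∈) u<x
  ... | here refl = v∈
  ... | there u∈  = u∈
... | no v∉ = subst (λ ys → v ∷ ys ∈ CW (suc n)) restore
  (concatMap-∈ children (CW-complete n (trans (length-map _ ys) (suc-injective len)) cay′) (children⁺ (split (v≤ v refl))))
  where
  zs = map (unbump v) ys
  restore : map (bump v) zs ≡ ys
  restore = trans (sym (map-∘ ys)) (trans (map-cong-local
    (All.tabulate λ {y} y∈ → bump-unbump v y λ { refl → v∉ y∈ })) (map-id ys))
  cay′ : Cayley zs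
  cay′ {u} x∈ u<x with ∈-map⁻ _ x∈
  ... | y , y∈ , refl with cay (there y∈) (subst (bump v u <_) (bump-unbump v y (λ { refl → v∉ y∈ })) (bump-mono-< v u<x))
  ... | here eq  = ⊥-elim (bump-≢ v u eq)
  ... | there u∈ = subst (_∈ zs) (unbump-bump v u) (∈-map⁺ _ u∈)
  -- The letter just below a positive `v` must occur, necessarily in the tail, and closing the gap
  -- above it leaves it in place.
  v≤ : ∀ u → u ≡ v → u ≤ width zs
  v≤ zero    eq = z≤n
  v≤ (suc t) refl with cay (here refl) (n<1+n t)
  ... | here eq  = ⊥-elim (1+n≢n (sym eq))
  ... | there t∈ = subst (_< width zs) (trans (cong (unbump v) (sym (bump-below (n<1+n t)))) (unbump-bump v t))
    (∈⇒<width (∈-map⁺ (unbump v) t∈))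

removeHead : List ℕ → List ℕ
removeHead []       = []
removeHead (v ∷ ys) = if does (v ∈? ys) then ys else map (unbump v) ys

removeHead-child : ∀ {ys c} → Cayley ys → Child ys c → removeHead c ≡ ys
removeHead-child {ys} cay (repeat {v} v<) rewrite dec-true (v ∈? ys) (<width⇒∈ cay v<) = refl
removeHead-child {ys} cay (split {v} v≤)
  rewrite dec-false (v ∈? map (bump v) ys) (λ v∈ → let y , _ , eq = ∈-map⁻ _ v∈ in bump-≢ v y (sym eq)) =
  trans (sym (map-∘ ys)) (trans (map-cong (unbump-bump v) ys) (map-id ys))

children-unique : ∀ {ys} → Cayley ys → Unique (children ys)
children-unique {ys} cay = Unique.++⁺
  (Unique.map⁺ ∷-injectiveˡ (Unique.upTo⁺ _)) (Unique.map⁺ ∷-injectiveˡ (Unique.upTo⁺ _)) disjoint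
  where
  disjoint : ∀ {c} → ¬ (c ∈ repeats ys × c ∈ splits ys)
  disjoint (p , q) with ∈-map⁻ _ p | ∈-map⁻ _ q
  ... | v , v∈ , refl | w , w∈ , eq with refl ← ∷-injectiveˡ eq =
    let y , _ , eq′ = ∈-map⁻ (bump v) (subst (v ∈_) (∷-injectiveʳ eq) (<width⇒∈ cay (∈-upTo⁻ v∈)))
    in bump-≢ v y (sym eq′)

CW-unique : ∀ n → Unique (CW n)
CW-unique zero    = [] ∷ []
CW-unique (suc n) = concatMap-unique children removeHead (CW n)
  (λ ys∈ → children-unique (IsCW.cayley (CW-sound n ys∈)))
  (λ ys∈ c∈ → removeHead-child (IsCW.cayley (CW-sound n ys∈)) (children⁻ c∈)) (CW-unique n)

IsWOC⇔Cayley : ∀ {m} (r : Fin m → Fin m) → (IsWOC m r → Cayley (toList r)) × (Cayley (toList r) → IsWOC m r)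
IsWOC⇔Cayley {m} r = to , from
  where
  to : IsWOC m r → Cayley (toList r)
  to woc {u} v∈ u<v with ∈-tabulate⁻ v∈
  ... | i , refl = subst (_∈ toList r) (trans (cong toℕ (proj₂ j)) (toℕ-fromℕ< u<m)) (∈-tabulate⁺ (proj₁ j))
    where
    u<m = <-trans u<v (toℕ<n (r i))
    j = woc i (fromℕ< u<m) (subst (_< toℕ (r i)) (sym (toℕ-fromℕ< u<m)) u<v)
  from : Cayley (toList r) → IsWOC m r
  from cay i k k<ri with ∈-tabulate⁻ (cay (∈-tabulate⁺ i) k<ri)
  ... | j , eq = j , toℕ-injective (sym eq)

cayley-reverse : ∀ {xs} → Cayley xs → Cayley (reverse xs)
cayley-reverse cay v∈ u<v = Any.reverse⁺ (cay (Any.reverse⁻ v∈) u<v)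

WOC↭CW : ∀ n → map toList (WOC n) ↭ map reverse (CW n)
WOC↭CW n = filter-words-↭ (isWOC? n) (Unique.map⁺ reverse-injective (CW-unique n)) to from
  where
  to : ∀ r → IsWOC n r → toList r ∈ map reverse (CW n)
  to r woc = subst (_∈ map reverse (CW n)) (reverse-involutive (toList r))
    (∈-map⁺ reverse (CW-complete n (trans (length-reverse (toList r)) (length-tabulate _))
      (cayley-reverse (proj₁ (IsWOC⇔Cayley r) woc))))
  from : ∀ {xs} → xs ∈ map reverse (CW n) →
    length xs ≡ n × All (_< n) xs × (∀ r → toList r ≡ xs → IsWOC n r)
  from xs∈ with ys , ys∈ , refl ← ∈-map⁻ reverse xs∈ with mkCW len cay w≤ ← CW-sound n ys∈ =
    trans (length-reverse ys) len ,
    All.tabulate (λ v∈ → <-≤-trans (∈⇒<width {ys = ys} (Any.reverse⁻ v∈)) w≤) ,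
    λ r eq → proj₂ (IsWOC⇔Cayley r) (subst Cayley (sym eq) (cayley-reverse cay))

-- Permutations

ins : ℕ → List ℕ → List (List ℕ)
ins n []       = (n ∷ []) ∷ []
ins n (x ∷ xs) = (n ∷ x ∷ xs) ∷ map (x ∷_) (ins n xs)

PW : ℕ → List (List ℕ)
PW zero    = [] ∷ []
PW (suc n) = concatMap (ins n) (PW n)

without : ℕ → List ℕ → List ℕ
without n = filter (λ v → ¬? (v ≟ n))

data Insert (n : ℕ) : List ℕ → List ℕ → Set where
  front : ∀ {xs} → Insert n xs (n ∷ xs)
  later : ∀ {x xs c} → Insert n xs c → Insert n (x ∷ xs) (x ∷ c)

ins⁻ : ∀ {n c} xs → c ∈ ins n xs → Insert n xs c
ins⁻ []       (here refl) = front
ins⁻ (x ∷ xs) (here refl) = front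
ins⁻ (x ∷ xs) (there c∈) with c′ , c′∈ , refl ← ∈-map⁻ _ c∈ = later (ins⁻ xs c′∈)

ins⁺ : ∀ {n xs c} → Insert n xs c → c ∈ ins n xs
ins⁺ {xs = []}     front     = here refl
ins⁺ {xs = x ∷ xs} front     = here refl
ins⁺               (later i) = there (∈-map⁺ _ (ins⁺ i))

insert-length : ∀ {n xs c} → Insert n xs c → length c ≡ suc (length xs)
insert-length front     = refl
insert-length (later i) = cong suc (insert-length i)

insert-All : ∀ {n xs c} {P : ℕ → Set} → Insert n xs c → P n → All P xs → All P c
insert-All front     p ps       = p ∷ ps
insert-All (later i) p (q ∷ ps) = q ∷ insert-All i p ps

insert-Unique : ∀ {n xs c} → Insert n xs c → All (_≢ n) xs → Unique xs → Unique c
insert-Unique front     ≢n u        = All.map (_∘ sym) ≢n ∷ u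
insert-Unique (later i) (x≢n ∷ ≢n) (x∉ ∷ u) = insert-All i x≢n x∉ ∷ insert-Unique i ≢n u

without-id : ∀ {n xs} → All (_≢ n) xs → without n xs ≡ xs
without-id = filter-all _

without-insert : ∀ {n xs c} → Insert n xs c → All (_≢ n) xs → without n c ≡ xs
without-insert {n} {xs} front ≢n rewrite dec-false (¬? (n ≟ n)) (λ ¬p → ¬p refl) = without-id ≢n
without-insert {n} (later {x} i) (x≢n ∷ ≢n) rewrite dec-true (¬? (x ≟ n)) x≢n = cong (x ∷_) (without-insert i ≢n)

insert-without : ∀ {n c} → Unique c → n ∈ c → Insert n (without n c) c
insert-without {n} {x ∷ c} (x∉ ∷ u) n∈ with x ≟ n
... | yes refl rewrite dec-false (¬? (n ≟ n)) (λ ¬p → ¬p refl)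
                     | without-id {n} {c} (All.map (_∘ sym) x∉) = front
insert-without {n} {x ∷ c} (x∉ ∷ u) (here refl) | no x≢n = ⊥-elim (x≢n refl)
insert-without {n} {x ∷ c} (x∉ ∷ u) (there n∈)  | no x≢n
  rewrite dec-true (¬? (x ≟ n)) x≢n = later (insert-without u n∈)

<suc∧≢⇒< : ∀ {n x} → x < suc n → x ≢ n → x < n
<suc∧≢⇒< x< x≢n = ≤∧≢⇒< (s≤s⁻¹ x<) x≢n

without-bound : ∀ {n} c → All (_< suc n) c → All (_< n) (without n c)
without-bound {n} c c< = All.tabulate λ x∈ →
  let x∈c , x≢n = ∈-filter⁻ (λ v → ¬? (v ≟ n)) {xs = c} x∈ in <suc∧≢⇒< (All.lookup c< x∈c) x≢n

-- The pigeonhole principle, by deleting the largest possible letter; in `PW-complete` it forces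
-- that letter to occur.
unique-length≤ : ∀ n {c} → Unique c → All (_< n) c → length c ≤ n
unique-length≤ zero    {[]}    u c< = z≤n
unique-length≤ zero    {x ∷ c} u (() ∷ _)
unique-length≤ (suc n) {c} u c< with n ∈? c
... | yes n∈ = subst (_≤ suc n) (sym (insert-length (insert-without u n∈)))
  (s≤s (unique-length≤ n (Unique.filter⁺ _ u) (without-bound c c<)))
... | no n∉ = m≤n⇒m≤1+n (unique-length≤ n u (All.tabulate λ x∈ →
  <suc∧≢⇒< (All.lookup c< x∈) λ { refl → n∉ x∈ }))

record IsPW (n : ℕ) (xs : List ℕ) : Set where
  constructor mkPW
  field
    len    : length xs ≡ n
    bound  : All (_< n) xs
    unique : Unique xs
  ≢n : All (_≢ n) xs
  ≢n = All.map <⇒≢ bound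

insert-PW : ∀ {n xs c} → IsPW n xs → Insert n xs c → IsPW (suc n) c
insert-PW {n} p@(mkPW len bound u) i =
  mkPW (trans (insert-length i) (cong suc len)) (insert-All i (n<1+n n) (All.map m≤n⇒m≤1+n bound))
    (insert-Unique i (IsPW.≢n p) u)

PW-sound : ∀ n {xs} → xs ∈ PW n → IsPW n xs
PW-sound zero    (here refl) = mkPW refl [] []
PW-sound (suc n) c∈ = let xs , xs∈ , c∈′ = ∈-concatMap {xs = PW n} c∈ in
  insert-PW (PW-sound n xs∈) (ins⁻ xs c∈′)

PW-complete : ∀ n {c} → IsPW n c → c ∈ PW n
PW-complete zero    {[]} p = here refl
PW-complete (suc n) {c} (mkPW len bound u) with n ∈? c
... | yes n∈ = concatMap-∈ (ins n) (PW-complete n (mkPW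
    (suc-injective (trans (sym (insert-length (insert-without u n∈))) len))
    (without-bound c bound) (Unique.filter⁺ _ u))) (ins⁺ (insert-without u n∈))
... | no n∉ = ⊥-elim (1+n≰n (subst (_≤ n) len (unique-length≤ n u (All.tabulate λ x∈ →
  <suc∧≢⇒< (All.lookup bound x∈) λ { refl → n∉ x∈ }))))

ins-unique : ∀ {n xs} → All (_≢ n) xs → Unique (ins n xs)
ins-unique {n} {[]}     []         = [] ∷ []
ins-unique {n} {x ∷ xs} (x≢n ∷ ≢n) =
  All.map⁺ (All.tabulate λ _ eq → x≢n (sym (∷-injectiveˡ eq))) ∷ Unique.map⁺ ∷-injectiveʳ (ins-unique ≢n)

PW-unique : ∀ n → Unique (PW n)
PW-unique zero    = [] ∷ []
PW-unique (suc n) = concatMap-unique (ins n) (without n) (PW n)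
  (λ xs∈ → ins-unique (IsPW.≢n (PW-sound n xs∈)))
  (λ {xs} xs∈ c∈ → without-insert (ins⁻ xs c∈) (IsPW.≢n (PW-sound n xs∈))) (PW-unique n)

unique-tabulate⁻ : ∀ {A : Set} {n} (f : Fin n → A) → Unique (tabulate f) → ∀ i j → f i ≡ f j → i ≡ j
unique-tabulate⁻ f (x∉ ∷ u) Fin.zero    Fin.zero    eq = refl
unique-tabulate⁻ f (x∉ ∷ u) Fin.zero    (Fin.suc j) eq = ⊥-elim (All.lookup x∉ (∈-tabulate⁺ j) eq)
unique-tabulate⁻ f (x∉ ∷ u) (Fin.suc i) Fin.zero    eq = ⊥-elim (All.lookup x∉ (∈-tabulate⁺ i) (sym eq))
unique-tabulate⁻ f (x∉ ∷ u) (Fin.suc i) (Fin.suc j) eq = cong Fin.suc (unique-tabulate⁻ (f ∘ Fin.suc) u i j eq)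

perm-PW : ∀ {n} (σ : Fin n → Fin n) → IsPerm n σ → IsPW n (toList σ)
perm-PW σ inj = mkPW (length-tabulate _)
  (All.tabulate λ v∈ → let i , eq = ∈-tabulate⁻ v∈ in subst (_< _) (sym eq) (toℕ<n (σ i)))
  (Unique.tabulate⁺ λ {i} {j} eq → inj i j (toℕ-injective eq))

Perms↭PW : ∀ n → map toList (Perms n) ↭ PW n
Perms↭PW n = filter-words-↭ (isPerm? n) (PW-unique n)
  (λ σ inj → PW-complete n (perm-PW σ inj))
  (λ xs∈ → let mkPW len bound u = PW-sound n xs∈ in len , bound ,
    λ σ eq i j σi≡σj → unique-tabulate⁻ (toℕ ∘ σ) (subst Unique (sym eq) u) i j (cong toℕ σi≡σj))

-- The pattern 123 as a sublist

-- With occurrences as sublists instead of index triples, passage to longer words, reversal and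
-- renaming of letters reduce to facts about `⊆`.
record Has123 (xs : List ℕ) : Set where
  constructor has123
  field
    {a b c} : ℕ
    a<b : a < b
    b<c : b < c
    sub : a ∷ b ∷ c ∷ [] ⊆ xs

has123-⊆ : ∀ {xs ys} → xs ⊆ ys → Has123 xs → Has123 ys
has123-⊆ xs⊆ys (has123 a<b b<c sub) = has123 a<b b<c (⊆-trans sub xs⊆ys)

contains⇒has : ∀ {xs} → Contains123 xs → Has123 xs
contains⇒has {xs} (i , j , k , i<j , j<k , a<b , b<c) = has123 a<b b<c (three xs i<j j<k)
  where
  two : ∀ xs {j k} → j Fin.< k → lookup xs j ∷ lookup xs k ∷ [] ⊆ xs
  two (x ∷ xs) {Fin.zero}  {Fin.suc k} j<k = refl ∷ from∈ (∈-lookup k)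
  two (x ∷ xs) {Fin.suc j} {Fin.suc k} (s≤s j<k) = x ∷ʳ two xs j<k
  three : ∀ xs {i j k} → i Fin.< j → j Fin.< k → lookup xs i ∷ lookup xs j ∷ lookup xs k ∷ [] ⊆ xs
  three (x ∷ xs) {Fin.zero}  {Fin.suc j} {Fin.suc k} i<j (s≤s j<k) = refl ∷ two xs j<k
  three (x ∷ xs) {Fin.suc i} {Fin.suc j} {Fin.suc k} (s≤s i<j) (s≤s j<k) = x ∷ʳ three xs i<j j<k

has⇒contains : ∀ {xs} → Has123 xs → Contains123 xs
has⇒contains (has123 a<b b<c sub) with three sub
  where
  one : ∀ {c xs} → c ∷ [] ⊆ xs → ∃ λ k → lookup xs k ≡ c
  one (refl ∷ _) = Fin.zero , refl
  one (_ ∷ʳ p)   = let k , eq = one p in Fin.suc k , eq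
  two : ∀ {b c xs} → b ∷ c ∷ [] ⊆ xs →
    ∃ λ j → ∃ λ k → j Fin.< k × lookup xs j ≡ b × lookup xs k ≡ c
  two (refl ∷ p) = let k , eq = one p in Fin.zero , Fin.suc k , s≤s z≤n , refl , eq
  two (_ ∷ʳ p)   = let j , k , j<k , eqs = two p in Fin.suc j , Fin.suc k , s≤s j<k , eqs
  three : ∀ {a b c xs} → a ∷ b ∷ c ∷ [] ⊆ xs → ∃ λ i → ∃ λ j → ∃ λ k → i Fin.< j × j Fin.< k ×
    lookup xs i ≡ a × lookup xs j ≡ b × lookup xs k ≡ c
  three (refl ∷ p) = let j , k , j<k , eqs = two p in
    Fin.zero , Fin.suc j , Fin.suc k , s≤s z≤n , s≤s j<k , refl , eqs
  three (_ ∷ʳ p)   = let i , j , k , i<j , j<k , eqs = three p in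
    Fin.suc i , Fin.suc j , Fin.suc k , s≤s i<j , s≤s j<k , eqs
... | i , j , k , i<j , j<k , refl , refl , refl = i , j , k , i<j , j<k , a<b , b<c

-- The stopping condition as it appears in the backwards words of `CW`.
record Has321 (ys : List ℕ) : Set where
  constructor has321
  field
    {a b c} : ℕ
    a<b : a < b
    b<c : b < c
    sub : c ∷ b ∷ a ∷ [] ⊆ ys

has321⇒contains : ∀ {ys} → Has321 ys → Contains123 (reverse ys)
has321⇒contains (has321 a<b b<c sub) = has⇒contains (has123 a<b b<c (reverse⁺ sub))

contains⇒has321 : ∀ {ys} → Contains123 (reverse ys) → Has321 ys
contains⇒has321 {ys} h with has123 a<b b<c sub ← contains⇒has {reverse ys} h =
  has321 a<b b<c (subst (_ ⊆_) (reverse-involutive ys) (reverse⁺ sub))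

map-⊆⁻ : ∀ {A B : Set} (f : A → B) {zs} ys → zs ⊆ map f ys → ∃ λ ws → ws ⊆ ys × zs ≡ map f ws
map-⊆⁻ f []       []         = [] , [] , refl
map-⊆⁻ f (y ∷ ys) (_ ∷ʳ p)   = let ws , q , eq = map-⊆⁻ f ys p in ws , y ∷ʳ q , eq
map-⊆⁻ f (y ∷ ys) (refl ∷ p) = let ws , q , eq = map-⊆⁻ f ys p in y ∷ ws , refl ∷ q , cong (f y ∷_) eq

-- Least tops and the states of chains

-- Excludes every pattern 12 of the chain, adjacent or not; in a backwards word the larger letter
-- comes first.
NoAscent : List ℕ → Set
NoAscent ys = ∀ {a b} → a < b → ¬ (b ∷ a ∷ [] ⊆ ys)

-- t is the least rank at the top of a pattern 12, so appending the rank v creates a 123 iff t < v.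
record MinTop (t : ℕ) (ys : List ℕ) : Set where
  constructor mkTop
  field
    attained : ∃ λ a → a < t × t ∷ a ∷ [] ⊆ ys
    minimal  : ∀ {a b} → a < b → b ∷ a ∷ [] ⊆ ys → t ≤ b
    avoids   : ¬ Has321 ys

noAscent-avoids : ∀ {ys} → NoAscent ys → ¬ Has321 ys
noAscent-avoids flat (has321 {c = c} a<b b<c sub) = flat a<b (⊆-trans (c ∷ʳ refl ∷ refl ∷ []) sub)

noAscent-zero : ∀ {ys} → NoAscent ys → NoAscent (0 ∷ ys)
noAscent-zero flat a<b (_ ∷ʳ p)   = flat a<b p
noAscent-zero flat ()  (refl ∷ p)

minTop-zero : ∀ {t ys} → MinTop t ys → MinTop t (0 ∷ ys)
minTop-zero {t} {ys} (mkTop (a , a<t , sub) min av) = mkTop (a , a<t , 0 ∷ʳ sub) min′ av′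
  where
  min′ : ∀ {a b} → a < b → b ∷ a ∷ [] ⊆ 0 ∷ ys → t ≤ b
  min′ a<b (_ ∷ʳ p)   = min a<b p
  min′ ()  (refl ∷ p)
  av′ : ¬ Has321 (0 ∷ ys)
  av′ (has321 a<b b<c (_ ∷ʳ p))  = av (has321 a<b b<c p)
  av′ (has321 a<b () (refl ∷ p))

-- Rank 0 occurs, so a positive new letter tops a pattern 12. Being at most every earlier top, it
-- becomes the least one and completes no 123.
minTop-cons : ∀ {v ys} → 0 ∈ ys → (∀ {a b} → a < b → b ∷ a ∷ [] ⊆ ys → suc v ≤ b) →
  ¬ Has321 ys → MinTop (suc v) (suc v ∷ ys)
minTop-cons {v} {ys} 0∈ min av = mkTop (0 , s≤s z≤n , refl ∷ from∈ 0∈) min′ av′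
  where
  min′ : ∀ {a b} → a < b → b ∷ a ∷ [] ⊆ suc v ∷ ys → suc v ≤ b
  min′ a<b (_ ∷ʳ p)   = min a<b p
  min′ a<b (refl ∷ p) = ≤-refl
  av′ : ¬ Has321 (suc v ∷ ys)
  av′ (has321 a<b b<c (_ ∷ʳ p))   = av (has321 a<b b<c p)
  av′ (has321 a<b b<c (refl ∷ p)) = <⇒≱ b<c (min a<b p)

has321-cons : ∀ {v ys} → Has321 ys → Has321 (v ∷ ys)
has321-cons (has321 a<b b<c sub) = has321 a<b b<c (_ ∷ʳ sub)

minTop-above : ∀ {t v ys} → MinTop t ys → t < v → Has321 (v ∷ ys)
minTop-above (mkTop (a , a<t , sub) _ _) t<v = has321 a<t t<v (refl ∷ sub)

has321-bump : ∀ v {ys} → Has321 ys → Has321 (map (bump v) ys)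
has321-bump v (has321 a<b b<c sub) = has321 (bump-mono-< v a<b) (bump-mono-< v b<c) (map⁺ (bump v) sub)

has321-bump⁻ : ∀ v {ys} → Has321 (map (bump v) ys) → Has321 ys
has321-bump⁻ v {ys} (has321 a<b b<c sub) with map-⊆⁻ (bump v) ys sub
... | c ∷ b ∷ a ∷ [] , sub′ , refl = has321 (bump-cancel-< v a<b) (bump-cancel-< v b<c) sub′

noAscent-bump : ∀ v {ys} → NoAscent ys → NoAscent (map (bump v) ys)
noAscent-bump v {ys} flat a<b sub with map-⊆⁻ (bump v) ys sub
... | b ∷ a ∷ [] , sub′ , refl = flat (bump-cancel-< v a<b) sub′

bump-mono-≤ : ∀ v {y z} → y ≤ z → bump v y ≤ bump v z
bump-mono-≤ v {y} {z} y≤z = ≮⇒≥ (λ h → <⇒≱ (bump-cancel-< v h) y≤z)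

minTop-bump : ∀ v {t ys} → MinTop t ys → MinTop (bump v t) (map (bump v) ys)
minTop-bump v {t} {ys} (mkTop (a , a<t , sub) min av) =
  mkTop (bump v a , bump-mono-< v a<t , map⁺ (bump v) sub) min′ (av ∘ has321-bump⁻ v)
  where
  min′ : ∀ {a b} → a < b → b ∷ a ∷ [] ⊆ map (bump v) ys → bump v t ≤ b
  min′ a<b sub with map-⊆⁻ (bump v) ys sub
  ... | b ∷ a ∷ [] , sub′ , refl = bump-mono-≤ v (min (bump-cancel-< v a<b) sub′)

-- N κ: a weakly decreasing word with κ + 1 blocks;
-- H b κ: a 123-avoiding word with κ + 1 blocks and least top b + 1 of a pattern 12.
data ChainState : Set where
  N : ℕ → ChainState
  H : ℕ → ℕ → ChainState

Reaches : ChainState → List ℕ → Set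
Reaches (N κ)   ys = Cayley ys × width ys ≡ suc κ × NoAscent ys
Reaches (H b κ) ys = Cayley ys × width ys ≡ suc κ × MinTop (suc b) ys

-- In each clause one line collects the repeats and one the splits. The new rank 0 tops nothing and
-- stands apart, a split there raising the old least top by one. The new rank `suc v` becomes the
-- least top; from `H b κ` only `v ≤ b` appears, since a higher rank completes a 123.
T : (ChainState → ℕ) → ChainState → ℕ
T f (N κ)   = (f (N κ) + ∑< κ (λ v → f (H v κ)))
            + (f (N (suc κ)) + ∑< (suc κ) (λ v → f (H v (suc κ))))
T f (H b κ) = (f (H b κ) + ∑< (suc b) (λ v → f (H v κ)))
            + (f (H (suc b) (suc κ)) + ∑< (suc b) (λ v → f (H v (suc κ))))

record _Represents_ (F : List ℕ → ℕ) (f : ChainState → ℕ) : Set where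
  constructor mkRep
  field
    reached : ∀ s {ys} → Reaches s ys → F ys ≡ f s
    stopped : ∀ {ys} → Has321 ys → F ys ≡ 0

∑-children : ∀ ys F → ∑ (children ys) F ≡
  ∑< (width ys) (λ v → F (v ∷ ys)) + ∑< (suc (width ys)) (λ v → F (v ∷ map (bump v) ys))
∑-children ys F = trans (∑-++ (repeats ys) (splits ys) F) (cong₂ _+_
  (trans (∑-map (_∷ ys) (upTo (width ys)) F) (∑-upTo (width ys) (F ∘ (_∷ ys))))
  (trans (∑-map (λ v → v ∷ map (bump v) ys) (upTo (suc (width ys))) F) (∑-upTo (suc (width ys)) _)))

-- A 321 persists in every child, which preserves vanishing on stopped words; the children of a word
-- in a given state fall into the states that `T` lists.
represents-T : ∀ {F f} → F Represents f → (λ ys → ∑ (children ys) F) Represents (T f)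
represents-T {F} {f} (mkRep reached stopped) = mkRep reached′ stopped′
  where
  reached′ : ∀ s {ys} → Reaches s ys → ∑ (children ys) F ≡ T f s
  reached′ (N κ) {ys} (cay , w≡ , flat) = trans (∑-children ys F) (step (width ys) w≡)
    where
    0∈ : 0 ∈ ys
    0∈ = <width⇒∈ cay (subst (0 <_) (sym w≡) (s≤s z≤n))
    repeat′ : ∀ {v} → v < suc κ → Child ys (v ∷ ys)
    repeat′ v< = repeat (subst (_ <_) (sym w≡) v<)
    rep-width : ∀ {v} → v < suc κ → width (v ∷ ys) ≡ suc κ
    rep-width v< = trans (m≤n⇒m⊔n≡n (subst (_ ≤_) (sym w≡) v<)) w≡
    split≤ : ∀ {v} → v ≤ suc κ → v ≤ width ys
    split≤ v≤ = subst (_ ≤_) (sym w≡) v≤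
    split-width : ∀ {v} → v ≤ suc κ → width (v ∷ map (bump v) ys) ≡ suc (suc κ)
    split-width v≤ = trans (child-width {ys} (split≤ v≤)) (cong suc w≡)
    step : ∀ w → w ≡ suc κ →
      ∑< w (λ v → F (v ∷ ys)) + ∑< (suc w) (λ v → F (v ∷ map (bump v) ys)) ≡ T f (N κ)
    step _ refl = cong₂ _+_
      (cong₂ _+_
        (reached (N κ) (child-cayley cay (repeat′ (s≤s z≤n)) , rep-width (s≤s z≤n) , noAscent-zero flat))
        (∑<-cong κ λ {v} v< → reached (H v κ) (child-cayley cay (repeat′ (s≤s v<)) , rep-width (s≤s v<) ,
          minTop-cons 0∈ (λ a<b p → ⊥-elim (flat a<b p)) (noAscent-avoids flat))))
      (cong₂ _+_
        (reached (N (suc κ)) (child-cayley cay (split z≤n) , split-width z≤n ,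
          noAscent-zero (noAscent-bump 0 flat)))
        (∑<-cong (suc κ) λ {v} v< → reached (H v (suc κ)) (child-cayley cay (split (split≤ v<)) , split-width v< ,
          minTop-cons (∈-map⁺ (bump (suc v)) 0∈) (λ a<b p → ⊥-elim (noAscent-bump (suc v) flat a<b p))
            (noAscent-avoids (noAscent-bump (suc v) flat)))))
  reached′ (H b κ) {ys} (cay , w≡ , top@(mkTop (a , a<t , sub) min av)) =
    trans (∑-children ys F) (step (width ys) w≡)
    where
    0∈ : 0 ∈ ys
    0∈ = <width⇒∈ cay (subst (0 <_) (sym w≡) (s≤s z≤n))
    b<κ : suc b ≤ κ
    b<κ = s≤s⁻¹ (subst (suc b <_) w≡ (∈⇒<width (to∈ sub)))
    repeat′ : ∀ {v} → v < suc κ → Child ys (v ∷ ys)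
    repeat′ v< = repeat (subst (_ <_) (sym w≡) v<)
    rep-width : ∀ {v} → v < suc κ → width (v ∷ ys) ≡ suc κ
    rep-width v< = trans (m≤n⇒m⊔n≡n (subst (_ ≤_) (sym w≡) v<)) w≡
    split≤ : ∀ {v} → v ≤ suc κ → v ≤ width ys
    split≤ v≤ = subst (_ ≤_) (sym w≡) v≤
    split-width : ∀ {v} → v ≤ suc κ → width (v ∷ map (bump v) ys) ≡ suc (suc κ)
    split-width v≤ = trans (child-width {ys} (split≤ v≤)) (cong suc w≡)
    bump-top : ∀ {v} → v ≤ b → MinTop (suc (suc b)) (map (bump (suc v)) ys)
    bump-top {v} v≤b = subst (λ t → MinTop (suc t) (map (bump (suc v)) ys)) (bump-above v≤b) (minTop-bump (suc v) top)
    step : ∀ w → w ≡ suc κ →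
      ∑< w (λ v → F (v ∷ ys)) + ∑< (suc w) (λ v → F (v ∷ map (bump v) ys)) ≡ T f (H b κ)
    step _ refl = cong₂ _+_
      (cong₂ _+_
        (reached (H b κ) (child-cayley cay (repeat′ (s≤s z≤n)) , rep-width (s≤s z≤n) , minTop-zero top))
        (trans (∑<-truncate _ b<κ λ b<v → stopped (minTop-above top (s≤s b<v)))
          (∑<-cong (suc b) λ {v} v< → reached (H v κ)
            (child-cayley cay (repeat′ (s≤s (≤-trans v< b<κ))) , rep-width (s≤s (≤-trans v< b<κ)) ,
             minTop-cons 0∈ (λ a<b p → ≤-trans v< (min a<b p)) av))))
      (cong₂ _+_
        (reached (H (suc b) (suc κ)) (child-cayley cay (split z≤n) , split-width z≤n ,
          minTop-zero (minTop-bump 0 top)))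
        -- A split above the old least top leaves that top in place, below the new letter, and so
        -- completes a 123. A split at or below it pushes it up by one, which is `bump-top`.
        (trans (∑<-truncate {m = suc b} _ (m≤n⇒m≤1+n b<κ) λ {v} b<v → stopped
            (minTop-above (subst (λ t → MinTop t (map (bump (suc v)) ys)) (bump-below (s≤s b<v)) (minTop-bump (suc v) top)) (s≤s b<v)))
          (∑<-cong (suc b) λ {v} v< →
            let v≤ = ≤-trans v< (m≤n⇒m≤1+n b<κ) in reached (H v (suc κ))
            (child-cayley cay (split (split≤ v≤)) , split-width v≤ ,
             minTop-cons (∈-map⁺ (bump (suc v)) 0∈)
               (λ a<b p → ≤-trans v< (≤-trans (n≤1+n (suc b)) (MinTop.minimal (bump-top (s≤s⁻¹ v<)) a<b p)))
               (MinTop.avoids (bump-top (s≤s⁻¹ v<)))))))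
  child-stopped : ∀ {ys c} → Has321 ys → Child ys c → Has321 c
  child-stopped h (repeat _)    = has321-cons h
  child-stopped h (split {v} _) = has321-cons (has321-bump v h)
  stopped′ : ∀ {ys} → Has321 ys → ∑ (children ys) F ≡ 0
  stopped′ {ys} h = trans (∑-cong (children ys) λ c∈ → stopped (child-stopped h (children⁻ c∈))) (∑-0 (children ys))

infixr 8 _^^_
_^^_ : {A : Set} → (A → A) → ℕ → A → A
(F ^^ zero)  x = x
(F ^^ suc n) x = F ((F ^^ n) x)

^^-comm : {A : Set} (F : A → A) (n : ℕ) (x : A) → (F ^^ n) (F x) ≡ (F ^^ suc n) x
^^-comm F zero    x = refl
^^-comm F (suc n) x = cong F (^^-comm F n x)

-- The empty word has no state, so the count starts from the one-letter chain, whose state is `N 0`.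
-- Each level of the tree is traded for one application of `T` to the summed function.
∑-CW : ∀ n {F f} → F Represents f → ∑ (CW (suc n)) F ≡ (T ^^ n) f (N 0)
∑-CW zero {F} rep = trans (+-identityʳ _) (_Represents_.reached rep (N 0) {0 ∷ []} (cay , refl , flat))
  where
  cay : Cayley (0 ∷ [])
  cay (here refl) ()
  flat : NoAscent (0 ∷ [])
  flat a<b (_ ∷ʳ ())
  flat () (refl ∷ p)
∑-CW (suc n) {F} {f} rep = trans (∑-concatMap children (CW (suc n)) F)
  (trans (∑-CW n (represents-T rep)) (cong (λ g → g (N 0)) (^^-comm T n f)))

-- Sums over sets of descents and the states of permutations

-- Bin p φ is the sum of φ ∣s∣ over the subsets s of a p-element set.
Bin : ℕ → (ℕ → ℕ) → ℕ
Bin zero    φ = φ 0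
Bin (suc p) φ = Bin p φ + Bin p (φ ∘ suc)

Bin-cong : ∀ p {φ ψ : ℕ → ℕ} → (∀ i → φ i ≡ ψ i) → Bin p φ ≡ Bin p ψ
Bin-cong zero    h = h 0
Bin-cong (suc p) h = cong₂ _+_ (Bin-cong p h) (Bin-cong p (h ∘ suc))

Bin-+ : ∀ p (φ ψ : ℕ → ℕ) → Bin p (λ i → φ i + ψ i) ≡ Bin p φ + Bin p ψ
Bin-+ zero    φ ψ = refl
Bin-+ (suc p) φ ψ rewrite Bin-+ p φ ψ | Bin-+ p (φ ∘ suc) (ψ ∘ suc) = lemma (Bin p φ) (Bin p ψ) _ _
  where
  lemma : ∀ a b c d → a + b + (c + d) ≡ a + c + (b + d)
  lemma = solve-∀

Bin-0 : ∀ p → Bin p (λ _ → 0) ≡ 0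
Bin-0 zero    = refl
Bin-0 (suc p) = cong₂ _+_ (Bin-0 p) (Bin-0 p)

Bin-∑< : ∀ p n (φ : ℕ → ℕ → ℕ) → Bin p (λ i → ∑< n (λ v → φ v i)) ≡ ∑< n (λ v → Bin p (φ v))
Bin-∑< p zero    φ = Bin-0 p
Bin-∑< p (suc n) φ = trans (Bin-+ p (φ 0) _) (cong (Bin p (φ 0) +_) (Bin-∑< p n (φ ∘ suc)))

Bin-split : ∀ p q φ → Bin (p + q) φ ≡ Bin p (λ i → Bin q (λ j → φ (i + j)))
Bin-split zero    q φ = refl
Bin-split (suc p) q φ = cong₂ _+_ (Bin-split p q φ) (Bin-split p q (φ ∘ suc))

Bin-const : ∀ p c → Bin p (λ _ → c) ≡ 2 ^ p * c
Bin-const zero    c = sym (+-identityʳ c)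
Bin-const (suc p) c rewrite Bin-const p c = lemma (2 ^ p) c
  where
  lemma : ∀ a c → a * c + a * c ≡ (a + (a + 0)) * c
  lemma = solve-∀

-- A subset and its complement have `p` elements together, so `2 * i` averages to `p` over the
-- `2 ^ p` subsets.
Bin-affine : ∀ p c → Bin p (λ i → 2 * i + c) ≡ 2 ^ p * (p + c)
Bin-affine zero    c = sym (+-identityʳ c)
Bin-affine (suc p) c = trans
  (cong₂ _+_ (Bin-affine p c)
    (trans (Bin-cong p (λ i → shift i c)) (Bin-affine p (2 + c))))
  (lemma (2 ^ p) p c)
  where
  shift : ∀ i c → 2 * suc i + c ≡ 2 * i + (2 + c)
  shift = solve-∀
  lemma : ∀ a p c → a * (p + c) + a * (p + (2 + c)) ≡ (a + (a + 0)) * (suc p + c)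
  lemma = solve-∀

-- PN p: a decreasing permutation with p descents.  PH p s a: the initial decreasing run
-- has p descents, there are s further descents and a + 1 ascents.
data PermState : Set where
  PN : ℕ → PermState
  PH : ℕ → ℕ → ℕ → PermState

-- The effect of a new letter in front. One larger than the old first letter (`up`) lengthens the
-- initial decreasing run; a smaller one (`asc`) starts a new run, and the descents of the old run
-- become further descents.
up asc : PermState → PermState
up (PN p)      = PN (suc p)
up (PH p s a)  = PH (suc p) s a
asc (PN p)     = PH 0 p 0
asc (PH p s a) = PH 0 (p + s) (suc a)

descents : PermState → ℕ
descents (PN p)     = p
descents (PH p s a) = p + s

stateFrom : ℕ → List ℕ → PermState
stateFrom x []       = PN 0
stateFrom x (y ∷ ys) = if does (y <? x) then up (stateFrom y ys) else asc (stateFrom y ys)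

state : List ℕ → PermState
state []       = PN 0
state (x ∷ xs) = stateFrom x xs

stateFrom-> : ∀ {x y} ys → y < x → stateFrom x (y ∷ ys) ≡ up (stateFrom y ys)
stateFrom-> {x} {y} ys y<x rewrite dec-true (y <? x) y<x = refl

stateFrom-< : ∀ {x y} ys → x < y → stateFrom x (y ∷ ys) ≡ asc (stateFrom y ys)
stateFrom-< {x} {y} ys x<y rewrite dec-false (y <? x) (<-asym x<y) = refl

-- V sums over all ways to insert a new maximum without creating a 123,
-- V′ over those that do not insert it in front.

V′ : PermState → (PermState → ℕ) → ℕ
V′ (PN zero)        h = h (PH 0 0 0)
V′ (PN (suc p))     h = h (PH 0 (suc p) 0) + V′ (PN p) (h ∘ up)
V′ (PH zero s a)    h = h (PH 0 (suc s) a)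
V′ (PH (suc p) s a) h = h (PH 0 (suc p + s) (suc a)) + V′ (PH p s a) (h ∘ up)

V : (PermState → ℕ) → PermState → ℕ
V h s = h (up s) + V′ s h

V′-up : ∀ s h → V′ (up s) h ≡ h (asc (up s)) + V′ s (h ∘ up)
V′-up (PN p)     h = refl
V′-up (PH p s a) h = refl

V′-asc : ∀ s h → V′ (asc s) h ≡ h (asc (up s))
V′-asc (PN p)     h = refl
V′-asc (PH p s a) h = refl

-- U sums over the chains that arise from a permutation by turning some of its descents into equalities.
U : (ChainState → ℕ) → PermState → ℕ
U f (PN p)     = Bin p (f ∘ N)
U f (PH p s a) = Bin p λ i → Bin s λ j → f (H i (i + j + suc a))

-- The sum over the antidiagonal `i + r + 1 = q`: one of `q` places is marked, with `i` places
-- before it and `r` after it.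
Diag : ℕ → (ℕ → ℕ → ℕ) → ℕ
Diag zero    k = 0
Diag (suc q) k = k 0 q + Diag q (k ∘ suc)

Diag-cong : ∀ q {k l : ℕ → ℕ → ℕ} → (∀ i r → k i r ≡ l i r) → Diag q k ≡ Diag q l
Diag-cong zero    h = refl
Diag-cong (suc q) h = cong₂ _+_ (h 0 q) (Diag-cong q (h ∘ suc))

Diag-+ : ∀ q (k l : ℕ → ℕ → ℕ) → Diag q (λ i r → k i r + l i r) ≡ Diag q k + Diag q l
Diag-+ zero    k l = refl
Diag-+ (suc q) k l rewrite Diag-+ q (k ∘ suc) (l ∘ suc) = lemma (k 0 q) (l 0 q) _ _
  where
  lemma : ∀ a b c d → a + b + (c + d) ≡ a + c + (b + d)
  lemma = solve-∀

-- Marking the v-th of the i elements of a subset of {1, …, q} amounts to choosing the marked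
-- element, then a subset on either side of it.
Diag-Bin : ∀ q (ψ : ℕ → ℕ → ℕ) →
  Diag q (λ i r → Bin i λ i′ → Bin r λ j → ψ i′ (i′ + suc j)) ≡ Bin q (λ i → ∑< i (λ v → ψ v i))
Diag-Bin zero    ψ = refl
Diag-Bin (suc q) ψ = begin
  Bin q (λ j → ψ 0 (suc j)) + Diag q (λ i r → k ψ i r + k ψ′ i r)
    ≡⟨ cong (Bin q (λ j → ψ 0 (suc j)) +_) (trans (Diag-+ q (k ψ) (k ψ′))
         (cong₂ _+_ (Diag-Bin q ψ) (Diag-Bin q ψ′))) ⟩
  Bin q (λ j → ψ 0 (suc j)) + (Bin q (λ i → ∑< i (λ v → ψ v i)) + Bin q (λ i → ∑< i (λ v → ψ′ v i)))
    ≡⟨ swap (Bin q (λ j → ψ 0 (suc j))) (Bin q (λ i → ∑< i (λ v → ψ v i))) _ ⟩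
  Bin q (λ i → ∑< i (λ v → ψ v i)) + (Bin q (λ j → ψ 0 (suc j)) + Bin q (λ i → ∑< i (λ v → ψ′ v i)))
    ≡⟨ cong (Bin q (λ i → ∑< i (λ v → ψ v i)) +_) (sym (Bin-+ q (λ j → ψ 0 (suc j)) _)) ⟩
  Bin (suc q) (λ i → ∑< i (λ v → ψ v i)) ∎
  where
  open ≡-Reasoning
  k : (ℕ → ℕ → ℕ) → ℕ → ℕ → ℕ
  k ψ i r = Bin i λ i′ → Bin r λ j → ψ i′ (i′ + suc j)
  ψ′ : ℕ → ℕ → ℕ
  ψ′ v i = ψ (suc v) (suc i)
  swap : ∀ a b c → a + (b + c) ≡ b + (a + c)
  swap = solve-∀

V′-PN : ∀ p h → V′ (PN p) h ≡ Diag (suc p) (λ i r → h (PH i r 0))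
V′-PN zero    h = sym (+-identityʳ _)
V′-PN (suc p) h = cong (h (PH 0 (suc p) 0) +_) (V′-PN p (h ∘ up))

-- A maximum inside the initial run cuts it in two and creates an ascent. At the end of the run it
-- replaces the ascent there by an ascent and a descent, so the number of ascents is kept; this is
-- the last summand.
V′-PH : ∀ p s a h → V′ (PH p s a) h ≡ Diag p (λ i r → h (PH i (suc r + s) (suc a))) + h (PH p (suc s) a)
V′-PH zero    s a h = refl
V′-PH (suc p) s a h = trans (cong (h (PH 0 (suc p + s) (suc a)) +_) (V′-PH p s a (h ∘ up)))
  (sym (+-assoc (h (PH 0 (suc p + s) (suc a))) _ _))

-- Both sides sum over the avoiding chains obtained by adding one element to a chain above the given
-- permutation, grouped on the left by the place of the maximum in one-line notation and on the
-- right by the rank of the new element. If `i` descents of the initial run stay strict, the run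
-- occupies the ranks up to `i`, so the least top is `i + 1`; `Diag-Bin` turns the cut of the run
-- into the choice of the new rank.
VU≡UT : ∀ f s → V (U f) s ≡ U (T f) s
VU≡UT f (PN p) = begin
  (Bin p (f ∘ N) + Bin p (f ∘ N ∘ suc)) + V′ (PN p) (U f)
    ≡⟨ cong ((Bin p (f ∘ N) + Bin p (f ∘ N ∘ suc)) +_) (trans (V′-PN p (U f)) (trans
         (Diag-cong (suc p) (λ i r → Bin-cong i λ i′ → Bin-cong r λ j → cong (λ κ → f (H i′ κ)) (shift i′ j)))
         (Diag-Bin (suc p) (λ v κ → f (H v κ))))) ⟩
  (Bin p (f ∘ N) + Bin p (f ∘ N ∘ suc)) + (Bin p R + Bin p (R ∘ suc))
    ≡⟨ swap (Bin p (f ∘ N)) (Bin p (f ∘ N ∘ suc)) (Bin p R) (Bin p (R ∘ suc)) ⟩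
  (Bin p (f ∘ N) + Bin p R) + (Bin p (f ∘ N ∘ suc) + Bin p (R ∘ suc))
    ≡⟨ cong₂ _+_ (Bin-+ p (f ∘ N) R) (Bin-+ p (f ∘ N ∘ suc) (R ∘ suc)) ⟨
  Bin p (λ i → f (N i) + R i) + Bin p (λ i → f (N (suc i)) + R (suc i))
    ≡⟨ Bin-+ p (λ i → f (N i) + R i) _ ⟨
  Bin p (λ i → T f (N i)) ∎
  where
  open ≡-Reasoning
  R : ℕ → ℕ
  R i = ∑< i (λ v → f (H v i))
  shift : ∀ i j → i + j + 1 ≡ i + suc j
  shift = solve-∀
  swap : ∀ a b c d → a + b + (c + d) ≡ a + c + (b + d)
  swap = solve-∀
VU≡UT f (PH p s a) = begin
  (Bin p K + Bin p (λ i → Bin s (λ j → f (H (suc i) (suc i + j + suc a))))) + V′ (PH p s a) (U f)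
    ≡⟨ cong₂ _+_ (sym (Bin-+ p K _)) (trans (V′-PH p s a (U f)) (cong₂ _+_
         (trans (Diag-cong p diag) (Diag-Bin p Ψ)) (Bin-cong p last))) ⟩
  Bin p (λ i → K i + K↗ i) + (Bin p (λ i → ∑< i (λ v → Ψ v i)) + Bin p (λ i → K i + K′ i))
    ≡⟨ cong (Bin p (λ i → K i + K↗ i) +_) (sym (Bin-+ p _ (λ i → K i + K′ i))) ⟩
  Bin p (λ i → K i + K↗ i) + Bin p (λ i → ∑< i (λ v → Ψ v i) + (K i + K′ i))
    ≡⟨ Bin-+ p (λ i → K i + K↗ i) _ ⟨
  Bin p (λ i → (K i + K↗ i) + (∑< i (λ v → Ψ v i) + (K i + K′ i)))
    ≡⟨ Bin-cong p (λ i → sym (pointwise i)) ⟩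
  U (T f) (PH p s a) ∎
  where
  open ≡-Reasoning
  κ : ℕ → ℕ → ℕ
  κ i j = i + j + suc a
  K K′ K↗ : ℕ → ℕ
  K  i = Bin s (λ j → f (H i (κ i j)))
  K′ i = Bin s (λ j → f (H i (suc (κ i j))))
  K↗ i = Bin s (λ j → f (H (suc i) (suc (κ i j))))
  Ψ : ℕ → ℕ → ℕ
  Ψ v i = Bin s (λ j → f (H v (κ i j))) + Bin s (λ j → f (H v (suc (κ i j))))
  last : ∀ i → Bin s (λ j → f (H i (κ i j))) + Bin s (λ j → f (H i (i + suc j + suc a))) ≡ K i + K′ i
  last i = cong (K i +_) (Bin-cong s λ j → cong (λ t → f (H i (t + suc a))) (+-suc i j))
  -- The descent right after the maximum is an equality if the new element joins a block and strict
  -- if it forms its own: these are the two summands of `Ψ`.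
  diag : ∀ i r → U f (PH i (suc r + s) (suc a)) ≡ (Bin i λ i′ → Bin r λ j → Ψ i′ (i′ + suc j))
  diag i r = Bin-cong i λ i′ → trans
    (cong₂ _+_
      (trans (Bin-split r s _) (Bin-cong r λ j → Bin-cong s λ t → cong (λ κ → f (H i′ κ)) (eq₁ i′ j t a)))
      (trans (Bin-split r s _) (Bin-cong r λ j → Bin-cong s λ t → cong (λ κ → f (H i′ κ)) (eq₂ i′ j t a))))
    (sym (Bin-+ r _ _))
    where
    eq₁ : ∀ i j t a → i + (j + t) + suc (suc a) ≡ i + suc j + t + suc a
    eq₁ = solve-∀
    eq₂ : ∀ i j t a → i + suc (j + t) + suc (suc a) ≡ suc (i + suc j + t + suc a)
    eq₂ = solve-∀
  pointwise : ∀ i → Bin s (λ j → T f (H i (κ i j))) ≡ (K i + K↗ i) + (∑< i (λ v → Ψ v i) + (K i + K′ i))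
  pointwise i = begin
    Bin s (λ j → T f (H i (κ i j)))
      ≡⟨ Bin-+ s _ _ ⟩
    Bin s (λ j → f (H i (κ i j)) + ∑< (suc i) (λ v → f (H v (κ i j))))
      + Bin s (λ j → f (H (suc i) (suc (κ i j))) + ∑< (suc i) (λ v → f (H v (suc (κ i j)))))
      ≡⟨ cong₂ _+_ (Bin-+ s _ _) (Bin-+ s _ _) ⟩
    (K i + Bin s (λ j → ∑< (suc i) (λ v → f (H v (κ i j)))))
      + (K↗ i + Bin s (λ j → ∑< (suc i) (λ v → f (H v (suc (κ i j))))))
      ≡⟨ cong₂ (λ x y → (K i + x) + (K↗ i + y))
           (trans (Bin-∑< s (suc i) (λ v j → f (H v (κ i j)))) (∑<-last i _))
           (trans (Bin-∑< s (suc i) (λ v j → f (H v (suc (κ i j))))) (∑<-last i _)) ⟩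
    (K i + (Y + K i)) + (K↗ i + (Y′ + K′ i))
      ≡⟨ swap (K i) Y (K↗ i) Y′ (K′ i) ⟩
    (K i + K↗ i) + ((Y + Y′) + (K i + K′ i))
      ≡⟨ cong (λ x → (K i + K↗ i) + (x + (K i + K′ i))) (∑<-+ i _ _) ⟨
    (K i + K↗ i) + (∑< i (λ v → Ψ v i) + (K i + K′ i)) ∎
    where
    Y Y′ : ℕ
    Y  = ∑< i (λ v → Bin s (λ j → f (H v (κ i j))))
    Y′ = ∑< i (λ v → Bin s (λ j → f (H v (suc (κ i j)))))
    swap : ∀ k x l y m → (k + (x + k)) + (l + (y + m)) ≡ (k + l) + ((x + y) + (k + m))
    swap = solve-∀

-- Insertion of a new maximum

insert-∈ : ∀ {n xs c} → Insert n xs c → n ∈ c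
insert-∈ front     = here refl
insert-∈ (later i) = there (insert-∈ i)

insert-⊆ : ∀ {n xs c} → Insert n xs c → xs ⊆ c
insert-⊆ front     = _ ∷ʳ ⊆-refl
insert-⊆ (later i) = refl ∷ insert-⊆ i

sub-< : ∀ {n b c xs} → All (_< n) xs → b ∷ c ∷ [] ⊆ xs → b < n × c < n
sub-< xs<n p with b<n ∷ c<n ∷ [] ← All-resp-⊆ p xs<n = b<n , c<n

avoid-front : ∀ {n xs} → All (_< n) xs → ¬ Has123 xs → ¬ Has123 (n ∷ xs)
avoid-front xs<n av (has123 a<b b<c (_ ∷ʳ p))   = av (has123 a<b b<c p)
avoid-front xs<n av (has123 a<b b<c (refl ∷ p)) = <-asym a<b (proj₁ (sub-< xs<n p))

avoid-second : ∀ {n x xs} → All (_< n) xs → ¬ Has123 (x ∷ xs) → ¬ Has123 (x ∷ n ∷ xs)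
avoid-second xs<n av (has123 a<b b<c (refl ∷ refl ∷ p)) =
  <-asym b<c (All.lookup xs<n (to∈ p))
avoid-second xs<n av (has123 a<b b<c (refl ∷ _ ∷ʳ p)) = av (has123 a<b b<c (refl ∷ p))
avoid-second xs<n av (has123 a<b b<c (_ ∷ʳ p)) =
  avoid-front xs<n (av ∘ has123-⊆ (_ ∷ʳ ⊆-refl)) (has123 a<b b<c p)

-- In an occurrence that begins with `x`, the smaller letter `y` can take its place.
has123-drop : ∀ {x y c} → y < x → Has123 (x ∷ y ∷ c) → Has123 (y ∷ c)
has123-drop y<x (has123 a<b b<c (_ ∷ʳ p))          = has123 a<b b<c p
has123-drop y<x (has123 a<b b<c (refl ∷ _ ∷ʳ p))   = has123 (<-trans y<x a<b) b<c (refl ∷ p)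
has123-drop y<x (has123 a<b b<c (refl ∷ refl ∷ p)) = ⊥-elim (<-asym y<x a<b)

av : List ℕ → ℕ
av xs = ind (¬? (contains123? xs))

av-yes : ∀ {xs} → ¬ Has123 xs → av xs ≡ 1
av-yes {xs} ¬h = ind-yes (¬? (contains123? xs)) (λ h → ¬h (contains⇒has h))

av-no : ∀ {xs} → Has123 xs → av xs ≡ 0
av-no {xs} h = ind-no (¬? (contains123? xs)) (λ ¬h → ¬h (has⇒contains h))

-- Right behind `x` the maximum creates no 123. Further right, a next letter larger than `x` forms a
-- 123 with `x` and the maximum, whereas in front of a smaller one `x` may be dropped and the
-- recursion goes on. So only places within the initial run or at its end survive.
ins-after : ∀ {n x} xs h → All (_< n) (x ∷ xs) → Unique (x ∷ xs) → ¬ Has123 (x ∷ xs) →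
  ∑ (ins n xs) (λ c → av (x ∷ c) * h (stateFrom x c)) ≡ V′ (stateFrom x xs) h
ins-after {n} {x} [] h (x<n ∷ []) u ¬h = begin
  av (x ∷ n ∷ []) * h (stateFrom x (n ∷ [])) + 0
    ≡⟨ +-identityʳ _ ⟩
  av (x ∷ n ∷ []) * h (stateFrom x (n ∷ []))
    ≡⟨ cong₂ (λ i s → i * h s) (av-yes {x ∷ n ∷ []} (avoid-second [] ¬h)) (stateFrom-< [] x<n) ⟩
  1 * h (PH 0 0 0)
    ≡⟨ *-identityˡ _ ⟩
  h (PH 0 0 0) ∎
  where open ≡-Reasoning
ins-after {n} {x} (y ∷ ys) h (x<n ∷ y<n ∷ ys<n) (x∉ ∷ u) ¬h = trans
  (cong₂ _+_ first (∑-map (y ∷_) (ins n ys) _)) (rest (y <? x))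
  where
  first : av (x ∷ n ∷ y ∷ ys) * h (stateFrom x (n ∷ y ∷ ys)) ≡ h (asc (up (stateFrom y ys)))
  first = trans (cong₂ (λ i s → i * h s) (av-yes {x ∷ n ∷ y ∷ ys} (avoid-second (y<n ∷ ys<n) ¬h))
      (trans (stateFrom-< (y ∷ ys) x<n) (cong asc (stateFrom-> ys y<n))))
    (*-identityˡ _)
  rest : Dec (y < x) → h (asc (up (stateFrom y ys)))
      + ∑ (ins n ys) (λ c → av (x ∷ y ∷ c) * h (stateFrom x (y ∷ c)))
    ≡ V′ (stateFrom x (y ∷ ys)) h
  rest (yes y<x) = begin
    h (asc (up (stateFrom y ys))) + ∑ (ins n ys) (λ c → av (x ∷ y ∷ c) * h (stateFrom x (y ∷ c)))
      ≡⟨ cong (h (asc (up (stateFrom y ys))) +_) (trans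
           (∑-cong (ins n ys) λ {c} _ → cong₂ (λ i s → i * h s)
             (ind-⇔ (¬? (contains123? (x ∷ y ∷ c))) (¬? (contains123? (y ∷ c)))
               (λ ¬h → ¬h ∘ has⇒contains ∘ has123-⊆ (x ∷ʳ ⊆-refl) ∘ contains⇒has)
               (λ ¬h → ¬h ∘ has⇒contains ∘ has123-drop y<x ∘ contains⇒has))
             (stateFrom-> c y<x))
           (ins-after ys (h ∘ up) (y<n ∷ ys<n) u (¬h ∘ has123-⊆ (x ∷ʳ ⊆-refl)))) ⟩
    h (asc (up (stateFrom y ys))) + V′ (stateFrom y ys) (h ∘ up)
      ≡⟨ V′-up (stateFrom y ys) h ⟨
    V′ (up (stateFrom y ys)) h
      ≡⟨ cong (λ s → V′ s h) (stateFrom-> ys y<x) ⟨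
    V′ (stateFrom x (y ∷ ys)) h ∎
    where open ≡-Reasoning
  rest (no y≮x) = begin
    h (asc (up (stateFrom y ys))) + ∑ (ins n ys) (λ c → av (x ∷ y ∷ c) * h (stateFrom x (y ∷ c)))
      ≡⟨ cong (h (asc (up (stateFrom y ys))) +_) (trans
           (∑-cong (ins n ys) λ {c} c∈ → cong (_* h (stateFrom x (y ∷ c)))
             (av-no (has123 x<y y<n (refl ∷ refl ∷ from∈ (insert-∈ (ins⁻ ys c∈))))))
           (∑-0 (ins n ys))) ⟩
    h (asc (up (stateFrom y ys))) + 0
      ≡⟨ +-identityʳ _ ⟩
    h (asc (up (stateFrom y ys)))
      ≡⟨ V′-asc (stateFrom y ys) h ⟨
    V′ (asc (stateFrom y ys)) h
      ≡⟨ cong (λ s → V′ s h) (stateFrom-< ys x<y) ⟨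
    V′ (stateFrom x (y ∷ ys)) h ∎
    where
    open ≡-Reasoning
    x<y : x < y
    x<y = ≤∧≢⇒< (≮⇒≥ y≮x) (All.head x∉)

ins-avoiding : ∀ {n x} xs h → All (_< n) (x ∷ xs) → Unique (x ∷ xs) → ¬ Has123 (x ∷ xs) →
  ∑ (ins n (x ∷ xs)) (λ c → av c * h (state c)) ≡ V h (stateFrom x xs)
ins-avoiding {n} {x} xs h <n@(x<n ∷ _) u ¬h = cong₂ _+_
  (trans (cong₂ (λ i s → i * h s) (av-yes {n ∷ x ∷ xs} (avoid-front <n ¬h)) (stateFrom-> xs x<n)) (*-identityˡ _))
  (trans (∑-map (x ∷_) (ins n xs) _) (ins-after xs h <n u ¬h))

_RepresentsP[_]_ : (List ℕ → ℕ) → ℕ → (PermState → ℕ) → Set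
F RepresentsP[ n ] h = ∀ {xs} → IsPW n xs → F xs ≡ av xs * h (state xs)

representsP-V : ∀ {n F h} → F RepresentsP[ suc (suc n) ] h →
  (λ xs → ∑ (ins (suc n) xs) F) RepresentsP[ suc n ] (V h)
representsP-V {n} {F} {h} rep {x ∷ xs} p@(mkPW len bound u) = trans
  (∑-cong (ins (suc n) (x ∷ xs)) λ c∈ → rep (insert-PW p (ins⁻ (x ∷ xs) c∈)))
  (split′ (contains123? (x ∷ xs)))
  where
  split′ : Dec (Contains123 (x ∷ xs)) →
    ∑ (ins (suc n) (x ∷ xs)) (λ c → av c * h (state c)) ≡ av (x ∷ xs) * V h (stateFrom x xs)
  split′ (yes c) = trans
    (trans (∑-cong (ins (suc n) (x ∷ xs)) λ {z} z∈ →
        cong (_* h (state z)) (av-no (has123-⊆ (insert-⊆ (ins⁻ (x ∷ xs) z∈)) (contains⇒has c))))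
      (∑-0 (ins (suc n) (x ∷ xs))))
    (cong (_* V h (stateFrom x xs)) (sym (av-no (contains⇒has c))))
  split′ (no ¬c) = trans (ins-avoiding xs h bound u (¬c ∘ has⇒contains))
    (trans (sym (*-identityˡ _)) (cong (_* V h (stateFrom x xs)) (sym (av-yes (¬c ∘ has⇒contains)))))

-- By `VU≡UT` each insertion step becomes one application of `T`, and the sum ends in the same
-- iterate as `∑-CW`.
∑-PW : ∀ n {F f} → F RepresentsP[ suc n ] (U f) → ∑ (PW (suc n)) F ≡ (T ^^ n) f (N 0)
∑-PW zero {F} {f} rep = trans (+-identityʳ _) (trans
  (rep {0 ∷ []} (mkPW refl (s≤s z≤n ∷ []) ([] ∷ [])))
  (trans (cong (_* f (N 0)) (av-yes {0 ∷ []} λ { (has123 _ _ (_ ∷ ())) ; (has123 _ _ (_ ∷ʳ ())) })) (*-identityˡ _)))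
∑-PW (suc n) {F} {f} rep = trans (∑-concatMap (ins (suc n)) (PW (suc n)) F)
  (trans (∑-PW n λ {xs} p → trans (representsP-V {F = F} {h = U f} rep p) (cong (av xs *_) (VU≡UT f (state xs))))
    (cong (λ g → g (N 0)) (^^-comm T n f)))

-- Descents of words

descentsFrom : ℕ → List ℕ → ℕ
descentsFrom x []       = 0
descentsFrom x (y ∷ ys) = ind (y <? x) + descentsFrom y ys

descentsOf : List ℕ → ℕ
descentsOf []       = 0
descentsOf (x ∷ xs) = descentsFrom x xs

∑-allFin-suc : ∀ n (F : Fin (suc n) → ℕ) → ∑ (allFin (suc n)) F ≡ F Fin.zero + ∑ (allFin n) (F ∘ Fin.suc)
∑-allFin-suc n F = cong (F Fin.zero +_) (trans
  (cong (λ is → ∑ is F) (sym (map-tabulate id Fin.suc))) (∑-map Fin.suc (allFin n) F))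

DescentAt : ∀ {n} → (Fin n → ℕ) → Fin n → Set
DescentAt {n} f i = ∃ λ (j : Fin n) → (toℕ j ≡ suc (toℕ i)) × (f j < f i)

descentAt? : ∀ {n} (f : Fin n → ℕ) i → Dec (DescentAt f i)
descentAt? f i = any? λ j → (toℕ j ≟ suc (toℕ i)) ×-dec (f j <? f i)

∑-descents : ∀ n (f : Fin n → ℕ) → ∑ (allFin n) (ind ∘ descentAt? f) ≡ descentsOf (tabulate f)
∑-descents zero f = refl
∑-descents (suc zero) f = trans (+-identityʳ _)
  (ind-no (descentAt? f Fin.zero) λ { (Fin.zero , () , _) })
∑-descents (suc (suc n)) f = trans (∑-allFin-suc (suc n) (ind ∘ descentAt? f)) (cong₂ _+_
  (ind-⇔ (descentAt? f Fin.zero) (f (Fin.suc Fin.zero) <? f Fin.zero)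
    (λ { (Fin.suc Fin.zero , _ , f<f) → f<f })
    (λ f<f → Fin.suc Fin.zero , refl , f<f))
  (trans (∑-cong (allFin (suc n)) λ {i} _ →
      ind-⇔ (descentAt? f (Fin.suc i)) (descentAt? (f ∘ Fin.suc) i)
        (λ { (Fin.suc j , eq , f<f) → j , suc-injective eq , f<f })
        (λ { (j , eq , f<f) → Fin.suc j , cong suc eq , f<f }))
    (∑-descents (suc n) (f ∘ Fin.suc))))

des≡descentsOf : ∀ {n} (σ : Fin n → Fin n) → des σ ≡ descentsOf (toList σ)
des≡descentsOf {n} σ = trans
  (count≡∑ (λ i → any? λ j → (toℕ j ≟ suc (toℕ i)) ×-dec (σ j <?ᶠ σ i)) (allFin n))
  (trans (∑-cong (allFin n) λ {i} _ →
      ind-⇔ (any? λ j → (toℕ j ≟ suc (toℕ i)) ×-dec (σ j <?ᶠ σ i)) (descentAt? (toℕ ∘ σ) i) id id)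
    (∑-descents n (toℕ ∘ σ)))

descents-up : ∀ s → descents (up s) ≡ suc (descents s)
descents-up (PN p)     = refl
descents-up (PH p s a) = refl

descents-asc : ∀ s → descents (asc s) ≡ descents s
descents-asc (PN p)     = refl
descents-asc (PH p s a) = refl

descents-stateFrom : ∀ x xs → descents (stateFrom x xs) ≡ descentsFrom x xs
descents-stateFrom x []       = refl
descents-stateFrom x (y ∷ ys) with does (y <? x)
... | true  = trans (descents-up (stateFrom y ys)) (cong suc (descents-stateFrom y ys))
... | false = trans (descents-asc (stateFrom y ys)) (descents-stateFrom y ys)

descentsFrom≤ : ∀ x xs → descentsFrom x xs ≤ length xs
descentsFrom≤ x []       = z≤n
descentsFrom≤ x (y ∷ ys) with does (y <? x)
... | true  = s≤s (descentsFrom≤ y ys)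
... | false = m≤n⇒m≤1+n (descentsFrom≤ y ys)

descentsFrom-asc : ∀ {c} x xs → x < c → c ∈ xs → suc (descentsFrom x xs) ≤ length xs
descentsFrom-asc x (y ∷ ys) x<c c∈ with y <? x
descentsFrom-asc x (y ∷ ys) x<c c∈ | no y≮x
  rewrite dec-false (y <? x) y≮x = s≤s (descentsFrom≤ y ys)
descentsFrom-asc x (y ∷ ys) x<c (here refl) | yes y<x = ⊥-elim (<-asym x<c y<x)
descentsFrom-asc x (y ∷ ys) x<c (there c∈)  | yes y<x
  rewrite dec-true (y <? x) y<x = s≤s (descentsFrom-asc y ys (<-trans y<x x<c) c∈)

descentsFrom≤descentsOf : ∀ x xs → descentsFrom x xs ≤ suc (descentsOf xs)
descentsFrom≤descentsOf x []       = z≤n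
descentsFrom≤descentsOf x (y ∷ ys) with does (y <? x)
... | true  = ≤-refl
... | false = n≤1+n _

descents-12 : ∀ {b c} xs → b < c → b ∷ c ∷ [] ⊆ xs → 2 + descentsOf xs ≤ length xs
descents-12 (x ∷ xs) b<c (_ ∷ʳ p) =
  s≤s (≤-trans (s≤s (descentsFrom≤descentsOf x xs)) (descents-12 xs b<c p))
descents-12 (x ∷ xs) b<c (refl ∷ p)   = s≤s (descentsFrom-asc x xs b<c (to∈ p))

descentsFrom-12 : ∀ {b c} x xs → x < b → b < c → b ∷ c ∷ [] ⊆ xs → 2 + descentsFrom x xs ≤ length xs
descentsFrom-12 x (y ∷ ys) x<b b<c p with y <? x
descentsFrom-12 x (y ∷ ys) x<b b<c p | no y≮x
  rewrite dec-false (y <? x) y≮x = descents-12 (y ∷ ys) b<c p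
descentsFrom-12 x (y ∷ ys) x<b b<c (refl ∷ p) | yes y<x = ⊥-elim (<-asym x<b y<x)
descentsFrom-12 x (y ∷ ys) x<b b<c (_ ∷ʳ p) | yes y<x
  rewrite dec-true (y <? x) y<x = s≤s (descentsFrom-12 y ys (<-trans y<x x<b) b<c p)

-- Descents alone never lead up to a larger letter, so each of the two rises in an occurrence of 123
-- costs a position that is not a descent. This bounds the range of `d` in the second sum.
descents-123 : ∀ xs → Has123 xs → 3 + descentsOf xs ≤ length xs
descents-123 (x ∷ xs) (has123 a<b b<c (_ ∷ʳ p)) =
  s≤s (≤-trans (s≤s (s≤s (descentsFrom≤descentsOf x xs))) (descents-123 xs (has123 a<b b<c p)))
descents-123 (x ∷ xs) (has123 a<b b<c (refl ∷ p)) = s≤s (descentsFrom-12 x xs a<b b<c p)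

-- Without descents the maximum comes last, and the first three of at least four letters survive its removal.
without-max-123 : ∀ {k xs} → IsPW (4 + k) xs → descentsOf xs ≡ 0 → Has123 (without (3 + k) xs)
without-max-123 {k} {x ∷ y ∷ z ∷ u ∷ xs} (mkPW len (_ ∷ _ ∷ _ ∷ u< ∷ _) (x∉ ∷ y∉ ∷ z∉ ∷ _)) d≡0
  with y <? x | z <? y | u <? z
... | yes y<x | _ | _ = ⊥-elim (1+n≢0 (trans (sym (cong (_+ _) (ind-yes (y <? x) y<x))) d≡0))
... | no y≮x | yes z<y | _ = ⊥-elim (1+n≢0 (trans (sym (cong (_+ _) (ind-yes (z <? y) z<y)))
      (m+n≡0⇒n≡0 (ind (y <? x)) d≡0)))
... | no y≮x | no z≮y | yes u<z = ⊥-elim (1+n≢0 (trans (sym (cong (_+ _) (ind-yes (u <? z) u<z)))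
      (m+n≡0⇒n≡0 (ind (z <? y)) (m+n≡0⇒n≡0 (ind (y <? x)) d≡0))))
... | no y≮x | no z≮y | no u≮z = has123 x<y y<z sub
  where
  m = 3 + k
  x<y = ≤∧≢⇒< (≮⇒≥ y≮x) (All.head x∉)
  y<z = ≤∧≢⇒< (≮⇒≥ z≮y) (All.head y∉)
  z<m = <-≤-trans (≤∧≢⇒< (≮⇒≥ u≮z) (All.head z∉)) (s≤s⁻¹ u<)
  y<m = <-trans y<z z<m
  x<m = <-trans x<y y<m
  sub : x ∷ y ∷ z ∷ [] ⊆ without m (x ∷ y ∷ z ∷ u ∷ xs)
  sub rewrite dec-true (¬? (x ≟ m)) (<⇒≢ x<m) | dec-true (¬? (y ≟ m)) (<⇒≢ y<m)
            | dec-true (¬? (z ≟ m)) (<⇒≢ z<m) = refl ∷ refl ∷ refl ∷ Sub.minimum _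

-- Numbers of leaves

avoiding : ℕ → ℕ
avoiding n = count (λ r → ¬? (contains123? (toList r))) (WOC n)

stops? : ∀ n (xs : List ℕ) → Dec (Contains123 xs × ¬ Contains123 (take (n ∸ 1) xs))
stops? n xs = contains123? xs ×-dec ¬? (contains123? (take (n ∸ 1) xs))

stopping : ℕ → ℕ
stopping n = count (λ r → stops? n (toList r)) (WOC n)

∑-WOC : ∀ n F → ∑ (WOC n) (F ∘ toList) ≡ ∑ (CW n) (F ∘ reverse)
∑-WOC n F = trans (sym (∑-map toList (WOC n) F)) (trans (∑-↭ F (WOC↭CW n)) (∑-map reverse (CW n) F))

∑-Perms : ∀ n F → ∑ (Perms n) (F ∘ toList) ≡ ∑ (PW n) F
∑-Perms n F = trans (sym (∑-map toList (Perms n) F)) (∑-↭ F (Perms↭PW n))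

const-state : ℕ → ChainState → ℕ
const-state c _ = c

blocks extensions : ChainState → ℕ
blocks (N κ)       = suc κ
blocks (H b κ)     = suc κ
extensions (N κ)   = 2 * κ + 3
extensions (H b κ) = 2 * κ + 3

reaches-avoids : ∀ s {ys} → Reaches s ys → ¬ Has321 ys
reaches-avoids (N κ)   (_ , _ , flat) = noAscent-avoids flat
reaches-avoids (H b κ) (_ , _ , top)  = MinTop.avoids top

represents-av : ∀ {φ : List ℕ → ℕ} {f} → (∀ s {ys} → Reaches s ys → φ ys ≡ f s) →
  (λ ys → av (reverse ys) * φ ys) Represents f
represents-av {φ} h = mkRep
  (λ s {ys} r → trans (cong₂ _*_ (av-yes {reverse ys} (reaches-avoids s r ∘ contains⇒has321 ∘ has⇒contains)) (h s r))
    (*-identityˡ _))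
  (λ {ys} h′ → cong (_* φ ys) (av-no {reverse ys} (contains⇒has (has321⇒contains h′))))

avoiding≡ : ∀ m → avoiding (suc m) ≡ (T ^^ m) (const-state 1) (N 0)
avoiding≡ m = trans (count≡∑ (λ r → ¬? (contains123? (toList r))) (WOC (suc m)))
  (trans (∑-WOC (suc m) av) (trans (∑-cong (CW (suc m)) λ _ → sym (*-identityʳ _))
    (∑-CW m (represents-av {λ _ → 1} λ _ _ → refl))))

children-length : ∀ ys c → ∑ (children ys) (λ _ → c) ≡ c * (2 * width ys + 1)
children-length ys c = trans (∑-children ys (λ _ → c))
  (trans (cong₂ _+_ (∑<-const (width ys) c) (∑<-const (suc (width ys)) c)) (lemma (width ys) c))
  where
  lemma : ∀ k c → k * c + (c + k * c) ≡ c * (2 * k + 1)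
  lemma = solve-∀

take-init : ∀ (xs : List ℕ) v → take (length xs) (xs ++ v ∷ []) ≡ xs
take-init []       v = refl
take-init (x ∷ xs) v = cong (x ∷_) (take-init xs v)

parent-reverse : ∀ {n} (v : ℕ) (zs : List ℕ) → length zs ≡ n → take n (reverse (v ∷ zs)) ≡ reverse zs
parent-reverse v zs refl = trans
  (cong₂ take (sym (length-reverse zs)) (unfold-reverse v zs)) (take-init (reverse zs) v)

-- A child of an avoiding chain either avoids or stops; a child of any other chain does neither.
av+stops : ∀ {n ys c} → IsCW n ys → Child ys c →
  av (reverse c) + ind (stops? (suc n) (reverse c)) ≡ av (reverse ys)
av+stops {n} {ys} {c} cw ch = trans (cong (av (reverse c) +_) ind-stops) (total (contains123? (reverse ys)))
  where
  -- Truncating a split leaves the parent with bumped ranks, which are in the same relative order.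
  restrict : ∀ {c} → Child ys c → (Contains123 (take n (reverse c)) → Contains123 (reverse ys))
    × (Contains123 (reverse ys) → Contains123 (take n (reverse c)))
  restrict (repeat {v} v<) =
    subst Contains123 (parent-reverse v ys (IsCW.len cw)) ,
    subst Contains123 (sym (parent-reverse v ys (IsCW.len cw)))
  restrict (split {v} v≤) =
    (has321⇒contains ∘ has321-bump⁻ v ∘ contains⇒has321 {map (bump v) ys} ∘ subst Contains123 eq) ,
    (subst Contains123 (sym eq) ∘ has321⇒contains ∘ has321-bump v ∘ contains⇒has321 {ys})
    where eq = parent-reverse v (map (bump v) ys) (trans (length-map (bump v) ys) (IsCW.len cw))
  ind-stops : ind (stops? (suc n) (reverse c))
    ≡ ind (contains123? (reverse c) ×-dec ¬? (contains123? (reverse ys)))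
  ind-stops = ind-⇔ (stops? (suc n) (reverse c)) (contains123? (reverse c) ×-dec ¬? (contains123? (reverse ys)))
    (λ (p , ¬q) → p , ¬q ∘ proj₂ (restrict ch))
    (λ (p , ¬q) → p , ¬q ∘ proj₁ (restrict ch))
  inherit : ∀ {c} → Child ys c → Has321 ys → Has321 c
  inherit (repeat _)    = has321-cons
  inherit (split {v} _) = has321-cons ∘ has321-bump v
  total : Dec (Contains123 (reverse ys)) →
    av (reverse c) + ind (contains123? (reverse c) ×-dec ¬? (contains123? (reverse ys))) ≡ av (reverse ys)
  total (yes q) = trans (cong₂ _+_
      (av-no {reverse c} (contains⇒has (has321⇒contains (inherit ch (contains⇒has321 {ys} q)))))
      (ind-no (contains123? (reverse c) ×-dec ¬? (contains123? (reverse ys))) (λ (_ , ¬q) → ¬q q)))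
    (sym (av-no {reverse ys} (contains⇒has q)))
  total (no ¬q) = trans (cong (av (reverse c) +_)
      (ind-⇔ (contains123? (reverse c) ×-dec ¬? (contains123? (reverse ys))) (contains123? (reverse c))
        proj₁ (_, ¬q)))
    (trans (ind-¬ (contains123? (reverse c))) (sym (av-yes {reverse ys} (¬q ∘ has⇒contains))))

avoiding+stopping : ∀ n → avoiding (suc n) + stopping (suc n)
  ≡ ∑ (CW n) (λ ys → av (reverse ys) * (2 * width ys + 1))
avoiding+stopping n = begin
  avoiding (suc n) + stopping (suc n)
    ≡⟨ cong₂ _+_
         (trans (count≡∑ (λ r → ¬? (contains123? (toList r))) (WOC (suc n))) (∑-WOC (suc n) av))
         (trans (count≡∑ (λ r → stops? (suc n) (toList r)) (WOC (suc n))) (∑-WOC (suc n) (ind ∘ stops? (suc n)))) ⟩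
  ∑ (CW (suc n)) (av ∘ reverse) + ∑ (CW (suc n)) (ind ∘ stops? (suc n) ∘ reverse)
    ≡⟨ ∑-+ (CW (suc n)) (av ∘ reverse) (ind ∘ stops? (suc n) ∘ reverse) ⟨
  ∑ (CW (suc n)) (λ c → av (reverse c) + ind (stops? (suc n) (reverse c)))
    ≡⟨ ∑-concatMap children (CW n) _ ⟩
  ∑ (CW n) (λ ys → ∑ (children ys) (λ c → av (reverse c) + ind (stops? (suc n) (reverse c))))
    ≡⟨ ∑-cong (CW n) (λ {ys} ys∈ → trans
         (∑-cong (children ys) λ c∈ → av+stops (CW-sound n ys∈) (children⁻ c∈))
         (children-length ys (av (reverse ys)))) ⟩
  ∑ (CW n) (λ ys → av (reverse ys) * (2 * width ys + 1)) ∎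
  where open ≡-Reasoning

avoiding+stopping≡ : ∀ m → avoiding (2 + m) + stopping (2 + m) ≡ (T ^^ m) extensions (N 0)
avoiding+stopping≡ m = trans (avoiding+stopping (suc m)) (∑-CW m (represents-av reached))
  where
  lemma : ∀ κ → 2 * suc κ + 1 ≡ 2 * κ + 3
  lemma = solve-∀
  reached : ∀ s {ys} → Reaches s ys → 2 * width ys + 1 ≡ extensions s
  reached (N κ)   (_ , w≡ , _) = trans (cong (λ k → 2 * k + 1) w≡) (lemma κ)
  reached (H b κ) (_ , w≡ , _) = trans (cong (λ k → 2 * k + 1) w≡) (lemma κ)

-- Permutations weighted by descents

U-const : ∀ s → U (const-state 1) s ≡ 2 ^ descents s
U-const (PN p)     = trans (Bin-const p 1) (*-identityʳ _)
U-const (PH p s a) = trans (sym (Bin-split p s (λ _ → 1))) (trans (Bin-const (p + s) 1) (*-identityʳ _))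

-- The total weight `2 ^ des` of all insertions of a new maximum behind the first letter: at a
-- descent or at the end the number of descents is kept, at an ascent it grows by one.
insertWeight : PermState → ℕ
insertWeight (PN p)     = 2 ^ p * (1 + p)
insertWeight (PH p s a) = 2 ^ (p + s) * (2 * a + 3 + (p + s))

insertWeight-up : ∀ s → 2 ^ suc (descents s) + 2 * insertWeight s ≡ insertWeight (up s)
insertWeight-up (PN p) = lemma (2 ^ p) p
  where
  lemma : ∀ t p → 2 * t + 2 * (t * (1 + p)) ≡ 2 * t * (2 + p)
  lemma = solve-∀
insertWeight-up (PH p s a) = lemma (2 ^ (p + s)) (p + s) a
  where
  lemma : ∀ t d a → 2 * t + 2 * (t * (2 * a + 3 + d)) ≡ 2 * t * (2 * a + 3 + suc d)
  lemma = solve-∀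

insertWeight-asc : ∀ s → 2 ^ suc (descents s) + insertWeight s ≡ insertWeight (asc s)
insertWeight-asc (PN p) = lemma (2 ^ p) p
  where
  lemma : ∀ t p → 2 * t + t * (1 + p) ≡ t * (3 + p)
  lemma = solve-∀
insertWeight-asc (PH p s a) = lemma (2 ^ (p + s)) (p + s) a
  where
  lemma : ∀ t d a → 2 * t + t * (2 * a + 3 + d) ≡ t * (2 * suc a + 3 + d)
  lemma = solve-∀

-- The power of two is the weight of the insertion in front. Children of chains and insertions into
-- permutations thus have equal totals even when 123 is allowed to appear.
U-extensions : ∀ s → U extensions s ≡ 2 ^ suc (descents s) + insertWeight s
U-extensions (PN p) = trans (Bin-affine p 3) (lemma (2 ^ p) p)
  where
  lemma : ∀ t p → t * (p + 3) ≡ 2 * t + t * (1 + p)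
  lemma = solve-∀
U-extensions (PH p s a) = begin
  U extensions (PH p s a)
    ≡⟨ Bin-split p s (λ t → 2 * (t + suc a) + 3) ⟨
  Bin (p + s) (λ t → 2 * (t + suc a) + 3)
    ≡⟨ Bin-cong (p + s) (λ t → shift t a) ⟩
  Bin (p + s) (λ t → 2 * t + (2 * a + 5))
    ≡⟨ Bin-affine (p + s) (2 * a + 5) ⟩
  2 ^ (p + s) * (p + s + (2 * a + 5))
    ≡⟨ lemma (2 ^ (p + s)) (p + s) a ⟩
  2 ^ suc (p + s) + insertWeight (PH p s a) ∎
  where
  open ≡-Reasoning
  shift : ∀ t a → 2 * (t + suc a) + 3 ≡ 2 * t + (2 * a + 5)
  shift = solve-∀
  lemma : ∀ t d a → t * (d + (2 * a + 5)) ≡ 2 * t + t * (2 * a + 3 + d)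
  lemma = solve-∀

ins-after-weight : ∀ {n} x xs → All (_< n) (x ∷ xs) →
  ∑ (ins n xs) (λ c → 2 ^ descentsFrom x c) ≡ insertWeight (stateFrom x xs)
ins-after-weight {n} x [] (x<n ∷ []) rewrite dec-false (n <? x) (<-asym x<n) = refl
ins-after-weight {n} x (y ∷ ys) (x<n ∷ <n@(y<n ∷ _)) = trans
  (cong₂ _+_ first (trans (∑-map (y ∷_) (ins n ys) _)
    (trans (∑-cong (ins n ys) λ {c} _ → ^-distribˡ-+-* 2 (ind (y <? x)) (descentsFrom y c))
      (trans (∑-* (2 ^ ind (y <? x)) (ins n ys) _) (cong (2 ^ ind (y <? x) *_) (ins-after-weight y ys <n))))))
  step
  where
  d = descents (stateFrom y ys)
  first : 2 ^ descentsFrom x (n ∷ y ∷ ys) ≡ 2 ^ suc d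
  first rewrite dec-false (n <? x) (<-asym x<n) | dec-true (y <? n) y<n =
    cong (λ d → 2 ^ suc d) (sym (descents-stateFrom y ys))
  step : 2 ^ suc d + 2 ^ ind (y <? x) * insertWeight (stateFrom y ys) ≡ insertWeight (stateFrom x (y ∷ ys))
  step with does (y <? x)
  ... | true  = insertWeight-up (stateFrom y ys)
  ... | false = trans (cong (2 ^ suc d +_) (*-identityˡ _)) (insertWeight-asc (stateFrom y ys))

ins-weight : ∀ {n} x xs → All (_< n) (x ∷ xs) →
  ∑ (ins n (x ∷ xs)) (λ c → 2 ^ descentsOf c) ≡ U extensions (stateFrom x xs)
ins-weight {n} x xs <n@(x<n ∷ _) = trans
  (cong₂ _+_ (front-weight (x <? n))
    (trans (∑-map (x ∷_) (ins n xs) _) (ins-after-weight x xs <n)))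
  (sym (U-extensions (stateFrom x xs)))
  where
  front-weight : (p? : Dec (x < n)) → 2 ^ (ind p? + descentsFrom x xs) ≡ 2 ^ suc (descents (stateFrom x xs))
  front-weight (yes _)  = cong (λ d → 2 ^ suc d) (sym (descents-stateFrom x xs))
  front-weight (no x≮n) = ⊥-elim (x≮n x<n)

avoidingPerms : ℕ → ℕ
avoidingPerms n = ∑ (PW n) (λ xs → av xs * 2 ^ descentsOf xs)

stopsPerm? : ∀ n xs → Dec (Contains123 xs × ¬ Contains123 (without (n ∸ 1) xs))
stopsPerm? n xs = contains123? xs ×-dec ¬? (contains123? (without (n ∸ 1) xs))

stoppingPerms : ℕ → ℕ
stoppingPerms n = ∑ (PW n) (λ xs → ind (stopsPerm? n xs) * 2 ^ descentsOf xs)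

avoidingPerms≡ : ∀ m → avoidingPerms (suc m) ≡ (T ^^ m) (const-state 1) (N 0)
avoidingPerms≡ m = ∑-PW m rep
  where
  rep : (λ xs → av xs * 2 ^ descentsOf xs) RepresentsP[ suc m ] U (const-state 1)
  rep {x ∷ xs} p = cong (av (x ∷ xs) *_)
    (trans (cong (2 ^_) (sym (descents-stateFrom x xs))) (sym (U-const (stateFrom x xs))))

av+stopsPerm : ∀ {n xs c} → IsPW n xs → Insert n xs c → av c + ind (stopsPerm? (suc n) c) ≡ av xs
av+stopsPerm {n} {xs} {c} p i rewrite without-insert i (IsPW.≢n p) = total (contains123? xs)
  where
  total : Dec (Contains123 xs) → av c + ind (contains123? c ×-dec ¬? (contains123? xs)) ≡ av xs
  total (yes q) = trans (cong₂ _+_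
      (av-no {c} (has123-⊆ (insert-⊆ i) (contains⇒has q)))
      (ind-no (contains123? c ×-dec ¬? (contains123? xs)) (λ (_ , ¬q) → ¬q q)))
    (sym (av-no {xs} (contains⇒has q)))
  total (no ¬q) = trans (cong (av c +_)
      (ind-⇔ (contains123? c ×-dec ¬? (contains123? xs)) (contains123? c) proj₁ (_, ¬q)))
    (trans (ind-¬ (contains123? c)) (sym (av-yes {xs} (¬q ∘ has⇒contains))))

avoiding+stoppingPerms≡ : ∀ m → avoidingPerms (2 + m) + stoppingPerms (2 + m) ≡ (T ^^ m) extensions (N 0)
avoiding+stoppingPerms≡ m = begin
  avoidingPerms (2 + m) + stoppingPerms (2 + m)
    ≡⟨ ∑-+ (PW (2 + m)) (λ c → av c * 2 ^ descentsOf c) (λ c → ind (stopsPerm? (2 + m) c) * 2 ^ descentsOf c) ⟨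
  ∑ (PW (2 + m)) (λ c → av c * 2 ^ descentsOf c + ind (stopsPerm? (2 + m) c) * 2 ^ descentsOf c)
    ≡⟨ ∑-concatMap (ins (suc m)) (PW (suc m)) _ ⟩
  ∑ (PW (suc m)) (λ xs → ∑ (ins (suc m) xs)
      (λ c → av c * 2 ^ descentsOf c + ind (stopsPerm? (2 + m) c) * 2 ^ descentsOf c))
    ≡⟨ ∑-cong (PW (suc m)) (λ {xs} xs∈ → trans
         (∑-cong (ins (suc m) xs) λ {c} c∈ → trans
           (sym (*-distribʳ-+ (2 ^ descentsOf c) (av c) _))
           (cong (_* 2 ^ descentsOf c) (av+stopsPerm (PW-sound (suc m) xs∈) (ins⁻ xs c∈))))
         (∑-* (av xs) (ins (suc m) xs) _)) ⟩
  ∑ (PW (suc m)) (λ xs → av xs * ∑ (ins (suc m) xs) (λ c → 2 ^ descentsOf c))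
    ≡⟨ ∑-PW m rep ⟩
  (T ^^ m) extensions (N 0) ∎
  where
  open ≡-Reasoning
  rep : (λ xs → av xs * ∑ (ins (suc m) xs) (λ c → 2 ^ descentsOf c)) RepresentsP[ suc m ] U extensions
  rep {x ∷ xs} p = cong (av (x ∷ xs) *_) (ins-weight x xs (IsPW.bound p))

stopping≡stoppingPerms : ∀ m → stopping (2 + m) ≡ stoppingPerms (2 + m)
stopping≡stoppingPerms m = +-cancelˡ-≡ (avoiding (2 + m)) _ _ (begin
  avoiding (2 + m) + stopping (2 + m)             ≡⟨ avoiding+stopping≡ m ⟩
  (T ^^ m) extensions (N 0)                       ≡⟨ avoiding+stoppingPerms≡ m ⟨
  avoidingPerms (2 + m) + stoppingPerms (2 + m)   ≡⟨ cong (_+ stoppingPerms (2 + m))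
                                                       (trans (avoidingPerms≡ (suc m)) (sym (avoiding≡ (suc m)))) ⟩
  avoiding (2 + m) + stoppingPerms (2 + m)        ∎)
  where open ≡-Reasoning

sumFromTo≡∑< : ∀ a b f → sumFromTo a b f ≡ ∑< (suc b ∸ a) (λ k → f (a + k))
sumFromTo≡∑< a b f = ∑-upTo (suc b ∸ a) (λ k → f (a + k))

∈-Perms : ∀ {n} {σ : Fin n → Fin n} → σ ∈ Perms n → IsPW n (toList σ)
∈-Perms {n} {σ} σ∈ = perm-PW σ (proj₂ (∈-filter⁻ (isPerm? n) {xs = funs n n} σ∈))

∑-e : ∀ n → sumFromTo 0 n (λ d → 2 ^ d * e (suc n) d) ≡ avoidingPerms (suc n)
∑-e n = begin
  sumFromTo 0 n (λ d → 2 ^ d * e (suc n) d)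
    ≡⟨ sumFromTo≡∑< 0 n (λ d → 2 ^ d * e (suc n) d) ⟩
  ∑< (suc n) (λ d → 2 ^ d * e (suc n) d)
    ≡⟨ ∑-weighted-count (λ σ → ¬? (contains123? (toList σ))) des
         (λ d σ → ¬? (contains123? (toList σ)) ×-dec (des σ ≟ d)) id (_, refl) (suc n) (2 ^_) (Perms (suc n))
         (λ {σ} _ _ → subst (_< suc n) (sym (des≡descentsOf σ))
           (s≤s (subst (descentsOf (toList σ) ≤_) (length-tabulate (toℕ ∘ σ ∘ Fin.suc)) (descentsFrom≤ (toℕ (σ Fin.zero)) (tabulate (toℕ ∘ σ ∘ Fin.suc)))))) ⟩
  ∑ (Perms (suc n)) (λ σ → av (toList σ) * 2 ^ des σ)
    ≡⟨ ∑-cong (Perms (suc n)) (λ {σ} _ → cong (λ d → av (toList σ) * 2 ^ d) (des≡descentsOf σ)) ⟩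
  ∑ (Perms (suc n)) (λ σ → av (toList σ) * 2 ^ descentsOf (toList σ))
    ≡⟨ ∑-Perms (suc n) (λ xs → av xs * 2 ^ descentsOf xs) ⟩
  avoidingPerms (suc n) ∎
  where open ≡-Reasoning

-- For `d = 0` the value 0 prescribed by `g` agrees with the count: without descents, a 123 is still
-- there after the maximum is removed.
g≡gCount : ∀ k d → d < 2 + k → g (4 + k) d ≡ gCount (4 + k) d
g≡gCount k zero    d< = sym (trans (count≡∑ Q? (Perms (4 + k)))
  (trans (∑-cong (Perms (4 + k)) λ {σ} σ∈ → ind-no (Q? σ)
      λ (_ , d≡0 , ¬c) → ¬c (has⇒contains (without-max-123 (∈-Perms σ∈) (trans (sym (des≡descentsOf σ)) d≡0))))
    (∑-0 (Perms (4 + k)))))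
  where
  Q? : (σ : Fin (4 + k) → Fin (4 + k)) → Dec (Contains123 (toList σ) × des σ ≡ 0 × ¬ Contains123 (deleteMax σ))
  Q? σ = contains123? (toList σ) ×-dec (des σ ≟ 0) ×-dec ¬? (contains123? (deleteMax σ))
g≡gCount k (suc d) d< = cong (if_then gCount (4 + k) (suc d) else 0) (Equivalence.to T-≡ (≤⇒≤ᵇ (s≤s⁻¹ d<)))

∑-g : ∀ k → sumFromTo 0 (suc k) (λ d → 2 ^ d * g (4 + k) d) ≡ stoppingPerms (4 + k)
∑-g k = begin
  sumFromTo 0 (suc k) (λ d → 2 ^ d * g (4 + k) d)
    ≡⟨ sumFromTo≡∑< 0 (suc k) (λ d → 2 ^ d * g (4 + k) d) ⟩
  ∑< (2 + k) (λ d → 2 ^ d * g (4 + k) d)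
    ≡⟨ ∑<-cong (2 + k) (λ {d} d< → cong (2 ^ d *_) (g≡gCount k d d<)) ⟩
  ∑< (2 + k) (λ d → 2 ^ d * gCount (4 + k) d)
    ≡⟨ ∑-weighted-count (λ σ → stopsPerm? (4 + k) (toList σ)) des
         (λ d σ → contains123? (toList σ) ×-dec (des σ ≟ d) ×-dec ¬? (contains123? (deleteMax σ)))
         (λ (p , eq , q) → (p , q) , eq) (λ (p , q) → p , refl , q) (2 + k) (2 ^_) (Perms (4 + k))
         (λ {σ} _ (p , _) → subst (_< 2 + k) (sym (des≡descentsOf σ))
           (s≤s⁻¹ (s≤s⁻¹ (subst (3 + descentsOf (toList σ) ≤_) (length-tabulate (toℕ ∘ σ))
             (descents-123 (toList σ) (contains⇒has p)))))) ⟩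
  ∑ (Perms (4 + k)) (λ σ → ind (stopsPerm? (4 + k) (toList σ)) * 2 ^ des σ)
    ≡⟨ ∑-cong (Perms (4 + k)) (λ {σ} _ →
         cong (λ d → ind (stopsPerm? (4 + k) (toList σ)) * 2 ^ d) (des≡descentsOf σ)) ⟩
  ∑ (Perms (4 + k)) (λ σ → ind (stopsPerm? (4 + k) (toList σ)) * 2 ^ descentsOf (toList σ))
    ≡⟨ ∑-Perms (4 + k) (λ xs → ind (stopsPerm? (4 + k) xs) * 2 ^ descentsOf xs) ⟩
  stoppingPerms (4 + k) ∎
  where open ≡-Reasoning

w≡ : ∀ n → w n ≡ avoiding n + ∑< n (stopping ∘ suc)
w≡ n = cong (avoiding n +_) (sumFromTo≡∑< 1 n stopping)

w-by-descents : ∀ n → 1 ≤ n → w n ≡ sumFromTo 0 (n ∸ 1) (λ d → 2 ^ d * e n d)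
  + sumFromTo 3 n (λ j → sumFromTo 0 (j ∸ 3) (λ d → 2 ^ d * g j d))
w-by-descents (suc n) _ = trans (w≡ (suc n)) (cong₂ _+_
  (trans (avoiding≡ n) (trans (sym (avoidingPerms≡ n)) (sym (∑-e n))))
  (trans (stops n) (sym (sumFromTo≡∑< 3 (suc n) (λ j → sumFromTo 0 (j ∸ 3) (λ d → 2 ^ d * g j d))))))
  where
  stop : ∀ k → stopping (3 + k) ≡ sumFromTo 0 k (λ d → 2 ^ d * g (3 + k) d)
  -- For `j = 3` evaluation finds the single stopping chain `x₁ < x₂ < x₃`, matching the prescribed
  -- value 1 of `g 3 0`.
  stop zero    = refl
  stop (suc k) = trans (stopping≡stoppingPerms (2 + k)) (sym (∑-g k))
  stops : ∀ n → ∑< (suc n) (stopping ∘ suc)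
    ≡ ∑< (n ∸ 1) (λ k → sumFromTo 0 (3 + k ∸ 3) (λ d → 2 ^ d * g (3 + k) d))
  stops zero    = refl
  -- `stopping 1` and `stopping 2` evaluate to 0, so the sum effectively begins at 3.
  stops (suc n) = ∑<-cong n λ {k} _ → stop k

-- Increments and initial values of the sequence

∑<-* : ∀ n c (f : ℕ → ℕ) → ∑< n (λ v → c * f v) ≡ c * ∑< n f
∑<-* zero    c f = sym (*-zeroʳ c)
∑<-* (suc n) c f = trans (cong (c * f 0 +_) (∑<-* n c _)) (sym (*-distribˡ-+ c (f 0) _))

T-linear : ∀ {f g h} c → (∀ s → f s ≡ g s + c * h s) → ∀ s → T f s ≡ T g s + c * T h s
T-linear {f} {g} {h} c eq = step
  where
  sums : ∀ n (φ : ℕ → ChainState) →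
    ∑< n (λ v → f (φ v)) ≡ ∑< n (λ v → g (φ v)) + c * ∑< n (λ v → h (φ v))
  sums n φ = trans (∑<-cong n λ {v} _ → eq (φ v)) (trans (∑<-+ n _ _)
    (cong (∑< n (λ v → g (φ v)) +_) (∑<-* n c (λ v → h (φ v)))))
  arrange : ∀ c a a′ b b′ d d′ e e′ → (a + c * a′ + (b + c * b′)) + (d + c * d′ + (e + c * e′))
    ≡ (a + b + (d + e)) + c * (a′ + b′ + (d′ + e′))
  arrange = solve-∀
  step : ∀ s → T f s ≡ T g s + c * T h s
  step (N κ) = trans
    (cong₂ _+_ (cong₂ _+_ (eq (N κ)) (sums κ (λ v → H v κ)))
               (cong₂ _+_ (eq (N (suc κ))) (sums (suc κ) (λ v → H v (suc κ)))))
    (arrange c (g (N κ)) (h (N κ)) (∑< κ (λ v → g (H v κ))) (∑< κ (λ v → h (H v κ)))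
      (g (N (suc κ))) (h (N (suc κ))) (∑< (suc κ) (λ v → g (H v (suc κ)))) (∑< (suc κ) (λ v → h (H v (suc κ)))))
  step (H b κ) = trans
    (cong₂ _+_ (cong₂ _+_ (eq (H b κ)) (sums (suc b) (λ v → H v κ)))
               (cong₂ _+_ (eq (H (suc b) (suc κ))) (sums (suc b) (λ v → H v (suc κ)))))
    (arrange c (g (H b κ)) (h (H b κ)) (∑< (suc b) (λ v → g (H v κ))) (∑< (suc b) (λ v → h (H v κ)))
      (g (H (suc b) (suc κ))) (h (H (suc b) (suc κ)))
      (∑< (suc b) (λ v → g (H v (suc κ)))) (∑< (suc b) (λ v → h (H v (suc κ)))))

T-iterate-extensions : ∀ n s → (T ^^ n) extensions s ≡ (T ^^ n) (const-state 1) s + 2 * (T ^^ n) blocks s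
T-iterate-extensions zero    (N κ)   = lemma κ
  where
  lemma : ∀ κ → 2 * κ + 3 ≡ 1 + 2 * suc κ
  lemma = solve-∀
T-iterate-extensions zero    (H b κ) = lemma κ
  where
  lemma : ∀ κ → 2 * κ + 3 ≡ 1 + 2 * suc κ
  lemma = solve-∀
T-iterate-extensions (suc n) s = T-linear 2 (T-iterate-extensions n) s

totalBlocks : ℕ → ℕ
totalBlocks m = (T ^^ m) blocks (N 0)

w-step : ∀ m → w (2 + m) ≡ w (1 + m) + 2 * totalBlocks m
w-step m = begin
  w (2 + m)
    ≡⟨ trans (w≡ (2 + m)) (cong (avoiding (2 + m) +_) (∑<-last (1 + m) (λ k → stopping (suc k)))) ⟩
  avoiding (2 + m) + (S + stopping (2 + m))
    ≡⟨ swap (avoiding (2 + m)) S _ ⟩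
  (avoiding (2 + m) + stopping (2 + m)) + S
    ≡⟨ cong (_+ S) (trans (avoiding+stopping≡ m) (T-iterate-extensions m (N 0))) ⟩
  ((T ^^ m) (const-state 1) (N 0) + 2 * totalBlocks m) + S
    ≡⟨ cong (λ a → a + 2 * totalBlocks m + S) (sym (avoiding≡ m)) ⟩
  (avoiding (1 + m) + 2 * totalBlocks m) + S
    ≡⟨ swap′ (avoiding (1 + m)) _ S ⟩
  (avoiding (1 + m) + S) + 2 * totalBlocks m
    ≡⟨ cong (_+ 2 * totalBlocks m) (w≡ (1 + m)) ⟨
  w (1 + m) + 2 * totalBlocks m ∎
  where
  open ≡-Reasoning
  S = ∑< (1 + m) (λ k → stopping (suc k))
  swap : ∀ a s t → a + (s + t) ≡ (a + t) + s
  swap = solve-∀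
  swap′ : ∀ a b s → (a + b) + s ≡ (a + s) + b
  swap′ = solve-∀

-- With `W` abstract, checking the values evaluates only `totalBlocks`, not the enumeration of
-- functions behind `w`.
values-from-step : (W : ℕ → ℕ) → W 1 ≡ 1 → (∀ m → W (2 + m) ≡ W (1 + m) + 2 * totalBlocks m) →
  W 1 ≡ 1 × W 2 ≡ 3 × W 3 ≡ 13 × W 4 ≡ 69 × W 5 ≡ 401 × W 6 ≡ 2433 × W 7 ≡ 15121 × W 8 ≡ 95441
values-from-step W W₁ step = W₁ , W₂ , W₃ , W₄ , W₅ , W₆ , W₇ , W₈
  where
  next : ∀ m {a} → W (1 + m) ≡ a → W (2 + m) ≡ a + 2 * totalBlocks m
  next m eq = trans (step m) (cong (_+ 2 * totalBlocks m) eq)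
  W₂ = next 0 W₁
  W₃ = next 1 W₂
  W₄ = next 2 W₃
  W₅ = next 3 W₄
  W₆ = next 4 W₅
  W₇ = next 5 W₆
  W₈ = next 6 W₇

w-values : w 1 ≡ 1 × w 2 ≡ 3 × w 3 ≡ 13 × w 4 ≡ 69 × w 5 ≡ 401 × w 6 ≡ 2433 × w 7 ≡ 15121 × w 8 ≡ 95441
w-values = values-from-step w refl w-step

-- Formal power series

open import Data.Integer using (+_)

infix 4 _≈_
_≈_ : FPS → FPS → Set
a ≈ b = ∀ n → a n ≡ b n

tail : FPS → FPS
tail a n = a (suc n)

sumℤ-cong : ∀ n {f g : ℕ → ℤ} → (∀ k → k ≤ n → f k ≡ g k) → sumℤ n f ≡ sumℤ n g
sumℤ-cong zero    h = h 0 z≤n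
sumℤ-cong (suc n) h = cong₂ ℤ._+_ (sumℤ-cong n λ k k≤ → h k (m≤n⇒m≤1+n k≤)) (h (suc n) ≤-refl)

sumℤ-head : ∀ n f → sumℤ (suc n) f ≡ f 0 ℤ.+ sumℤ n (f ∘ suc)
sumℤ-head zero    f = refl
sumℤ-head (suc n) f = trans (cong (ℤ._+ f (suc (suc n))) (sumℤ-head n f)) (ℤ.+-assoc (f 0) _ _)

⊛-head : ∀ a b n → (a ⊛ b) (suc n) ≡ a 0 ℤ.* b (suc n) ℤ.+ (tail a ⊛ b) n
⊛-head a b n = sumℤ-head n (λ k → a k ℤ.* b (suc n ∸ k))

⊛-last : ∀ a b n → (a ⊛ b) (suc n) ≡ (a ⊛ tail b) n ℤ.+ a (suc n) ℤ.* b 0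
⊛-last a b n = cong₂ ℤ._+_
  (sumℤ-cong n λ k k≤n → cong (λ m → a k ℤ.* b m) (+-∸-assoc 1 k≤n))
  (cong (λ m → a (suc n) ℤ.* b m) (n∸n≡0 n))

⊛-cong : ∀ {a b c d} → a ≈ b → c ≈ d → a ⊛ c ≈ b ⊛ d
⊛-cong p q n = sumℤ-cong n λ k _ → cong₂ ℤ._*_ (p k) (q (n ∸ k))

⊛-comm : ∀ a b → a ⊛ b ≈ b ⊛ a
⊛-comm a b zero    = ℤ.*-comm (a 0) (b 0)
⊛-comm a b (suc n) = begin
  (a ⊛ b) (suc n)                             ≡⟨ ⊛-head a b n ⟩
  a 0 ℤ.* b (suc n) ℤ.+ (tail a ⊛ b) n        ≡⟨ cong₂ ℤ._+_ (ℤ.*-comm (a 0) _) (⊛-comm (tail a) b n) ⟩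
  b (suc n) ℤ.* a 0 ℤ.+ (b ⊛ tail a) n        ≡⟨ ℤ.+-comm (b (suc n) ℤ.* a 0) _ ⟩
  (b ⊛ tail a) n ℤ.+ b (suc n) ℤ.* a 0        ≡⟨ ⊛-last b a n ⟨
  (b ⊛ a) (suc n)                             ∎
  where open ≡-Reasoning

⊛-distribʳ : ∀ c a b → (a ⊕ b) ⊛ c ≈ (a ⊛ c) ⊕ (b ⊛ c)
⊛-distribʳ c a b n = go n
  where
  arrange : ∀ p q r s t → p ℤ.+ q ℤ.+ (r ℤ.+ s) ℤ.* t ≡ p ℤ.+ r ℤ.* t ℤ.+ (q ℤ.+ s ℤ.* t)
  arrange = ℤSolver.solve-∀
  go : ∀ m → sumℤ m (λ k → (a ⊕ b) k ℤ.* c (n ∸ k))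
    ≡ sumℤ m (λ k → a k ℤ.* c (n ∸ k)) ℤ.+ sumℤ m (λ k → b k ℤ.* c (n ∸ k))
  go zero    = ℤ.*-distribʳ-+ (c n) (a 0) (b 0)
  go (suc m) = trans (cong (ℤ._+ (a (suc m) ℤ.+ b (suc m)) ℤ.* c (n ∸ suc m)) (go m))
    (arrange (sumℤ m (λ k → a k ℤ.* c (n ∸ k))) (sumℤ m (λ k → b k ℤ.* c (n ∸ k))) (a (suc m)) (b (suc m)) _)

scale : ℤ → FPS → FPS
scale r a n = r ℤ.* a n

scale-⊛ : ∀ r a b → scale r a ⊛ b ≈ scale r (a ⊛ b)
scale-⊛ r a b n = go n
  where
  go : ∀ m → sumℤ m (λ k → r ℤ.* a k ℤ.* b (n ∸ k)) ≡ r ℤ.* sumℤ m (λ k → a k ℤ.* b (n ∸ k))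
  go zero    = ℤ.*-assoc r (a 0) (b n)
  go (suc m) = trans (cong₂ ℤ._+_ (go m) (ℤ.*-assoc r (a (suc m)) _))
    (sym (ℤ.*-distribˡ-+ r (sumℤ m (λ k → a k ℤ.* b (n ∸ k))) _))

⊛-assoc : ∀ a b c → (a ⊛ b) ⊛ c ≈ a ⊛ (b ⊛ c)
⊛-assoc a b c zero    = ℤ.*-assoc (a 0) (b 0) (c 0)
⊛-assoc a b c (suc n) = begin
  ((a ⊛ b) ⊛ c) (suc n)
    ≡⟨ ⊛-head (a ⊛ b) c n ⟩
  a 0 ℤ.* b 0 ℤ.* c (suc n) ℤ.+ (tail (a ⊛ b) ⊛ c) n
    ≡⟨ cong₂ ℤ._+_ (refl {x = a 0 ℤ.* b 0 ℤ.* c (suc n)}) (trans (⊛-cong {c = c} (⊛-head a b) (λ _ → refl) n)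
         (trans (⊛-distribʳ c (scale (a 0) (tail b)) (tail a ⊛ b) n)
           (cong₂ ℤ._+_ (scale-⊛ (a 0) (tail b) c n) (⊛-assoc (tail a) b c n)))) ⟩
  a 0 ℤ.* b 0 ℤ.* c (suc n) ℤ.+ (a 0 ℤ.* (tail b ⊛ c) n ℤ.+ (tail a ⊛ (b ⊛ c)) n)
    ≡⟨ arrange (a 0) (b 0) (c (suc n)) ((tail b ⊛ c) n) ((tail a ⊛ (b ⊛ c)) n) ⟩
  a 0 ℤ.* (b 0 ℤ.* c (suc n) ℤ.+ (tail b ⊛ c) n) ℤ.+ (tail a ⊛ (b ⊛ c)) n
    ≡⟨ cong (λ t → a 0 ℤ.* t ℤ.+ (tail a ⊛ (b ⊛ c)) n) (⊛-head b c n) ⟨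
  a 0 ℤ.* (b ⊛ c) (suc n) ℤ.+ (tail a ⊛ (b ⊛ c)) n
    ≡⟨ ⊛-head a (b ⊛ c) n ⟨
  (a ⊛ (b ⊛ c)) (suc n) ∎
  where
  open ≡-Reasoning
  arrange : ∀ p q r s t → p ℤ.* q ℤ.* r ℤ.+ (p ℤ.* s ℤ.+ t) ≡ p ℤ.* (q ℤ.* r ℤ.+ s) ℤ.+ t
  arrange = ℤSolver.solve-∀

constant : ℤ → FPS
constant r zero    = r
constant r (suc n) = + 0

neg : FPS → FPS
neg a n = ℤ.- a n

⊛-zeroˡ : ∀ {z} a → (∀ n → z n ≡ + 0) → ∀ n → (z ⊛ a) n ≡ + 0
⊛-zeroˡ {z} a z≡0 zero    = trans (cong (ℤ._* a 0) (z≡0 0)) (ℤ.*-zeroˡ (a 0))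
⊛-zeroˡ {z} a z≡0 (suc n) = trans (⊛-head z a n)
  (cong₂ ℤ._+_ (trans (cong (ℤ._* a (suc n)) (z≡0 0)) (ℤ.*-zeroˡ (a (suc n)))) (⊛-zeroˡ a (z≡0 ∘ suc) n))

constant-⊛ : ∀ r a n → (constant r ⊛ a) n ≡ r ℤ.* a n
constant-⊛ r a zero    = refl
constant-⊛ r a (suc n) = trans (⊛-head (constant r) a n)
  (trans (cong₂ ℤ._+_ (refl {x = r ℤ.* a (suc n)}) (⊛-zeroˡ a (λ _ → refl) n)) (ℤ.+-identityʳ _))

-- A copy of ⊛ that does not unfold to products of integers, which would make unification explode.
infixl 7 _⋆_

opaque
  _⋆_ : FPS → FPS → FPS
  _⋆_ = _⊛_

  ⋆≈⊛ : ∀ a b → a ⋆ b ≈ a ⊛ b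
  ⋆≈⊛ a b n = refl

  ⋆-cong : ∀ {a b c d} → a ≈ b → c ≈ d → a ⋆ c ≈ b ⋆ d
  ⋆-cong = ⊛-cong

  ⋆-comm : ∀ a b → a ⋆ b ≈ b ⋆ a
  ⋆-comm = ⊛-comm

  ⋆-assoc : ∀ a b c → (a ⋆ b) ⋆ c ≈ a ⋆ (b ⋆ c)
  ⋆-assoc = ⊛-assoc

  ⋆-distribʳ : ∀ c a b → (a ⊕ b) ⋆ c ≈ (a ⋆ c) ⊕ (b ⋆ c)
  ⋆-distribʳ = ⊛-distribʳ

  constant-⋆ : ∀ r a n → (constant r ⋆ a) n ≡ r ℤ.* a n
  constant-⋆ = constant-⊛

  ⋆-zero : ∀ a b → (a ⋆ b) 0 ≡ a 0 ℤ.* b 0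
  ⋆-zero a b = refl

ring : CommutativeRing 0ℓ 0ℓ
ring = record
  { Carrier = FPS
  ; _≈_ = _≈_
  ; _+_ = _⊕_
  ; _*_ = _⋆_
  ; -_  = neg
  ; 0#  = constant (+ 0)
  ; 1#  = constant (+ 1)
  ; isCommutativeRing = record
    { isRing = record
      { +-isAbelianGroup = record
        { isGroup = record
          { isMonoid = record
            { isSemigroup = record
              { isMagma = record
                { isEquivalence = record
                  { refl = λ _ → refl ; sym = λ p n → sym (p n) ; trans = λ p q n → trans (p n) (q n) }
                ; ∙-cong = λ p q n → cong₂ ℤ._+_ (p n) (q n) }
              ; assoc = λ a b c n → ℤ.+-assoc (a n) (b n) (c n) }
            ; identity = (λ a n → trans (cong (ℤ._+ a n) (zero-constant n)) (ℤ.+-identityˡ (a n)))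
                       , (λ a n → trans (cong₂ ℤ._+_ (refl {x = a n}) (zero-constant n)) (ℤ.+-identityʳ (a n))) }
          ; inverse = (λ a n → trans (ℤ.+-inverseˡ (a n)) (sym (zero-constant n)))
                    , (λ a n → trans (ℤ.+-inverseʳ (a n)) (sym (zero-constant n)))
          ; ⁻¹-cong = λ p n → cong ℤ.-_ (p n) }
        ; comm = λ a b n → ℤ.+-comm (a n) (b n) }
      ; *-cong = ⋆-cong
      ; *-assoc = ⋆-assoc
      ; *-identity = one-identity , (λ a n → trans (⋆-comm a (constant (+ 1)) n) (one-identity a n))
      ; distrib = (λ c a b n → trans (⋆-comm c (a ⊕ b) n) (trans (⋆-distribʳ c a b n)
                    (cong₂ ℤ._+_ (⋆-comm a c n) (⋆-comm b c n))))
                , ⋆-distribʳ }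
    ; *-comm = ⋆-comm } }
  where
  zero-constant : ∀ n → constant (+ 0) n ≡ + 0
  zero-constant zero    = refl
  zero-constant (suc n) = refl
  one-identity : ∀ a → constant (+ 1) ⋆ a ≈ a
  one-identity a n = trans (constant-⋆ (+ 1) a n) (ℤ.*-identityˡ (a n))

constant-hom : CommutativeRing.rawRing ℤ.+-*-commutativeRing -Raw-AlmostCommutative⟶ fromCommutativeRing ring
constant-hom = record
  { ⟦_⟧    = constant
  ; +-homo = λ { r s zero → refl ; r s (suc n) → refl }
  ; *-homo = λ { r s zero → sym (⋆-zero (constant r) (constant s)) ; r s (suc n) →
      sym (trans (constant-⋆ r (constant s) (suc n)) (ℤ.*-zeroʳ r)) }
  ; -‿homo = λ { r zero → refl ; r (suc n) → refl }
  ; 0-homo = λ _ → refl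
  ; 1-homo = λ _ → refl
  }

constant≟ : ∀ r s → Maybe (constant r ≈ constant s)
constant≟ r s with r ℤ.≟ s
... | yes refl = just λ _ → refl
... | no _     = nothing

import Algebra.Solver.Ring (CommutativeRing.rawRing ℤ.+-*-commutativeRing) (fromCommutativeRing ring)
  constant-hom constant≟ as Solver
open Solver using (Polynomial; solve; con; _:+_; _:*_; _:-_; _:=_)
open CommutativeRing ring using (0#) renaming
  ( _+_ to _⊞_; setoid to seriesSetoid; refl to ≈-refl; sym to ≈-sym; trans to ≈-trans
  ; +-cong to ⊞-cong; -‿cong to neg-cong; zeroʳ to ⋆-zeroʳ)

infixl 6 _⊖_
_⊖_ : FPS → FPS → FPS
a ⊖ b = a ⊕ neg b

⊖-cong : ∀ {a b c d} → a ≈ b → c ≈ d → a ⊖ c ≈ b ⊖ d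
⊖-cong p q = ⊞-cong p (neg-cong q)

0#≡0 : ∀ n → 0# n ≡ + 0
0#≡0 zero    = refl
0#≡0 (suc n) = refl

⊖≈0⇒≈ : ∀ {a b} → a ⊖ b ≈ 0# → a ≈ b
⊖≈0⇒≈ {a} {b} p n = ℤ.i-j≡0⇒i≡j (a n) (b n) (trans (p n) (0#≡0 n))

≈⇒⊖≈0 : ∀ {a b} → a ≈ b → a ⊖ b ≈ 0#
≈⇒⊖≈0 {a} {b} p n = trans (ℤ.i≡j⇒i-j≡0 (p n)) (sym (0#≡0 n))

-- Cancellation, uniqueness for linear systems and polynomial identities

-- The lowest coefficient of `a` that is not yet known to vanish meets only `b 0` in the product,
-- and ℤ has no zero divisors. This stands in for division: the constant term 2 of `S ⊞ R` in
-- `root-unique` is no unit of ℤ.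
cancelʳ : ∀ a b → b 0 ≢ + 0 → a ⋆ b ≈ 0# → a ≈ 0#
cancelʳ a b b₀≢0 ab≈0 n = trans (<-rec (λ n → a n ≡ + 0) step n) (sym (0#≡0 n))
  where
  leading : ∀ n → (∀ {k} → k < n → a k ≡ + 0) → (a ⊛ b) n ≡ a n ℤ.* b 0
  leading zero    below = refl
  leading (suc n) below = trans (⊛-last a b n) (trans
    (cong (ℤ._+ a (suc n) ℤ.* b 0) (zeros n ≤-refl)) (ℤ.+-identityˡ _))
    where
    zeros : ∀ m → m ≤ n → sumℤ m (λ k → a k ℤ.* tail b (n ∸ k)) ≡ + 0
    zeros zero    m≤n = trans (cong (ℤ._* tail b n) (below (s≤s z≤n))) (ℤ.*-zeroˡ (tail b n))
    zeros (suc m) m≤n = cong₂ ℤ._+_ (zeros m (<⇒≤ m≤n))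
      (trans (cong (ℤ._* tail b (n ∸ suc m)) (below (s≤s m≤n))) (ℤ.*-zeroˡ (tail b (n ∸ suc m))))
  step : ∀ n → (∀ {k} → k < n → a k ≡ + 0) → a n ≡ + 0
  step n below with ℤ.i*j≡0⇒i≡0∨j≡0 (a n)
    (trans (sym (leading n below)) (trans (sym (⋆≈⊛ a b n)) (trans (ab≈0 n) (0#≡0 n))))
  ... | inj₁ aₙ≡0 = aₙ≡0
  ... | inj₂ b₀≡0 = ⊥-elim (b₀≢0 b₀≡0)

X-zero : ∀ a → (X ⋆ a) 0 ≡ + 0
X-zero a = trans (⋆-zero X a) (ℤ.*-zeroˡ (a 0))

X-suc : ∀ a n → (X ⋆ a) (suc n) ≡ a n
X-suc a n = trans (⋆≈⊛ X a (suc n)) (trans (⊛-head X a n)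
  (trans (cong₂ ℤ._+_ (ℤ.*-zeroˡ (a (suc n))) (one n)) (ℤ.+-identityˡ (a n))))
  where
  one : ∀ n → (tail X ⊛ a) n ≡ a n
  one n = trans (⊛-cong {tail X} {constant (+ 1)} {a} {a} (λ { zero → refl ; (suc _) → refl }) (λ _ → refl) n)
    (trans (constant-⊛ (+ 1) a n) (ℤ.*-identityˡ (a n)))

-- Because of the factor `X`, the coefficients of degree `n + 1` are governed by those of degree
-- `n`, so all `E b` vanish simultaneously, degree by degree, although the system is infinite in
-- `b`.
vanish : ∀ (E F : ℕ → FPS) → (∀ b → E b ≈ X ⋆ F b) →
  (∀ n → (∀ b → E b n ≡ + 0) → ∀ b → F b n ≡ + 0) → ∀ b → E b ≈ 0#
vanish E F eq causal b n = trans (zeros n b) (sym (0#≡0 n))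
  where
  zeros : ∀ n b → E b n ≡ + 0
  zeros zero    b = trans (eq b 0) (X-zero (F b))
  zeros (suc n) b = trans (eq b (suc n)) (trans (X-suc (F b) n) (causal n (zeros n) b))

Σ< : ℕ → (ℕ → FPS) → FPS
Σ< zero    a = 0#
Σ< (suc n) a = a 0 ⊕ Σ< n (a ∘ suc)

Σ<-zero : ∀ m (a : ℕ → FPS) n → (∀ v → a v n ≡ + 0) → Σ< m a n ≡ + 0
Σ<-zero zero    a n h = 0#≡0 n
Σ<-zero (suc m) a n h = cong₂ ℤ._+_ (h 0) (Σ<-zero m (a ∘ suc) n (h ∘ suc))

minus-+ : ∀ t a b c d → (a ⊖ t ⋆ b) ⊕ (c ⊖ t ⋆ d) ≈ (a ⊕ c) ⊖ t ⋆ (b ⊕ d)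
minus-+ = solve 5 (λ t a b c d → (a :- t :* b) :+ (c :- t :* d) := (a :+ c) :- t :* (b :+ d)) (λ _ → refl)

Σ<-minus : ∀ m (t : FPS) (a b : ℕ → FPS) →
  Σ< m (λ v → a v ⊖ t ⋆ b v) ≈ Σ< m a ⊖ t ⋆ Σ< m b
Σ<-minus zero t a b = solve 1 (λ t → con (+ 0) := con (+ 0) :- t :* con (+ 0)) (λ _ → refl) t
Σ<-minus (suc m) t a b = ≈-trans (⊞-cong {a 0 ⊖ t ⋆ b 0} (λ _ → refl) (Σ<-minus m t (a ∘ suc) (b ∘ suc)))
  (minus-+ t (a 0) (b 0) (Σ< m (a ∘ suc)) (Σ< m (b ∘ suc)))

# : ℕ → FPS
# k = constant (+ k)

:# : ∀ {n} → ℕ → Polynomial n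
:# k = con (+ k)

:root :half :quadric :square : ∀ {n} → Polynomial n → Polynomial n → Polynomial n
:root x h = :# 1 :- :# 4 :* x :- :# 4 :* x :* x :* h
:half x h = :# 1 :- :# 2 :* x :- :# 2 :* x :* x :* h
:quadric x h = h :- (:# 1 :+ x :* (:# 4 :* h :+ :# 2 :* x :* h :* h))
:square x h = (:# 1 :+ x :* h) :* (:# 1 :+ x :* h)

-- For x = X and h = Hs 0 below: root is √P, half is (1 + √P) / 2, quadric vanishes, and square is Ys 0 · √P.
root half quadric square : FPS → FPS → FPS
root x h = # 1 ⊖ # 4 ⋆ x ⊖ # 4 ⋆ x ⋆ x ⋆ h
half x h = # 1 ⊖ # 2 ⋆ x ⊖ # 2 ⋆ x ⋆ x ⋆ h
quadric x h = h ⊖ (# 1 ⊞ x ⋆ (# 4 ⋆ h ⊞ # 2 ⋆ x ⋆ h ⋆ h))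
square x h = (# 1 ⊞ x ⋆ h) ⋆ (# 1 ⊞ x ⋆ h)

-- Completing the square in `2x²h² - (1 - 4x)h + 1 = 0`, whose discriminant is
-- `(1 - 4x)² - 8x² = 1 - 8x + 8x²`.
root-square-quadric : ∀ x h → root x h ⋆ root x h ⊖ (# 1 ⊖ # 8 ⋆ x ⊞ # 8 ⋆ x ⋆ x) ≈ (# 0 ⊖ # 8 ⋆ x ⋆ x) ⋆ quadric x h
root-square-quadric = solve 2 (λ x h → :root x h :* :root x h :- (:# 1 :- :# 8 :* x :+ :# 8 :* x :* x) := (:# 0 :- :# 8 :* x :* x) :* :quadric x h)
  (λ _ → refl)

-- The cofactors arise from eliminating z, δ and y in turn and dividing what remains by the quadric.
elimination : ∀ x h y δ z →
  let θ = # 1 ⊞ # 2 ⋆ x ⋆ h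
      ζ = x ⋆ (# 2 ⋆ y ⊖ h)
      e₂ = y ⋆ root x h ⊖ square x h
      e₃ = δ ⋆ half x h ⊖ x ⋆ h
      e₄ = z ⋆ half x h ⊖ x ⋆ ((ζ ⊞ θ) ⋆ δ ⊞ y)
  in ((# 1 ⊞ # 4 ⋆ x ⋆ (y ⊖ z)) ⋆ root x h ⊖ # 1) ⋆ (half x h ⋆ half x h)
   ≈ ((# 4 ⋆ x ⋆ x ⊖ # 8 ⋆ x ⋆ x ⋆ x ⊞ # 4 ⋆ x ⋆ x ⋆ x ⋆ h ⊖ # 16 ⋆ x ⋆ x ⋆ x ⋆ x ⋆ h
        ⊖ # 8 ⋆ x ⋆ x ⋆ x ⋆ x ⋆ x ⋆ h ⋆ h) ⋆ quadric x h
     ⊞ (# 4 ⋆ x ⋆ half x h ⋆ half x h ⊖ # 8 ⋆ x ⋆ x ⋆ x ⋆ x ⋆ h ⊖ # 4 ⋆ x ⋆ x ⋆ half x h) ⋆ e₂)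
     ⊖ # 4 ⋆ x ⋆ x ⋆ root x h ⋆ (ζ ⊞ θ) ⋆ e₃ ⊖ # 4 ⋆ x ⋆ root x h ⋆ half x h ⋆ e₄
elimination = solve 5 (λ x h y δ z →
  let θ = :# 1 :+ :# 2 :* x :* h
      ζ = x :* (:# 2 :* y :- h)
      e₂ = y :* :root x h :- :square x h
      e₃ = δ :* :half x h :- x :* h
      e₄ = z :* :half x h :- x :* ((ζ :+ θ) :* δ :+ y)
  in ((:# 1 :+ :# 4 :* x :* (y :- z)) :* :root x h :- :# 1) :* (:half x h :* :half x h)
   := ((:# 4 :* x :* x :- :# 8 :* x :* x :* x :+ :# 4 :* x :* x :* x :* h :- :# 16 :* x :* x :* x :* x :* h
        :- :# 8 :* x :* x :* x :* x :* x :* h :* h) :* :quadric x h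
     :+ (:# 4 :* x :* :half x h :* :half x h :- :# 8 :* x :* x :* x :* x :* h :- :# 4 :* x :* x :* :half x h) :* e₂)
     :- :# 4 :* x :* x :* :root x h :* (ζ :+ θ) :* e₃ :- :# 4 :* x :* :root x h :* :half x h :* e₄) (λ _ → refl)

-- Chains and blocks below a state

-- In the clause of `T` for `H b κ` the parameter `κ` bounds no sum; it only adds `κ` blocks to
-- every chain below. So functions of `b` alone suffice.
Tₕ : (ℕ → ℕ) → ℕ → ℕ
Tₕ p b = (p b + ∑< (suc b) p) + (p (suc b) + ∑< (suc b) p)

chainsIn : ℕ → ℕ → ℕ
chainsIn n = (Tₕ ^^ n) (λ _ → 1)

-- The total number of blocks below `H b 0`. The last bracket counts the chains below the splits,
-- each with one block more than the recursion at `κ = 0` gives it.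
blocksIn : ℕ → ℕ → ℕ
blocksIn zero    b = 1
blocksIn (suc n) b = Tₕ (blocksIn n) b + (chainsIn n (suc b) + ∑< (suc b) (chainsIn n))

T-iterate-const : ∀ n b κ → (T ^^ n) (const-state 1) (H b κ) ≡ chainsIn n b
T-iterate-const zero    b κ = refl
T-iterate-const (suc n) b κ = cong₂ _+_
  (cong₂ _+_ (T-iterate-const n b κ) (∑<-cong (suc b) λ {v} _ → T-iterate-const n v κ))
  (cong₂ _+_ (T-iterate-const n (suc b) (suc κ)) (∑<-cong (suc b) λ {v} _ → T-iterate-const n v (suc κ)))

T-iterate-blocks : ∀ n b κ → (T ^^ n) blocks (H b κ) ≡ blocksIn n b + κ * chainsIn n b
T-iterate-blocks zero    b κ = cong suc (sym (lemma κ))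
  where
  lemma : ∀ κ → κ * 1 ≡ κ
  lemma = solve-∀
T-iterate-blocks (suc n) b κ = trans
  (cong₂ _+_ (cong₂ _+_ (T-iterate-blocks n b κ) (sums κ))
               (cong₂ _+_ (T-iterate-blocks n (suc b) (suc κ)) (sums (suc κ))))
  (arrange κ (blocksIn n b) (chainsIn n b) (∑< (suc b) (blocksIn n)) (∑< (suc b) (chainsIn n)) (blocksIn n (suc b)) (chainsIn n (suc b)))
  where
  sums : ∀ κ → ∑< (suc b) (λ v → (T ^^ n) blocks (H v κ)) ≡ ∑< (suc b) (blocksIn n) + κ * ∑< (suc b) (chainsIn n)
  sums κ = trans (∑<-cong (suc b) λ {v} _ → T-iterate-blocks n v κ)
    (trans (∑<-+ (suc b) (blocksIn n) (λ v → κ * chainsIn n v)) (cong (_+_ (∑< (suc b) (blocksIn n))) (∑<-* (suc b) κ (chainsIn n))))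
  arrange : ∀ κ p q P Q r t →
    ((p + κ * q) + (P + κ * Q)) + ((r + suc κ * t) + (P + suc κ * Q))
    ≡ (((p + P) + (r + P)) + (t + Q)) + κ * ((q + Q) + (t + Q))
  arrange = solve-∀

-- Coefficient n of Hs b counts the avoiding chains n levels below the state H b 0, that of Ys b their blocks.
Hs Ys : ℕ → FPS
Hs b n = + chainsIn n b
Ys b n = + blocksIn n b

Σ<-coeff : ∀ m (p : ℕ → ℕ → ℕ) n → Σ< m (λ b n → + p n b) n ≡ + ∑< m (p n)
Σ<-coeff zero    p n = 0#≡0 n
Σ<-coeff (suc m) p n = cong (ℤ._+_ (+ p n 0)) (Σ<-coeff m (λ n b → p n (suc b)) n)

fromSteps : ∀ r a b → a 0 ≡ r → (∀ n → a (suc n) ≡ b n) → a ≈ constant r ⊞ X ⋆ b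
fromSteps r a b a₀ aₙ zero    = trans a₀ (sym (trans (cong (ℤ._+_ r) (X-zero b)) (ℤ.+-identityʳ r)))
fromSteps r a b a₀ aₙ (suc n) = trans (aₙ n) (sym (trans (ℤ.+-identityˡ _) (X-suc b n)))

Hs-eq : ∀ b → Hs b ≈ # 1 ⊞ X ⋆ ((Hs b ⊞ Σ< (suc b) Hs) ⊞ (Hs (suc b) ⊞ Σ< (suc b) Hs))
Hs-eq b = fromSteps (+ 1) (Hs b) _ refl λ n →
  cong (λ t → (+ chainsIn n b ℤ.+ t) ℤ.+ (+ chainsIn n (suc b) ℤ.+ t)) (sym (Σ<-coeff (suc b) chainsIn n))

Ys-eq : ∀ b → Ys b ≈ # 1 ⊞ X ⋆ (((Ys b ⊞ Σ< (suc b) Ys) ⊞ (Ys (suc b) ⊞ Σ< (suc b) Ys))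
  ⊞ (Hs (suc b) ⊞ Σ< (suc b) Hs))
Ys-eq b = fromSteps (+ 1) (Ys b) _ refl λ n →
  cong₂ (λ t t′ → ((+ blocksIn n b ℤ.+ t) ℤ.+ (+ blocksIn n (suc b) ℤ.+ t)) ℤ.+ (+ chainsIn n (suc b) ℤ.+ t′))
    (sym (Σ<-coeff (suc b) blocksIn n)) (sym (Σ<-coeff (suc b) chainsIn n))

-- T f (H κ κ) consists of the terms of T f (N κ) with N replaced by H, and one more term f (H κ κ);
-- so the gap between the two satisfies a system of the same shape as Hs and Ys.
gap : (ChainState → ℕ) → ℕ → FPS
gap f κ n = + (T ^^ n) f (H κ κ) ℤ.- + (T ^^ n) f (N κ)

gap-eq : ∀ f → (∀ κ → f (H κ κ) ≡ f (N κ)) → ∀ κ →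
  gap f κ ≈ X ⋆ ((gap f κ ⊞ gap f (suc κ)) ⊞ (λ n → + (T ^^ n) f (H κ κ)))
gap-eq f f₀ κ zero    = trans (ℤ.i≡j⇒i-j≡0 (cong +_ (f₀ κ)))
  (sym (X-zero ((gap f κ ⊞ gap f (suc κ)) ⊞ (λ n → + (T ^^ n) f (H κ κ)))))
gap-eq f f₀ κ (suc n) = trans
  (cong (λ t → + (a + t + (b + t′)) ℤ.- + (a′ + S + (b′ + t′))) (∑<-last κ (λ v → F (H v κ))))
  (trans (arrange (+ a) (+ a′) (+ b) (+ b′) (+ S) (+ t′))
    (sym (X-suc ((gap f κ ⊞ gap f (suc κ)) ⊞ (λ n → + (T ^^ n) f (H κ κ))) n)))
  where
  F = (T ^^ n) f
  a = F (H κ κ)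
  a′ = F (N κ)
  b = F (H (suc κ) (suc κ))
  b′ = F (N (suc κ))
  S = ∑< κ (λ v → F (H v κ))
  t′ = ∑< (suc κ) (λ v → F (H v (suc κ)))
  arrange : ∀ a a′ b b′ S t′ →
    (a ℤ.+ (S ℤ.+ a) ℤ.+ (b ℤ.+ t′)) ℤ.- (a′ ℤ.+ S ℤ.+ (b′ ℤ.+ t′))
    ≡ ((a ℤ.- a′) ℤ.+ (b ℤ.- b′)) ℤ.+ a
  arrange = ℤSolver.solve-∀

Δs Zs : ℕ → FPS
Δs = gap (const-state 1)
Zs = gap blocks

Δs-eq : ∀ κ → Δs κ ≈ X ⋆ ((Δs κ ⊞ Δs (suc κ)) ⊞ Hs κ)
Δs-eq κ = ≈-trans (gap-eq (const-state 1) (λ _ → refl) κ)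
  (⋆-cong {X} (λ _ → refl) λ n → cong (ℤ._+_ ((Δs κ ⊞ Δs (suc κ)) n)) (cong +_ (T-iterate-const n κ κ)))

Zs-eq : ∀ κ → Zs κ ≈ X ⋆ ((Zs κ ⊞ Zs (suc κ)) ⊞ (Ys κ ⊞ # κ ⋆ Hs κ))
Zs-eq κ = ≈-trans (gap-eq blocks (λ _ → refl) κ)
  (⋆-cong {X} (λ _ → refl) λ n → cong (ℤ._+_ ((Zs κ ⊞ Zs (suc κ)) n))
    (trans (cong +_ (T-iterate-blocks n κ κ)) (cong (ℤ._+_ (+ blocksIn n κ))
      (trans (ℤ.pos-* κ (chainsIn n κ)) (sym (constant-⋆ (+ κ) (Hs κ) n))))))

-- Shift relations

minus₂-+ : ∀ t z a b c a′ b′ c′ → (a ⊖ (t ⋆ b ⊞ z ⋆ c)) ⊞ (a′ ⊖ (t ⋆ b′ ⊞ z ⋆ c′))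
  ≈ (a ⊞ a′) ⊖ (t ⋆ (b ⊞ b′) ⊞ z ⋆ (c ⊞ c′))
minus₂-+ = solve 8 (λ t z a b c a′ b′ c′ → (a :- (t :* b :+ z :* c)) :+ (a′ :- (t :* b′ :+ z :* c′))
  := (a :+ a′) :- (t :* (b :+ b′) :+ z :* (c :+ c′))) ≈-refl

Σ<-minus₂ : ∀ m (t z : FPS) (a b c : ℕ → FPS) →
  Σ< m (λ v → a v ⊖ (t ⋆ b v ⊞ z ⋆ c v)) ≈ Σ< m a ⊖ (t ⋆ Σ< m b ⊞ z ⋆ Σ< m c)
Σ<-minus₂ zero t z a b c = solve 2 (λ t z → :# 0 := :# 0 :- (t :* :# 0 :+ z :* :# 0)) ≈-refl t z
Σ<-minus₂ (suc m) t z a b c =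
  ≈-trans (⊞-cong {a 0 ⊖ (t ⋆ b 0 ⊞ z ⋆ c 0)} ≈-refl (Σ<-minus₂ m t z (a ∘ suc) (b ∘ suc) (c ∘ suc)))
    (minus₂-+ t z (a 0) (b 0) (c 0) (Σ< m (a ∘ suc)) (Σ< m (b ∘ suc)) (Σ< m (c ∘ suc)))

-- Increasing b by one multiplies Hs by θ; ζ is the derivative of θ with respect to a variable marking blocks.
θ ζ : FPS
θ = # 1 ⊞ # 2 ⋆ X ⋆ Hs 0
ζ = X ⋆ (# 2 ⋆ Ys 0 ⊖ Hs 0)

-- Passing from `b` to `b + 1` adds the terms `v = 0`, that is `2 X Hs 0`, and shifts all others.
-- The constant 1 of the system thereby becomes `θ`, so the shifted system is solved by `θ` times
-- the old solution.
Hs-suc : ∀ b → Hs (suc b) ≈ θ ⋆ Hs b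
Hs-suc b = ⊖≈0⇒≈ (vanish E F step causal b)
  where
  E F : ℕ → FPS
  E b = Hs (suc b) ⊖ θ ⋆ Hs b
  F b = (E b ⊞ E (suc b)) ⊞ (Σ< (suc b) E ⊞ Σ< (suc b) E)
  causal : ∀ n → (∀ b → E b n ≡ + 0) → ∀ b → F b n ≡ + 0
  causal n z b = cong₂ ℤ._+_ (cong₂ ℤ._+_ (z b) (z (suc b)))
    (cong₂ ℤ._+_ (Σ<-zero (suc b) E n z) (Σ<-zero (suc b) E n z))
  step : ∀ b → E b ≈ X ⋆ F b
  step b = begin
    Hs (suc b) ⊖ θ ⋆ Hs b
      ≈⟨ ⊖-cong (Hs-eq (suc b)) (⋆-cong {θ} ≈-refl (Hs-eq b)) ⟩
    (# 1 ⊞ X ⋆ ((Hs (suc b) ⊞ (Hs 0 ⊞ S′)) ⊞ (Hs (suc (suc b)) ⊞ (Hs 0 ⊞ S′))))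
      ⊖ θ ⋆ (# 1 ⊞ X ⋆ ((Hs b ⊞ S) ⊞ (Hs (suc b) ⊞ S)))
      ≈⟨ solve 7 (λ x h₀ a b c s s′ → let θ = :# 1 :+ :# 2 :* x :* h₀ in
           (:# 1 :+ x :* ((b :+ (h₀ :+ s′)) :+ (c :+ (h₀ :+ s′)))) :- θ :* (:# 1 :+ x :* ((a :+ s) :+ (b :+ s)))
           := x :* (((b :- θ :* a) :+ (c :- θ :* b)) :+ ((s′ :- θ :* s) :+ (s′ :- θ :* s))))
           ≈-refl X (Hs 0) (Hs b) (Hs (suc b)) (Hs (suc (suc b))) S S′ ⟩
    X ⋆ ((E b ⊞ E (suc b)) ⊞ ((S′ ⊖ θ ⋆ S) ⊞ (S′ ⊖ θ ⋆ S)))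
      ≈⟨ ⋆-cong {X} ≈-refl (⊞-cong {E b ⊞ E (suc b)} ≈-refl
           (⊞-cong (≈-sym (Σ<-minus (suc b) θ (Hs ∘ suc) Hs)) (≈-sym (Σ<-minus (suc b) θ (Hs ∘ suc) Hs)))) ⟩
    X ⋆ F b ∎
    where
    open SetoidReasoning seriesSetoid
    S  = Σ< (suc b) Hs
    S′ = Σ< (suc b) (Hs ∘ suc)

Hs-defect : ∀ b → Hs (suc b) ⊖ θ ⋆ Hs b ≈ 0#
Hs-defect b = ≈⇒⊖≈0 (Hs-suc b)

-- Here the terms `v = 0` turn the constant 1 into `1 + X (2 Ys 0 + Hs 0)`, which is `θ + ζ`; this
-- determines `ζ`. The defects of the relation for `Hs` enter as inhomogeneous terms already known
-- to vanish.
Ys-suc : ∀ b → Ys (suc b) ⊖ (θ ⋆ Ys b ⊞ ζ ⋆ Hs b) ≈ 0#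
Ys-suc = vanish E F step causal
  where
  D E F : ℕ → FPS
  D b = Hs (suc b) ⊖ θ ⋆ Hs b
  E b = Ys (suc b) ⊖ (θ ⋆ Ys b ⊞ ζ ⋆ Hs b)
  F b = ((E b ⊞ Σ< (suc b) E) ⊞ (E (suc b) ⊞ Σ< (suc b) E)) ⊞ (D (suc b) ⊞ Σ< (suc b) D)
  causal : ∀ n → (∀ b → E b n ≡ + 0) → ∀ b → F b n ≡ + 0
  causal n z b = cong₂ ℤ._+_
    (cong₂ ℤ._+_ (cong₂ ℤ._+_ (z b) (Σ<-zero (suc b) E n z)) (cong₂ ℤ._+_ (z (suc b)) (Σ<-zero (suc b) E n z)))
    (cong₂ ℤ._+_ (defect n (suc b)) (Σ<-zero (suc b) D n (defect n)))
    where
    defect : ∀ n v → D v n ≡ + 0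
    defect n v = trans (Hs-defect v n) (0#≡0 n)
  step : ∀ b → E b ≈ X ⋆ F b
  step b = begin
    Ys (suc b) ⊖ (θ ⋆ Ys b ⊞ ζ ⋆ Hs b)
      ≈⟨ ⊖-cong (Ys-eq (suc b)) (⊞-cong (⋆-cong {θ} ≈-refl (Ys-eq b)) (⋆-cong {ζ} ≈-refl (Hs-eq b))) ⟩
    (# 1 ⊞ X ⋆ (((Ys (suc b) ⊞ (Ys 0 ⊞ R′)) ⊞ (Ys (suc (suc b)) ⊞ (Ys 0 ⊞ R′)))
        ⊞ (Hs (suc (suc b)) ⊞ (Hs 0 ⊞ S′))))
      ⊖ (θ ⋆ (# 1 ⊞ X ⋆ (((Ys b ⊞ R) ⊞ (Ys (suc b) ⊞ R)) ⊞ (Hs (suc b) ⊞ S)))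
         ⊞ ζ ⋆ (# 1 ⊞ X ⋆ ((Hs b ⊞ S) ⊞ (Hs (suc b) ⊞ S))))
      ≈⟨ ⊖-cong (⊞-cong {# 1} ≈-refl (⋆-cong {X} ≈-refl
           (regroup (Ys 0) (Hs 0) (Ys (suc b)) (Ys (suc (suc b))) R′ (Hs (suc (suc b))) S′))) ≈-refl ⟩
    (# 1 ⊞ X ⋆ ((α′ ⊞ γ′) ⊞ (# 2 ⋆ Ys 0 ⊞ Hs 0))) ⊖ (θ ⋆ (# 1 ⊞ X ⋆ (α ⊞ γ)) ⊞ ζ ⋆ (# 1 ⊞ X ⋆ β))
      ≈⟨ solve 8 (λ x h₀ y₀ α α′ β γ γ′ →
           let θ = :# 1 :+ :# 2 :* x :* h₀
               ζ = x :* (:# 2 :* y₀ :- h₀) in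
           (:# 1 :+ x :* ((α′ :+ γ′) :+ (:# 2 :* y₀ :+ h₀)))
             :- (θ :* (:# 1 :+ x :* (α :+ γ)) :+ ζ :* (:# 1 :+ x :* β))
           := x :* ((α′ :- (θ :* α :+ ζ :* β)) :+ (γ′ :- θ :* γ)))
           ≈-refl X (Hs 0) (Ys 0) α α′ β γ γ′ ⟩
    X ⋆ ((α′ ⊖ (θ ⋆ α ⊞ ζ ⋆ β)) ⊞ (γ′ ⊖ θ ⋆ γ))
      ≈⟨ ⋆-cong {X} ≈-refl (⊞-cong
           (≈-trans (⊞-cong (part (Ys (suc b)) (Ys b) (Hs b)) (part (Ys (suc (suc b))) (Ys (suc b)) (Hs (suc b))))
             (minus₂-+ θ ζ (Ys (suc b) ⊞ R′) (Ys b ⊞ R) (Hs b ⊞ S) (Ys (suc (suc b)) ⊞ R′) (Ys (suc b) ⊞ R) (Hs (suc b) ⊞ S)))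
           (≈-trans (⊞-cong {D (suc b)} ≈-refl (Σ<-minus (suc b) θ (Hs ∘ suc) Hs))
             (minus-+ θ (Hs (suc (suc b))) (Hs (suc b)) S′ S))) ⟨
    X ⋆ F b ∎
    where
    open SetoidReasoning seriesSetoid
    R R′ S S′ α α′ β γ γ′ : FPS
    R  = Σ< (suc b) Ys
    R′ = Σ< (suc b) (Ys ∘ suc)
    S  = Σ< (suc b) Hs
    S′ = Σ< (suc b) (Hs ∘ suc)
    α  = (Ys b ⊞ R) ⊞ (Ys (suc b) ⊞ R)
    α′ = (Ys (suc b) ⊞ R′) ⊞ (Ys (suc (suc b)) ⊞ R′)
    β  = (Hs b ⊞ S) ⊞ (Hs (suc b) ⊞ S)
    γ  = Hs (suc b) ⊞ S
    γ′ = Hs (suc (suc b)) ⊞ S′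
    regroup : ∀ y₀ h₀ y₁ y₂ r k s → (((y₁ ⊞ (y₀ ⊞ r)) ⊞ (y₂ ⊞ (y₀ ⊞ r))) ⊞ (k ⊞ (h₀ ⊞ s)))
      ≈ ((((y₁ ⊞ r) ⊞ (y₂ ⊞ r)) ⊞ (k ⊞ s)) ⊞ (# 2 ⋆ y₀ ⊞ h₀))
    regroup = solve 7 (λ y₀ h₀ y₁ y₂ r k s → (((y₁ :+ (y₀ :+ r)) :+ (y₂ :+ (y₀ :+ r))) :+ (k :+ (h₀ :+ s)))
      := ((((y₁ :+ r) :+ (y₂ :+ r)) :+ (k :+ s)) :+ (:# 2 :* y₀ :+ h₀))) ≈-refl
    part : ∀ p q r → (p ⊖ (θ ⋆ q ⊞ ζ ⋆ r)) ⊞ Σ< (suc b) E ≈ (p ⊞ R′) ⊖ (θ ⋆ (q ⊞ R) ⊞ ζ ⋆ (r ⊞ S))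
    part p q r = ≈-trans (⊞-cong {p ⊖ (θ ⋆ q ⊞ ζ ⋆ r)} ≈-refl (Σ<-minus₂ (suc b) θ ζ (Ys ∘ suc) Ys Hs))
      (minus₂-+ θ ζ p q r R′ R S)

Δs-suc : ∀ κ → Δs (suc κ) ⊖ θ ⋆ Δs κ ≈ 0#
Δs-suc = vanish E F causal-step causal
  where
  D E F : ℕ → FPS
  D b = Hs (suc b) ⊖ θ ⋆ Hs b
  E κ = Δs (suc κ) ⊖ θ ⋆ Δs κ
  F κ = (E κ ⊞ E (suc κ)) ⊞ D κ
  causal : ∀ n → (∀ b → E b n ≡ + 0) → ∀ b → F b n ≡ + 0
  causal n z b = cong₂ ℤ._+_ (cong₂ ℤ._+_ (z b) (z (suc b))) (trans (Hs-defect b n) (0#≡0 n))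
  causal-step : ∀ κ → E κ ≈ X ⋆ F κ
  causal-step κ = ≈-trans (⊖-cong (Δs-eq (suc κ)) (⋆-cong {θ} ≈-refl (Δs-eq κ)))
    (solve 7 (λ x t a b c k l →
      x :* ((b :+ c) :+ l) :- t :* (x :* ((a :+ b) :+ k))
      := x :* (((b :- t :* a) :+ (c :- t :* b)) :+ (l :- t :* k)))
      ≈-refl X θ (Δs κ) (Δs (suc κ)) (Δs (suc (suc κ))) (Hs κ) (Hs (suc κ)))

-- In `H κ κ` both parameters move. The extra `θ` beside `ζ` accounts for the additional block that
-- a larger `κ` gives to every chain.
Zs-suc : ∀ κ → Zs (suc κ) ⊖ (θ ⋆ Zs κ ⊞ (ζ ⊞ θ) ⋆ Δs κ) ≈ 0#
Zs-suc = vanish E F causal-step causal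
  where
  D G E F : ℕ → FPS
  D b = Hs (suc b) ⊖ θ ⋆ Hs b
  G b = Ys (suc b) ⊖ (θ ⋆ Ys b ⊞ ζ ⋆ Hs b)
  E κ = Zs (suc κ) ⊖ (θ ⋆ Zs κ ⊞ (ζ ⊞ θ) ⋆ Δs κ)
  F κ = (E κ ⊞ E (suc κ)) ⊞ (G κ ⊞ # (suc κ) ⋆ D κ)
  causal : ∀ n → (∀ b → E b n ≡ + 0) → ∀ b → F b n ≡ + 0
  causal n z b = cong₂ ℤ._+_ (cong₂ ℤ._+_ (z b) (z (suc b)))
    (cong₂ ℤ._+_ (trans (Ys-suc b n) (0#≡0 n)) (trans (constant-⋆ (+ suc b) (D b) n)
      (trans (cong (ℤ._*_ (+ suc b)) (trans (Hs-defect b n) (0#≡0 n))) (ℤ.*-zeroʳ (+ suc b)))))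
  #-suc : ∀ κ → # (suc κ) ≈ # 1 ⊞ # κ
  #-suc κ zero    = refl
  #-suc κ (suc n) = refl
  causal-step : ∀ κ → E κ ≈ X ⋆ F κ
  causal-step κ = begin
    Zs (suc κ) ⊖ (θ ⋆ Zs κ ⊞ (ζ ⊞ θ) ⋆ Δs κ)
      ≈⟨ ⊖-cong (Zs-eq (suc κ)) (⊞-cong (⋆-cong {θ} ≈-refl (Zs-eq κ)) (⋆-cong {ζ ⊞ θ} ≈-refl (Δs-eq κ))) ⟩
    X ⋆ ((Zs (suc κ) ⊞ Zs (suc (suc κ))) ⊞ (Ys (suc κ) ⊞ # (suc κ) ⋆ Hs (suc κ)))
      ⊖ (θ ⋆ (X ⋆ ((Zs κ ⊞ Zs (suc κ)) ⊞ (Ys κ ⊞ # κ ⋆ Hs κ)))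
         ⊞ (ζ ⊞ θ) ⋆ (X ⋆ ((Δs κ ⊞ Δs (suc κ)) ⊞ Hs κ)))
      ≈⟨ ⊖-cong (⋆-cong {X} ≈-refl (⊞-cong {Zs (suc κ) ⊞ Zs (suc (suc κ))} ≈-refl
           (⊞-cong {Ys (suc κ)} ≈-refl (⋆-cong {c = Hs (suc κ)} (#-suc κ) ≈-refl)))) ≈-refl ⟩
    X ⋆ ((Zs (suc κ) ⊞ Zs (suc (suc κ))) ⊞ (Ys (suc κ) ⊞ (# 1 ⊞ # κ) ⋆ Hs (suc κ)))
      ⊖ (θ ⋆ (X ⋆ ((Zs κ ⊞ Zs (suc κ)) ⊞ (Ys κ ⊞ # κ ⋆ Hs κ)))
         ⊞ (ζ ⊞ θ) ⋆ (X ⋆ ((Δs κ ⊞ Δs (suc κ)) ⊞ Hs κ)))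
      ≈⟨ solve 6 (λ x t z a b c → x :* a :- (t :* (x :* b) :+ z :* (x :* c)) := x :* (a :- (t :* b :+ z :* c)))
           ≈-refl X θ (ζ ⊞ θ) ((Zs (suc κ) ⊞ Zs (suc (suc κ))) ⊞ (Ys (suc κ) ⊞ (# 1 ⊞ # κ) ⋆ Hs (suc κ)))
             ((Zs κ ⊞ Zs (suc κ)) ⊞ (Ys κ ⊞ # κ ⋆ Hs κ)) ((Δs κ ⊞ Δs (suc κ)) ⊞ Hs κ) ⟩
    X ⋆ (((Zs (suc κ) ⊞ Zs (suc (suc κ))) ⊞ (Ys (suc κ) ⊞ (# 1 ⊞ # κ) ⋆ Hs (suc κ)))
      ⊖ (θ ⋆ ((Zs κ ⊞ Zs (suc κ)) ⊞ (Ys κ ⊞ # κ ⋆ Hs κ)) ⊞ (ζ ⊞ θ) ⋆ ((Δs κ ⊞ Δs (suc κ)) ⊞ Hs κ)))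
      ≈⟨ ⋆-cong {X} ≈-refl (≈-trans
           (⊞-cong (minus₂-+ θ (ζ ⊞ θ) (Zs (suc κ)) (Zs κ) (Δs κ) (Zs (suc (suc κ))) (Zs (suc κ)) (Δs (suc κ)))
             (inner θ ζ (# κ) (Hs κ) (Hs (suc κ)) (Ys κ) (Ys (suc κ))))
           (minus₂-+ θ (ζ ⊞ θ) (Zs (suc κ) ⊞ Zs (suc (suc κ))) (Zs κ ⊞ Zs (suc κ)) (Δs κ ⊞ Δs (suc κ))
             (Ys (suc κ) ⊞ (# 1 ⊞ # κ) ⋆ Hs (suc κ)) (Ys κ ⊞ # κ ⋆ Hs κ) (Hs κ))) ⟨
    X ⋆ ((E κ ⊞ E (suc κ)) ⊞ (G κ ⊞ (# 1 ⊞ # κ) ⋆ D κ))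
      ≈⟨ ⋆-cong {X} ≈-refl (⊞-cong {E κ ⊞ E (suc κ)} ≈-refl
           (⊞-cong {G κ} ≈-refl (⋆-cong {c = D κ} (≈-sym (#-suc κ)) ≈-refl))) ⟩
    X ⋆ F κ ∎
    where
    open SetoidReasoning seriesSetoid
    inner : ∀ t z i k l p q → (q ⊖ (t ⋆ p ⊞ z ⋆ k)) ⊞ (# 1 ⊞ i) ⋆ (l ⊖ t ⋆ k)
      ≈ (q ⊞ (# 1 ⊞ i) ⋆ l) ⊖ (t ⋆ (p ⊞ i ⋆ k) ⊞ (z ⊞ t) ⋆ k)
    inner = solve 7 (λ t z i k l p q → (q :- (t :* p :+ z :* k)) :+ (:# 1 :+ i) :* (l :- t :* k)
      := (q :+ (:# 1 :+ i) :* l) :- (t :* (p :+ i :* k) :+ (z :+ t) :* k)) ≈-refl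

-- The generating function

quadric≈0 : quadric X (Hs 0) ≈ 0#
quadric≈0 = ≈⇒⊖≈0 (begin
  Hs 0
    ≈⟨ Hs-eq 0 ⟩
  # 1 ⊞ X ⋆ ((Hs 0 ⊞ (Hs 0 ⊞ 0#)) ⊞ (Hs 1 ⊞ (Hs 0 ⊞ 0#)))
    ≈⟨ ⊞-cong {# 1} ≈-refl (⋆-cong {X} ≈-refl (⊞-cong {Hs 0 ⊞ (Hs 0 ⊞ 0#)} ≈-refl (⊞-cong {u = Hs 0 ⊞ 0#} (Hs-suc 0) ≈-refl))) ⟩
  # 1 ⊞ X ⋆ ((Hs 0 ⊞ (Hs 0 ⊞ 0#)) ⊞ (θ ⋆ Hs 0 ⊞ (Hs 0 ⊞ 0#)))
    ≈⟨ solve 2 (λ x h → :# 1 :+ x :* ((h :+ (h :+ :# 0)) :+ ((:# 1 :+ :# 2 :* x :* h) :* h :+ (h :+ :# 0)))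
         := :# 1 :+ x :* (:# 4 :* h :+ :# 2 :* x :* h :* h)) ≈-refl X (Hs 0) ⟩
  # 1 ⊞ X ⋆ (# 4 ⋆ Hs 0 ⊞ # 2 ⋆ X ⋆ Hs 0 ⋆ Hs 0) ∎)
  where open SetoidReasoning seriesSetoid

-- Counting blocks differentiates the equation of `Hs 0` with respect to a variable marking them, so
-- the coefficient of `Ys 0` is the derivative of `quadric` in `h`, which is `root`.
blocks≈0 : Ys 0 ⋆ root X (Hs 0) ⊖ square X (Hs 0) ≈ 0#
blocks≈0 = begin
  Ys 0 ⋆ root X (Hs 0) ⊖ square X (Hs 0)
    ≈⟨ solve 3 (λ x h y →
         let θ = :# 1 :+ :# 2 :* x :* h
             ζ = x :* (:# 2 :* y :- h) in
         y :* :root x h :- :square x h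
         := y :- (:# 1 :+ x :* (((y :+ (y :+ :# 0)) :+ ((θ :* y :+ ζ :* h) :+ (y :+ :# 0))) :+ (θ :* h :+ (h :+ :# 0)))))
         ≈-refl X (Hs 0) (Ys 0) ⟩
  Ys 0 ⊖ (# 1 ⊞ X ⋆ (((Ys 0 ⊞ (Ys 0 ⊞ 0#)) ⊞ ((θ ⋆ Ys 0 ⊞ ζ ⋆ Hs 0) ⊞ (Ys 0 ⊞ 0#))) ⊞ (θ ⋆ Hs 0 ⊞ (Hs 0 ⊞ 0#))))
    ≈⟨ ⊖-cong {Ys 0} ≈-refl (⊞-cong {# 1} ≈-refl (⋆-cong {X} ≈-refl (⊞-cong
         (⊞-cong {Ys 0 ⊞ (Ys 0 ⊞ 0#)} ≈-refl (⊞-cong {u = Ys 0 ⊞ 0#} (⊖≈0⇒≈ {Ys 1} {θ ⋆ Ys 0 ⊞ ζ ⋆ Hs 0} (Ys-suc 0)) ≈-refl))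
         (⊞-cong {u = Hs 0 ⊞ 0#} (Hs-suc 0) ≈-refl)))) ⟨
  Ys 0 ⊖ (# 1 ⊞ X ⋆ (((Ys 0 ⊞ (Ys 0 ⊞ 0#)) ⊞ (Ys 1 ⊞ (Ys 0 ⊞ 0#))) ⊞ (Hs 1 ⊞ (Hs 0 ⊞ 0#))))
    ≈⟨ ≈⇒⊖≈0 (Ys-eq 0) ⟩
  0# ∎
  where open SetoidReasoning seriesSetoid

-- The factor `half` is `1 - X (1 + θ)`, what remains at `Δs 0` once `Δs 1` is replaced by
-- `θ ⋆ Δs 0`.
Δs≈0 : Δs 0 ⋆ half X (Hs 0) ⊖ X ⋆ Hs 0 ≈ 0#
Δs≈0 = begin
  Δs 0 ⋆ half X (Hs 0) ⊖ X ⋆ Hs 0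
    ≈⟨ solve 3 (λ x h δ → δ :* :half x h :- x :* h
         := δ :- x :* ((δ :+ (:# 1 :+ :# 2 :* x :* h) :* δ) :+ h)) ≈-refl X (Hs 0) (Δs 0) ⟩
  Δs 0 ⊖ X ⋆ ((Δs 0 ⊞ θ ⋆ Δs 0) ⊞ Hs 0)
    ≈⟨ ⊖-cong {Δs 0} ≈-refl (⋆-cong {X} ≈-refl (⊞-cong {u = Hs 0} (⊞-cong {Δs 0} ≈-refl (⊖≈0⇒≈ {Δs 1} {θ ⋆ Δs 0} (Δs-suc 0))) ≈-refl)) ⟨
  Δs 0 ⊖ X ⋆ ((Δs 0 ⊞ Δs 1) ⊞ Hs 0)
    ≈⟨ ≈⇒⊖≈0 (Δs-eq 0) ⟩
  0# ∎
  where open SetoidReasoning seriesSetoid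

Zs≈0 : Zs 0 ⋆ half X (Hs 0) ⊖ X ⋆ ((ζ ⊞ θ) ⋆ Δs 0 ⊞ Ys 0) ≈ 0#
Zs≈0 = begin
  Zs 0 ⋆ half X (Hs 0) ⊖ X ⋆ ((ζ ⊞ θ) ⋆ Δs 0 ⊞ Ys 0)
    ≈⟨ solve 5 (λ x h y δ z →
         let θ = :# 1 :+ :# 2 :* x :* h
             ζ = x :* (:# 2 :* y :- h) in
         z :* :half x h :- x :* ((ζ :+ θ) :* δ :+ y)
         := z :- x :* ((z :+ (θ :* z :+ (ζ :+ θ) :* δ)) :+ (y :+ :# 0 :* h)))
         ≈-refl X (Hs 0) (Ys 0) (Δs 0) (Zs 0) ⟩
  Zs 0 ⊖ X ⋆ ((Zs 0 ⊞ (θ ⋆ Zs 0 ⊞ (ζ ⊞ θ) ⋆ Δs 0)) ⊞ (Ys 0 ⊞ # 0 ⋆ Hs 0))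
    ≈⟨ ⊖-cong {Zs 0} ≈-refl (⋆-cong {X} ≈-refl (⊞-cong {u = Ys 0 ⊞ # 0 ⋆ Hs 0} (⊞-cong {Zs 0} ≈-refl (⊖≈0⇒≈ {Zs 1} {θ ⋆ Zs 0 ⊞ (ζ ⊞ θ) ⋆ Δs 0} (Zs-suc 0))) ≈-refl)) ⟨
  Zs 0 ⊖ X ⋆ ((Zs 0 ⊞ Zs 1) ⊞ (Ys 0 ⊞ # 0 ⋆ Hs 0))
    ≈⟨ ≈⇒⊖≈0 (Zs-eq 0) ⟩
  0# ∎
  where open SetoidReasoning seriesSetoid

BlockSeries : FPS
BlockSeries n = + totalBlocks n

BlockSeries≈ : BlockSeries ≈ Ys 0 ⊖ Zs 0
BlockSeries≈ n = trans (arrange (+ totalBlocks n) (+ (T ^^ n) blocks (H 0 0)))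
  (cong (λ t → + t ℤ.- Zs 0 n) (trans (T-iterate-blocks n 0 0) (ℕ-+0 (blocksIn n 0))))
  where
  arrange : ∀ a b → a ≡ b ℤ.- (b ℤ.- a)
  arrange = ℤSolver.solve-∀
  ℕ-+0 : ∀ m → m + 0 ≡ m
  ℕ-+0 zero    = refl
  ℕ-+0 (suc m) = cong suc (ℕ-+0 m)

⋆-zero-cong : ∀ c {e} → e ≈ 0# → c ⋆ e ≈ 0#
⋆-zero-cong c e≈0 = ≈-trans (⋆-cong {c} ≈-refl e≈0) (⋆-zeroʳ c)

BlockSeries-root : (# 1 ⊞ # 4 ⋆ X ⋆ BlockSeries) ⋆ root X (Hs 0) ≈ # 1
BlockSeries-root = ⊖≈0⇒≈ (cancelʳ _ (half X (Hs 0) ⋆ half X (Hs 0)) u²₀≢0 (begin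
  ((# 1 ⊞ # 4 ⋆ X ⋆ BlockSeries) ⋆ root X (Hs 0) ⊖ # 1) ⋆ (half X (Hs 0) ⋆ half X (Hs 0))
    ≈⟨ ⋆-cong {c = half X (Hs 0) ⋆ half X (Hs 0)} (⊖-cong {c = # 1} (⋆-cong {c = root X (Hs 0)}
         (⊞-cong {# 1} ≈-refl (⋆-cong {# 4 ⋆ X} ≈-refl BlockSeries≈)) ≈-refl) ≈-refl) ≈-refl ⟩
  ((# 1 ⊞ # 4 ⋆ X ⋆ (Ys 0 ⊖ Zs 0)) ⋆ root X (Hs 0) ⊖ # 1) ⋆ (half X (Hs 0) ⋆ half X (Hs 0))
    ≈⟨ elimination X (Hs 0) (Ys 0) (Δs 0) (Zs 0) ⟩
  _ ≈⟨ ⊖-cong (⊖-cong (⊞-cong (⋆-zero-cong _ quadric≈0) (⋆-zero-cong _ blocks≈0))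
         (⋆-zero-cong _ Δs≈0)) (⋆-zero-cong _ Zs≈0) ⟩
  ((0# ⊞ 0#) ⊖ 0#) ⊖ 0#
    ≈⟨ solve 0 (((:# 0 :+ :# 0) :- :# 0) :- :# 0 := :# 0) ≈-refl ⟩
  0# ∎))
  where
  open SetoidReasoning seriesSetoid
  u₀ : half X (Hs 0) 0 ≡ + 1
  u₀ = cong₂ (λ a b → (+ 1 ℤ.- a) ℤ.- b) (trans (⋆-zero (# 2) X) refl)
    (trans (⋆-zero (# 2 ⋆ X ⋆ X) (Hs 0)) (cong (ℤ._* + 1) (trans (⋆-zero (# 2 ⋆ X) X) (cong (ℤ._* + 0) (⋆-zero (# 2) X)))))
  u²₀≢0 : (half X (Hs 0) ⋆ half X (Hs 0)) 0 ≢ + 0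
  u²₀≢0 eq with trans (sym (trans (⋆-zero (half X (Hs 0)) (half X (Hs 0))) (cong₂ ℤ._*_ u₀ u₀))) eq
  ... | ()

P≈ : P ≈ # 1 ⊖ # 8 ⋆ X ⊞ # 8 ⋆ X ⋆ X
P≈ n = sym (trans (cong₂ (λ a b → (# 1 n ℤ.- a) ℤ.+ b) (constant-⋆ (+ 8) X n)
    (trans (⋆-assoc (# 8) X X n) (constant-⋆ (+ 8) (X ⋆ X) n))) (value n))
  where
  value : ∀ n → (# 1 n ℤ.- + 8 ℤ.* X n) ℤ.+ + 8 ℤ.* (X ⋆ X) n ≡ P n
  value zero    rewrite X-zero X = refl
  value (suc n) rewrite X-suc X n = shifted n
    where
    shifted : ∀ n → (# 1 (suc n) ℤ.- + 8 ℤ.* X (suc n)) ℤ.+ + 8 ℤ.* X n ≡ P (suc n)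
    shifted zero          = refl
    shifted (suc zero)    = refl
    shifted (suc (suc n)) = refl

root-square : root X (Hs 0) ⋆ root X (Hs 0) ≈ P
root-square = ≈-trans (⊖≈0⇒≈ (≈-trans (root-square-quadric X (Hs 0)) (⋆-zero-cong _ quadric≈0))) (≈-sym P≈)

root₀ : root X (Hs 0) 0 ≡ + 1
root₀ = cong₂ (λ a b → (+ 1 ℤ.- a) ℤ.- b) (⋆-zero (# 4) X)
  (trans (⋆-zero (# 4 ⋆ X ⋆ X) (Hs 0)) (cong (ℤ._* + 1) (trans (⋆-zero (# 4 ⋆ X) X) (cong (ℤ._* + 0) (⋆-zero (# 4) X)))))

root-unique : ∀ (S R : FPS) → S 0 ≡ + 1 → R 0 ≡ + 1 → S ⋆ S ≈ R ⋆ R → S ≈ R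
root-unique S R S₀ R₀ eq = ⊖≈0⇒≈ (cancelʳ (S ⊖ R) (S ⊞ R) sum₀≢0
  (≈-trans (solve 2 (λ s r → (s :- r) :* (s :+ r) := s :* s :- r :* r) ≈-refl S R) (≈⇒⊖≈0 eq)))
  where
  sum₀≢0 : (S ⊞ R) 0 ≢ + 0
  sum₀≢0 p with trans (sym (cong₂ ℤ._+_ S₀ R₀)) p
  ... | ()

W-step : (# 1 ⊖ X) ⋆ Wser ≈ X ⋆ (# 1 ⊞ # 2 ⋆ X ⋆ BlockSeries)
W-step = ≈-trans (solve 2 (λ x w → (:# 1 :- x) :* w := w :- x :* w) ≈-refl X Wser) coefficient
  where
  coefficient : Wser ⊖ X ⋆ Wser ≈ X ⋆ (# 1 ⊞ # 2 ⋆ X ⋆ BlockSeries)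
  coefficient zero = trans (cong (λ t → + 0 ℤ.- t) (X-zero Wser)) (sym (X-zero (# 1 ⊞ # 2 ⋆ X ⋆ BlockSeries)))
  coefficient (suc zero) = trans (cong (λ t → + w 1 ℤ.- t) (X-suc Wser 0))
    (sym (trans (X-suc (# 1 ⊞ # 2 ⋆ X ⋆ BlockSeries) 0)
      (cong (ℤ._+_ (+ 1)) (trans (⋆-assoc (# 2) X BlockSeries 0)
        (trans (constant-⋆ (+ 2) (X ⋆ BlockSeries) 0) (cong (ℤ._*_ (+ 2)) (X-zero BlockSeries)))))))
  coefficient (suc (suc n)) = trans
    (cong₂ ℤ._-_ (trans (cong +_ (w-step n)) (cong (ℤ._+_ (+ w (suc n))) (ℤ.pos-* 2 (totalBlocks n)))) (X-suc Wser (suc n)))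
    (trans (arrange (+ w (suc n)) (+ 2 ℤ.* + totalBlocks n))
      (sym (trans (X-suc (# 1 ⊞ # 2 ⋆ X ⋆ BlockSeries) (suc n))
        (trans (ℤ.+-identityˡ _) (trans (⋆-assoc (# 2) X BlockSeries (suc n))
          (trans (constant-⋆ (+ 2) (X ⋆ BlockSeries) (suc n)) (cong (ℤ._*_ (+ 2)) (X-suc BlockSeries n))))))))
    where
    arrange : ∀ a b → (a ℤ.+ b) ℤ.- a ≡ b
    arrange = ℤSolver.solve-∀

generating-function : (S : FPS) → S 0 ≡ + 1 → ((n : ℕ) → (S ⊛ S) n ≡ P n) →
  (n : ℕ) → ((twoOneMinusX ⊛ S) ⊛ Wser) n ≡ (X ⊛ (One ⊕ S)) n
generating-function S S₀ S² = begin
  (twoOneMinusX ⊛ S) ⊛ Wser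
    ≈⟨ ⊛-cong {c = Wser} (⊛-cong {c = S} two ≈-refl) ≈-refl ⟩
  ((# 2 ⋆ (# 1 ⊖ X)) ⊛ S) ⊛ Wser
    ≈⟨ ⊛-cong {c = Wser} (⋆≈⊛ (# 2 ⋆ (# 1 ⊖ X)) S) ≈-refl ⟨
  ((# 2 ⋆ (# 1 ⊖ X)) ⋆ S) ⊛ Wser
    ≈⟨ ⋆≈⊛ ((# 2 ⋆ (# 1 ⊖ X)) ⋆ S) Wser ⟨
  # 2 ⋆ (# 1 ⊖ X) ⋆ S ⋆ Wser
    ≈⟨ solve 3 (λ x s w → :# 2 :* (:# 1 :- x) :* s :* w := :# 2 :* s :* ((:# 1 :- x) :* w)) ≈-refl X S Wser ⟩
  # 2 ⋆ S ⋆ ((# 1 ⊖ X) ⋆ Wser)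
    ≈⟨ ⋆-cong {# 2 ⋆ S} ≈-refl W-step ⟩
  # 2 ⋆ S ⋆ (X ⋆ (# 1 ⊞ # 2 ⋆ X ⋆ BlockSeries))
    -- Writing `2 S` as `S + S` collects the product `(1 + 4 X BlockSeries) S`, which equals 1 by
    -- `BlockSeries-root`.
    ≈⟨ solve 3 (λ x s b → :# 2 :* s :* (x :* (:# 1 :+ :# 2 :* x :* b)) := x :* ((:# 1 :+ :# 4 :* x :* b) :* s :+ s))
         ≈-refl X S BlockSeries ⟩
  X ⋆ ((# 1 ⊞ # 4 ⋆ X ⋆ BlockSeries) ⋆ S ⊞ S)
    ≈⟨ ⋆-cong {X} ≈-refl (⊞-cong {u = S} (≈-trans (⋆-cong {# 1 ⊞ # 4 ⋆ X ⋆ BlockSeries} ≈-refl S≈root)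
         (≈-trans BlockSeries-root one)) ≈-refl) ⟩
  X ⋆ (One ⊕ S)
    ≈⟨ ⋆≈⊛ X (One ⊕ S) ⟩
  X ⊛ (One ⊕ S) ∎
  where
  open SetoidReasoning seriesSetoid
  S≈root : S ≈ root X (Hs 0)
  S≈root = root-unique S (root X (Hs 0)) S₀ root₀
    (≈-trans (⋆≈⊛ S S) (≈-trans S² (≈-sym root-square)))
  one : # 1 ≈ One
  one zero    = refl
  one (suc n) = refl
  two : twoOneMinusX ≈ # 2 ⋆ (# 1 ⊖ X)
  two n = sym (trans (constant-⋆ (+ 2) (# 1 ⊖ X) n) (value n))
    where
    value : ∀ n → + 2 ℤ.* (# 1 n ℤ.- X n) ≡ twoOneMinusX n
    value zero          = refl
    value (suc zero)    = refl
    value (suc (suc n)) = refl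

theorem5 : ((n : ℕ) → 1 ≤ n →
    w n ≡ sumFromTo 0 (n ∸ 1) (λ d → 2 ^ d * e n d)
    + sumFromTo 3 n (λ j → sumFromTo 0 (j ∸ 3) (λ d → 2 ^ d * g j d)))
    × (w 1 ≡ 1 × w 2 ≡ 3 × w 3 ≡ 13 × w 4 ≡ 69 × w 5 ≡ 401
    × w 6 ≡ 2433 × w 7 ≡ 15121 × w 8 ≡ 95441)
    × ((S : FPS) → S 0 ≡ + 1 → ((n : ℕ) → (S ⊛ S) n ≡ P n) →
    (n : ℕ) → ((twoOneMinusX ⊛ S) ⊛ Wser) n ≡ (X ⊛ (One ⊕ S)) n)
theorem5 = w-by-descents , w-values , generating-function
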